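{- Let $r$ be a positive integer, let $\gamma$ be an $r$-core, and let $\mathbf{RH}(\gamma)$ be the set of partitions $\lambda$ with $\gamma\le_r\lambda$. Then for any $m,n\in\mathbb{N}$ there exists a bijection between on one side the $m\times n$ matrices $A=(A_{i,j})_{0\le i<m,\,0\le j<n}$ with entries in $\mathbb{N}^r$, and on the other side the pairs $(P,Q)$ of semistandard $r$-ribbon tableaux of equal shape $\lambda/\gamma$ for some $\lambda\in\mathbf{RH}(\gamma)$ ($P$ having $n$ steps and $Q$ having $m$ steps), such that whenever $A$ corresponds to $(P,Q)$ one has $$\mathrm{wt}(P)=\Bigl(\sum_{i=0}^{m-1}|A_{i,j}|\Bigr)_{0\le j<n},\qquad \mathrm{wt}(Q)=\Bigl(\sum_{j=0}^{n-1}|A_{i,j}|\Bigr)_{0\le i<m},$$ $$\mathrm{spin}(P)+\mathrm{spin}(Q)=\sum_{i=0}^{m-1}\sum_{j=0}^{n-1}\mathrm{n}(A_{i,j}).$$ Moreover the correspondence (the family of these bijections, for all $m,n$) is symmetric: if $A$ is mapped to $(P,Q)$, then the transpose matrix $A^{\mathrm t}$ is mapped to $(Q,P)$.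
   Context: $\mathbb{N}=\{0,1,2,\dots\}$. For $a=(a_0,\dots,a_{r-1})\in\mathbb{N}^r$ put $|a|=\sum_{i=0}^{r-1}a_i$ and $\mathrm{n}(a)=\sum_{i=0}^{r-1}i\,a_i$. Partitions are identified with their Young diagrams (square $(i,j)$ in row $i$, column $j$, both numbered from $0$; rows numbered downwards). Diagonal $d_k$ is $\{(i,j):j-i=k\}$. For partitions $\lambda\subset\mu$, $\mu/\lambda$ is an $r$-ribbon (written $\lambda\prec_r\mu$) if the skew diagram consists of exactly one square on each of $r$ consecutive diagonals; its head is its top-rightmost square, and its height is one less than the number of rows it meets. $\le_r$ is the reflexive transitive closure of $\prec_r$; an $r$-core is a minimal element for $\le_r$ (a partition from which no $r$-ribbon can be removed). The sets $\mathbf{RH}(\gamma)$ are the connected components of the poset of partitions ordered by $\le_r$. $\mu/\lambda$ is a horizontal $r$-ribbon strip, written $\lambda\leftharpoondown_r\mu$, if there is a (possibly trivial) chain $\lambda=\lambda^{(0)}\prec_r\lambda^{(1)}\prec_r\cdots\prec_r\lambda^{(p)}=\mu$ such that, with $d_{k_t}$ the diagonal containing the head of $\lambda^{(t)}/\lambda^{(t-1)}$, one has $k_1<k_2<\cdots<k_p$. The chain is then unique and called the standardisation of $\mu/\lambda$; put $|\mu/\lambda|_r=p$, and $\mathrm{spin}(\mu/\lambda)=\frac12\sum_{t=1}^p\mathrm{ht}(\lambda^{(t)}/\lambda^{(t-1)})$, where $\mathrm{ht}$ is the height. A semistandard $r$-ribbon tableau of shape $\lambda/\gamma$ with $n$ steps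 is a sequence $P=(\gamma=\lambda^0\leftharpoondown_r\lambda^1\leftharpoondown_r\cdots\leftharpoondown_r\lambda^n=\lambda)$ (repetitions allowed); $\mathrm{wt}(P)=(|\lambda^{j+1}/\lambda^j|_r)_{0\le j<n}$ and $\mathrm{spin}(P)=\sum_{j=0}^{n-1}\mathrm{spin}(\lambda^{j+1}/\lambda^j)$. -}

module Defs where

open import Data.Fin.Base using (Fin; toℕ)
open import Data.Integer.Base as ℤ using (ℤ; +_)
open import Data.List.Base as List using (List; []; _∷_; length; filter; upTo)
open import Data.List.Relation.Unary.All using (All)
open import Data.List.Relation.Unary.Linked using (Linked)
open import Data.Nat.Base using (ℕ; zero; suc; pred; _*_; _≤_; _≥_; _<_; NonZero)
open import Data.Nat.ListAction using (sum)
open import Data.Nat.Properties using (_<?_)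
open import Data.Product.Base using (_×_; _,_; proj₁; proj₂; ∃)
open import Data.Product using (∃!)
open import Data.Rational.Base as ℚ using (ℚ; 0ℚ)
open import Data.Vec.Base as Vec using (Vec; []; _∷_; lookup; tabulate)
open import Level using (0ℓ)
open import Relation.Binary.Bundles using (Setoid)
open import Relation.Binary.Construct.Closure.ReflexiveTransitive using (Star; ε; _◅_)
open import Relation.Binary.PropositionalEquality using (_≡_; refl; sym; trans)
open import Relation.Nullary.Negation.Core using (¬_)

------------------------------------------------------------------------
-- Partitions and Young diagrams

-- The conditions are irrelevant, so that partitions with the same parts
-- are propositionally equal.
record Partition : Set where
  constructor partition
  field
    parts       : List ℕ
    .positive   : All NonZero parts
    .decreasing : Linked _≥_ parts

open Partition public

nth : List ℕ → ℕ → ℕ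
nth []       _       = 0
nth (p ∷ _)  zero    = p
nth (_ ∷ ps) (suc i) = nth ps i

rowLength : Partition → ℕ → ℕ
rowLength μ i = nth (parts μ) i

Square : Set
Square = ℕ × ℕ

row col : Square → ℕ
row = proj₁
col = proj₂

diagonal : Square → ℤ
diagonal s = + col s ℤ.- + row s

infix 4 _∈_ _⊆_ _∈_/_

_∈_ : Square → Partition → Set
s ∈ μ = col s < rowLength μ (row s)

_⊆_ : Partition → Partition → Set
κ ⊆ μ = ∀ {s} → s ∈ κ → s ∈ μ

_∈_/_ : Square → Partition → Partition → Set
s ∈ μ / κ = s ∈ μ × ¬ s ∈ κ

------------------------------------------------------------------------
-- Ribbons

infix 4 _≺[_]_ _≤[_]_ _⇀[_]_

-- μ / κ is an r-ribbon; the r consecutive diagonals are those numbered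
-- start, …, start + r - 1.  For r ≥ 1 the ribbon has a unique
-- top-rightmost square, so including it adds no condition.
record _≺[_]_ (κ : Partition) (r : ℕ) (μ : Partition) : Set where
  field
    included        : κ ⊆ μ
    start           : ℤ
    confined        : ∀ {s} → s ∈ μ / κ →
                      start ℤ.≤ diagonal s × diagonal s ℤ.< start ℤ.+ + r
    onePerDiagonal  : ∀ {k} → start ℤ.≤ k → k ℤ.< start ℤ.+ + r →
                      ∃! _≡_ (λ s → s ∈ μ / κ × diagonal s ≡ k)
    head            : Square
    head∈           : head ∈ μ / κ
    head-topRight   : ∀ {s} → s ∈ μ / κ → row head ≤ row s × col s ≤ col head

open _≺[_]_ public using (head)

-- The rows that meet the skew diagram μ / κ.
rowsMet : Partition → Partition → List ℕ
rowsMet κ μ = filter (λ i → rowLength κ i <? rowLength μ i) (upTo (length (parts μ)))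

height : ∀ {r κ μ} → κ ≺[ r ] μ → ℕ
height {κ = κ} {μ} _ = pred (length (rowsMet κ μ))

_≤[_]_ : Partition → ℕ → Partition → Set
κ ≤[ r ] μ = Star _≺[ r ]_ κ μ

IsCore : ℕ → Partition → Set
IsCore r γ = ∀ κ → κ ≤[ r ] γ → κ ≡ γ

-- For an r-core γ, the component of γ is the set of partitions above it.
RH : ℕ → Partition → Partition → Set
RH r γ μ = γ ≤[ r ] μ

------------------------------------------------------------------------
-- Horizontal ribbon strips

headDiagonals : ∀ {r κ μ} → κ ≤[ r ] μ → List ℤ
headDiagonals ε       = []
headDiagonals (ρ ◅ c) = diagonal (head ρ) ∷ headDiagonals c

heights : ∀ {r κ μ} → κ ≤[ r ] μ → List ℕ
heights ε       = []
heights (ρ ◅ c) = height ρ ∷ heights c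

record _⇀[_]_ (κ : Partition) (r : ℕ) (μ : Partition) : Set where
  constructor strip
  field
    standardisation : κ ≤[ r ] μ
    increasing      : Linked ℤ._<_ (headDiagonals standardisation)

open _⇀[_]_ public

stripSize : ∀ {r κ μ} → κ ⇀[ r ] μ → ℕ
stripSize σ = length (headDiagonals (standardisation σ))

stripSpin : ∀ {r κ μ} → κ ⇀[ r ] μ → ℚ
stripSpin σ = + sum (heights (standardisation σ)) ℚ./ 2

------------------------------------------------------------------------
-- Semistandard ribbon tableaux

-- Tableau r n κ μ: semistandard r-ribbon tableaux of shape μ / κ with n steps.
data Tableau (r : ℕ) : ℕ → Partition → Partition → Set where
  []  : ∀ {κ} → Tableau r 0 κ κ
  _∷_ : ∀ {n κ ν μ} → κ ⇀[ r ] ν → Tableau r n ν μ → Tableau r (suc n) κ μ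

shapes : ∀ {r n κ μ} → Tableau r n κ μ → Vec Partition (suc n)
shapes {κ = κ} []      = κ ∷ []
shapes {κ = κ} (_ ∷ P) = κ ∷ shapes P

wt : ∀ {r n κ μ} → Tableau r n κ μ → Vec ℕ n
wt []      = []
wt (σ ∷ P) = stripSize σ ∷ wt P

spin : ∀ {r n κ μ} → Tableau r n κ μ → ℚ
spin []      = 0ℚ
spin (σ ∷ P) = stripSpin σ ℚ.+ spin P

record TableauPair (r : ℕ) (γ : Partition) (m n : ℕ) : Set where
  constructor pair
  field
    {shape} : Partition
    inRH    : RH r γ shape
    P       : Tableau r n γ shape
    Q       : Tableau r m γ shape

open TableauPair public

swapPair : ∀ {r γ m n} → TableauPair r γ m n → TableauPair r γ n m
swapPair (pair i P Q) = pair i Q P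

-- A tableau is a sequence of partitions, so two pairs are equal when their
-- sequences agree, whatever the witnesses of the strip relations.
TableauPairs : ℕ → Partition → ℕ → ℕ → Setoid 0ℓ 0ℓ
TableauPairs r γ m n = record
  { Carrier       = TableauPair r γ m n
  ; _≈_           = λ x y → shapes (P x) ≡ shapes (P y) × shapes (Q x) ≡ shapes (Q y)
  ; isEquivalence = record
    { refl  = refl , refl
    ; sym   = λ (p , q) → sym p , sym q
    ; trans = λ (p , q) (p′ , q′) → trans p p′ , trans q q′
    }
  }

------------------------------------------------------------------------
-- Matrices with entries in ℕ^r

Matrix : ℕ → ℕ → ℕ → Set
Matrix r m n = Vec (Vec (Vec ℕ r) n) m

entry : ∀ {r m n} → Matrix r m n → Fin m → Fin n → Vec ℕ r
entry A i j = lookup (lookup A i) j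

∑ : ∀ {n} → (Fin n → ℕ) → ℕ
∑ f = Vec.sum (tabulate f)

∣_∣ : ∀ {r} → Vec ℕ r → ℕ
∣ a ∣ = ∑ (λ i → lookup a i)

𝐧 : ∀ {r} → Vec ℕ r → ℕ
𝐧 a = ∑ (λ i → toℕ i * lookup a i)

{-# OPTIONS --safe #-}
-- Write a partition as the sequence of beads (vertical steps) on its boundary.
-- Adding an r-ribbon moves a bead r places to the right, and its height is the
-- number of beads jumped over.  A horizontal r-ribbon strip is then one scan of
-- the sequence from left to right through a window of r places, in which the
-- bead at the front of the window may jump to the place just behind it.
--
-- By the growth diagrams of Fomin it suffices to give, for fixed λ and μ, a
-- bijection between the (κ, a) with κ ⇀ λ, κ ⇀ μ and a ∈ ℕ^r and the ν with
-- λ ⇀ ν, μ ⇀ ν that respects sizes and spins and is symmetric in λ and μ.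
-- It is computed by scanning λ and μ simultaneously: κ is read r places ahead,
-- ν is written r places behind, and the state consists of a letter for each place
-- of the window and a stack of numbers, one for each letter that is not vacant.
-- The stack is a at the left end and is used up at the right end.  Every step is
-- reversible and preserves an energy, a sum over the pairs of letters in the
-- window and the items on the stack, which makes the spins agree.
module Submission where

open import Defs
open import Data.Bool.Base using (Bool; true; false; _∨_; if_then_else_)
open import Data.Fin.Base using (Fin; zero; suc; toℕ)
open import Data.Integer.Base as ℤ using (ℤ)
import Data.Integer.Properties as ℤ
import Data.Integer.Tactic.RingSolver as ℤ
open import Data.List.Base using (List; []; _∷_; _++_; _∷ʳ_; [_]; length; map; replicate; drop;
  reverse; filter; applyUpTo; initLast; _∷ʳ′_)
open import Data.List.Properties using (++-assoc; ++-identityʳ; length-++; length-map;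
  length-replicate; length-reverse; map-++; map-cong; map-replicate; drop-drop; drop-[]; filter-accept;
  filter-reject; unfold-reverse; reverse-injective; reverse-involutive; ∷-injective; ∷ʳ-injective)
open import Data.List.Relation.Unary.All as All using (All; []; _∷_)
import Data.List.Relation.Unary.All.Properties as All
open import Data.List.Relation.Unary.Linked as Linked using (Linked; []; [-]; _∷_)
import Data.List.Relation.Unary.Linked.Properties as Linked
open import Data.List.Reverse using (Reverse; []; _∶_∶ʳ_; reverseView)
open import Data.Nat.Base hiding (_/_)
open import Data.Nat.ListAction using (sum)
open import Data.Nat.ListAction.Properties using (sum-++)
open import Data.Nat.Properties
open import Data.Nat.Tactic.RingSolver using (solve-∀)
open import Data.Product.Base using (_×_; _,_; proj₁; proj₂; ∃; ∃₂)
open import Data.Product using (∃!)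
open import Data.Rational.Base as ℚ using ()
import Data.Rational.Properties as ℚ
open import Data.Rational.Unnormalised.Base using (mkℚᵘ; *≡*)
import Data.Rational.Unnormalised.Properties as ℚᵘ
open import Data.Sum.Base using (_⊎_; inj₁; inj₂; [_,_]′)
open import Data.Unit.Base using (⊤)
open import Data.Vec.Base as Vec using (Vec; []; _∷_; lookup; tabulate; transpose; _⊛_)
import Data.Vec.Properties as Vec
open import Function.Base using (_∘_)
open import Function.Bundles using (Bijection)
open import Relation.Binary.Bundles using (Setoid)
open import Relation.Binary.Construct.Closure.ReflexiveTransitive using (ε; _◅_; _◅◅_)
open import Relation.Binary.PropositionalEquality hiding ([_])
open import Relation.Nullary using (recompute; yes; no; contradiction; ¬_)
open import Relation.Unary using (Pred; Decidable)
open ≡-Reasoning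

-- A jump made by κ → μ alone is repeated by λ → ν between the same two places, one turn of the
-- window later, starting from the bead that κ → λ left in place; `onlyμ` remembers it, and `onlyλ`
-- does the same with λ and μ exchanged. The obstacle is a jump that κ → λ and κ → μ make together:
-- neither λ nor μ has a bead left at that place to repeat it. It is added to the top item of the
-- stack and given back further right as a common jump of λ → ν and μ → ν, from a place where both
-- hold a bead while κ has none r places ahead. A matrix entry is thus a supply of common jumps that
-- is on the stack from the start.
--
-- Stack items belong to no particular letter; only the top one is ever touched, so that a step can
-- be undone from its result. The height of an item stands for the number of beads that a common
-- jump passes, up to the correction made by the energy of the window. It counts twice, once for
-- each strip, whence the factors 2.

Word : Set
Word = List Bool

private variable
  c c′ i k m n s s′ h h′ : ℕ
  x x′ y z z′ z″ : Bool
  w w′ w″ w₁ κs κs′ λs μs νs νs′ : Word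

⟦_⟧ : Bool → ℕ
⟦ false ⟧ = 0
⟦ true  ⟧ = 1

ones : Word → ℕ
ones []      = 0
ones (b ∷ w) = ⟦ b ⟧ + ones w

full empty : ℕ → Word
full  r = replicate r true
empty r = replicate r false

-- x is read at the front of the window and y behind it; z is left at the front
-- place, and x′ enters the window.
data Advance : (x y z x′ : Bool) → ℕ → Set where
  stay : Advance x y x y 0
  move : Advance true false false true 1

-- In Scan w κs λs w′ s h, s beads jump, and they jump over h beads in total.
data Scan : Word → Word → Word → Word → ℕ → ℕ → Set where
  []  : Scan w [] [] w 0 0
  _∷_ : Advance x y z x′ c → Scan (w ∷ʳ x′) κs λs w′ s h →
        Scan (x ∷ w) (y ∷ κs) (z ∷ λs) w′ (c + s) (c * ones w + h)

Advance-functional : Advance x y z z′ c → Advance x y z z″ c′ → z′ ≡ z″ × c ≡ c′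
Advance-functional stay stay = refl , refl
Advance-functional move move = refl , refl

Scan-functional : Scan w κs λs w′ s h → Scan w κs λs w″ s′ h′ → w′ ≡ w″ × s ≡ s′ × h ≡ h′
Scan-functional [] [] = refl , refl , refl
Scan-functional (a ∷ σ) (a′ ∷ σ′) with Advance-functional a a′
... | refl , refl with Scan-functional σ σ′
...   | refl , refl , refl = refl , refl , refl

-- Letters, stacks and the steps of the simultaneous scan

-- The four scans κλ, κμ (ahead of the current place) and λν, μν (behind it) each
-- have a bit in every letter.  The letter onlyμ has the bits of κμ and λν, onlyλ
-- those of κλ and μν; vacant and laden carry the common bit of λν and μν.
-- A pending letter has both of these bits, and its next step moves both beads,
-- whereas vacant true writes its bead to ν.
data Letter : Set where
  vacant laden : Bool → Letter
  pending onlyμ onlyλ : Letter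

bitκλ bitκμ bitλν bitμν : Letter → Bool
bitκλ (laden _)  = true
bitκλ onlyλ      = true
bitκλ _          = false
bitκμ (laden _)  = true
bitκμ onlyμ      = true
bitκμ _          = false
bitλν (vacant β) = β
bitλν (laden β)  = β
bitλν pending    = true
bitλν onlyμ      = true
bitλν onlyλ      = false
bitμν (vacant β) = β
bitμν (laden β)  = β
bitμν pending    = true
bitμν onlyμ      = false
bitμν onlyλ      = true

Window Stack : Set
Window = List Letter
Stack  = List ℕ

private variable
  f f′ b b′ : Letter
  a a′ a″ : Stack
  W W′ W″ : Window
  bκ bκ′ bλ bμ bν bν′ β : Bool

-- Both strips into ν now hold a bead at the place of the front letter. If κ has a bead r places
-- ahead, the letter is laden again. Otherwise the top item decides whether the bead stays there for
-- good (`quit`) or is moved on by both strips (`hold`); the unit is taken at once, while the common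
-- jump itself is still owed by `pending`.
data Refill : (bκ : Bool) → Letter → Stack → Stack → Set where
  bead : Refill true (laden true) a a
  quit : Refill false (vacant true) (0 ∷ a) a
  hold : Refill false pending (suc i ∷ a) (i ∷ a)

-- Step f κ λ μ ν b a a′: the front letter f is replaced by b behind the window.
data Step : Letter → (bκ bλ bμ bν : Bool) → Letter → Stack → Stack → Set where
  clear   : Step (vacant β) false false false β (vacant false) a a
  enter   : Step (vacant β) true  false false β (laden false) a (0 ∷ a)
  collect : Step (laden β) false false false β (laden false) (i ∷ a) (suc i ∷ a)
  spend   : Refill bκ b a a′ → Step pending   bκ false false false b a a′
  land    : Refill bκ b a a′ → Step (laden β) bκ true  true  β     b a a′
  landμ   : Refill bκ b a a′ → Step onlyμ     bκ false true  false b a a′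
  landλ   : Refill bκ b a a′ → Step onlyλ     bκ true  false false b a a′
  splitλ  : Step (laden β) false true  false β onlyμ a a
  splitμ  : Step (laden β) false false true  β onlyλ a a
  passμ   : Step onlyμ false false false false onlyμ a a
  passλ   : Step onlyλ false false false false onlyλ a a

data Run : Window → Stack → (κs λs μs νs : Word) → Window → Stack → Set where
  []  : Run W a [] [] [] [] W a
  _∷_ : Step f bκ bλ bμ bν b a a′ → Run (W ∷ʳ b) a′ κs λs μs νs W′ a″ →
        Run (f ∷ W) a (bκ ∷ κs) (bλ ∷ λs) (bμ ∷ μs) (bν ∷ νs) W′ a″

_⟨++⟩_ : ∀ {κs λs μs νs κs′ λs′ μs′ νs′} → Run W a κs λs μs νs W′ a′ → Run W′ a′ κs′ λs′ μs′ νs′ W″ a″ →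
         Run W a (κs ++ κs′) (λs ++ λs′) (μs ++ μs′) (νs ++ νs′) W″ a″
[]      ⟨++⟩ ρ′ = ρ′
(p ∷ ρ) ⟨++⟩ ρ′ = p ∷ (ρ ⟨++⟩ ρ′)

-- Symmetry in λ and μ

mirror : Letter → Letter
mirror onlyμ = onlyλ
mirror onlyλ = onlyμ
mirror f = f

Refill-mirror : Refill bκ b a a′ → Refill bκ (mirror b) a a′
Refill-mirror bead = bead
Refill-mirror quit = quit
Refill-mirror hold = hold

Step-mirror : Step f bκ bλ bμ bν b a a′ → Step (mirror f) bκ bμ bλ bν (mirror b) a a′
Step-mirror clear     = clear
Step-mirror enter     = enter
Step-mirror collect   = collect
Step-mirror (spend q) = spend (Refill-mirror q)
Step-mirror (land q)  = land (Refill-mirror q)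
Step-mirror (landμ q) = landλ (Refill-mirror q)
Step-mirror (landλ q) = landμ (Refill-mirror q)
Step-mirror splitλ    = splitμ
Step-mirror splitμ    = splitλ
Step-mirror passμ     = passλ
Step-mirror passλ     = passμ

Run-mirror : Run W a κs λs μs νs W′ a′ → Run (map mirror W) a κs μs λs νs (map mirror W′) a′
Run-mirror []                = []
Run-mirror {W = f ∷ W} (_∷_ {b = b} p ρ) =
  Step-mirror p ∷ subst (λ V → Run V _ _ _ _ _ _ _) (map-++ mirror W [ b ]) (Run-mirror ρ)

-- Determinism of steps in both directions

Refill-functional : Refill bκ b a a′ → Refill bκ b′ a a″ → b ≡ b′ × a′ ≡ a″
Refill-functional bead bead = refl , refl
Refill-functional quit quit = refl , refl
Refill-functional hold hold = refl , refl

Refill-injective : Refill bκ b a a″ → Refill bκ′ b a′ a″ → bκ ≡ bκ′ × a ≡ a′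
Refill-injective bead bead = refl , refl
Refill-injective quit quit = refl , refl
Refill-injective hold hold = refl , refl

Step-functional : Step f bκ bλ bμ bν b a a′ → Step f bκ bλ bμ bν′ b′ a a″ → bν ≡ bν′ × b ≡ b′ × a′ ≡ a″
Step-functional clear     clear      = refl , refl , refl
Step-functional enter     enter      = refl , refl , refl
Step-functional collect   collect    = refl , refl , refl
Step-functional (spend q) (spend q′) = refl , Refill-functional q q′
Step-functional (land q)  (land q′)  = refl , Refill-functional q q′
Step-functional (landμ q) (landμ q′) = refl , Refill-functional q q′
Step-functional (landλ q) (landλ q′) = refl , Refill-functional q q′
Step-functional splitλ    splitλ     = refl , refl , refl
Step-functional splitμ    splitμ     = refl , refl , refl
Step-functional passμ     passμ      = refl , refl , refl
Step-functional passλ     passλ      = refl , refl , refl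

-- The rule is read off from `b`, `bλ` and `bμ`, and for `enter` against `collect` from whether the
-- top item is zero. What this does not recover is the bit `β` inside `vacant` and `laden`, which
-- the hypotheses on the bits supply.
Step-injective : bitλν f ≡ bitλν f′ → bitμν f ≡ bitμν f′ →
                 Step f bκ bλ bμ bν b a a″ → Step f′ bκ′ bλ bμ bν′ b a′ a″ → f ≡ f′ × bκ ≡ bκ′ × a ≡ a′
Step-injective refl e clear     clear      = refl , refl , refl
Step-injective refl e enter     enter      = refl , refl , refl
Step-injective refl e collect   collect    = refl , refl , refl
Step-injective e e′ (spend q) (spend q′) = refl , Refill-injective q q′
Step-injective refl e (land q)  (land q′)  = refl , Refill-injective q q′
Step-injective e e′ (landμ q) (landμ q′) = refl , Refill-injective q q′
Step-injective e e′ (landλ q) (landλ q′) = refl , Refill-injective q q′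
Step-injective refl e splitλ    splitλ     = refl , refl , refl
Step-injective refl e splitμ    splitμ     = refl , refl , refl
Step-injective e e′ passμ     passμ      = refl , refl , refl
Step-injective e e′ passλ     passλ      = refl , refl , refl

-- Conservation of size and energy

-- `activity` is the number of stack items that a letter accounts for. `debtκμ` is the number of
-- jumps, made by κ → μ or taken from the stack, that λ → ν has still to carry out; `debtκλ` is the
-- same for κ → λ and μ → ν. The `weight` below is the sum of the two debts.
activity debtκμ debtκλ : Letter → ℕ
activity (vacant _) = 0
activity _     = 1
debtκμ pending = 1
debtκμ onlyμ = 1
debtκμ _ = 0
debtκλ pending = 1
debtκλ onlyλ = 1
debtκλ _ = 0

occupied weight : Letter → ℕ
occupied f = ⟦ bitλν f ∨ bitμν f ⟧
weight pending = 2
weight onlyμ = 1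
weight onlyλ = 1
weight _ = 0

backPairing : Letter → Letter → ℕ
backPairing pending f = 2 * activity f
backPairing onlyμ f = ⟦ bitκμ f ⟧
backPairing onlyλ f = ⟦ bitκλ f ⟧
backPairing _ f = 0

-- Twice the energy of a pair of letters, f being closer to the front.  The
-- formula is found by solving the equations "balanced" below.
pairing : Letter → Letter → ℕ
pairing f b = weight f * occupied b + backPairing b f

∑ₗ : (Letter → ℕ) → Window → ℕ
∑ₗ g W = sum (map g W)

windowEnergy : Window → ℕ
windowEnergy []      = 0
windowEnergy (f ∷ W) = ∑ₗ (pairing f) W + windowEnergy W

stackEnergy : Stack → ℕ
stackEnergy []      = 0
stackEnergy (i ∷ a) = i * (2 * length a) + stackEnergy a

-- An item pushed on or taken from the stack has height the number of letters in
-- the rest of the window that are not vacant, whence the terms gain and loss;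
-- this reduces the conservation of energy to a statement on a single letter g
-- of the rest of the window.
record Exchange (f : Letter) (bκ bλ bμ bν : Bool) (b : Letter) (a a′ : Stack) : Set where
  constructor conserve
  field
    {cκλ cκμ cλν cμν} : ℕ
    advκλ : Advance (bitκλ f) bκ bλ (bitκλ b) cκλ
    advκμ : Advance (bitκμ f) bκ bμ (bitκμ b) cκμ
    advλν : Advance (bitλν f) bλ bν (bitλν b) cλν
    advμν : Advance (bitμν f) bμ bν (bitμν b) cμν
    gain loss : ℕ
    balanced : ∀ g → cκλ * ⟦ bitκλ g ⟧ + cκμ * ⟦ bitκμ g ⟧ + pairing f g + loss * (2 * activity g)
                   ≡ cλν * ⟦ bitλν g ⟧ + cμν * ⟦ bitμν g ⟧ + pairing g b + gain * (2 * activity g)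
    resize : activity b + length a ≡ activity f + length a′
    charge : length a ≡ activity f + n →
             stackEnergy a + gain * (2 * n) ≡ stackEnergy a′ + loss * (2 * n)
    owedκμ : cκμ + (debtκμ f + sum a) ≡ cλν + (debtκμ b + sum a′)
    owedκλ : cκλ + (debtκλ f + sum a) ≡ cμν + (debtκλ b + sum a′)

open Exchange

-- At each of the seven letters both sides of `balanced` compute to the same numeral, even while `β`
-- is a variable, so that the check of the energy function consists of `refl`.
byLetter : {T : Letter → Set} → T (vacant false) → T (vacant true) → T (laden false) → T (laden true) →
    T pending → T onlyμ → T onlyλ → ∀ g → T g
byLetter p _ _ _ _ _ _ (vacant false) = p
byLetter _ p _ _ _ _ _ (vacant true)  = p
byLetter _ _ p _ _ _ _ (laden false) = p
byLetter _ _ _ p _ _ _ (laden true)  = p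
byLetter _ _ _ _ p _ _ pending         = p
byLetter _ _ _ _ _ p _ onlyμ         = p
byLetter _ _ _ _ _ _ p onlyλ         = p

quit-charge : ∀ a → length (0 ∷ a) ≡ 1 + n → stackEnergy (0 ∷ a) + 0 ≡ stackEnergy a + 0
quit-charge _ _ = refl

hold-charge : ∀ i a → length (suc i ∷ a) ≡ 1 + n →
              stackEnergy (suc i ∷ a) + 0 ≡ stackEnergy (i ∷ a) + 1 * (2 * n)
hold-charge i a refl = identity i (length a) (stackEnergy a)
  where
  identity : ∀ i l e → suc i * (2 * l) + e + 0 ≡ i * (2 * l) + e + 1 * (2 * l)
  identity = solve-∀

collect-charge : ∀ i a → length (i ∷ a) ≡ 1 + n →
                 stackEnergy (i ∷ a) + 1 * (2 * n) ≡ stackEnergy (suc i ∷ a) + 0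
collect-charge i a eq = sym (hold-charge i a eq)

exchange : Step f bκ bλ bμ bν b a a′ → Exchange f bκ bλ bμ bν b a a′
exchange clear =
  conserve stay stay stay stay 0 0 (byLetter refl refl refl refl refl refl refl) refl (λ _ → refl) refl refl
exchange enter =
  conserve stay stay stay stay 0 0 (byLetter refl refl refl refl refl refl refl) refl (λ _ → refl) refl refl
exchange (collect {i = i} {a = a}) =
  conserve move move stay stay 1 0 (byLetter refl refl refl refl refl refl refl) refl
    (collect-charge i a) refl refl
exchange (spend bead) =
  conserve stay stay move move 0 0 (byLetter refl refl refl refl refl refl refl) refl (λ _ → refl) refl refl
exchange (spend (quit {a})) =
  conserve stay stay move move 0 0 (byLetter refl refl refl refl refl refl refl) refl (quit-charge a) refl refl
exchange (spend (hold {i} {a})) =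
  conserve stay stay move move 0 1 (byLetter refl refl refl refl refl refl refl) refl
    (hold-charge i a) refl refl
exchange (land bead) =
  conserve stay stay stay stay 0 0 (byLetter refl refl refl refl refl refl refl) refl (λ _ → refl) refl refl
exchange (land (quit {a})) =
  conserve stay stay stay stay 0 0 (byLetter refl refl refl refl refl refl refl) refl (quit-charge a) refl refl
exchange (land (hold {i} {a})) =
  conserve stay stay stay stay 0 1 (byLetter refl refl refl refl refl refl refl) refl
    (hold-charge i a) refl refl
exchange (landμ bead) =
  conserve stay stay move stay 0 0 (byLetter refl refl refl refl refl refl refl) refl (λ _ → refl) refl refl
exchange (landμ (quit {a})) =
  conserve stay stay move stay 0 0 (byLetter refl refl refl refl refl refl refl) refl (quit-charge a) refl refl
exchange (landμ (hold {i} {a})) =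
  conserve stay stay move stay 0 1 (byLetter refl refl refl refl refl refl refl) refl
    (hold-charge i a) refl refl
exchange (landλ bead) =
  conserve stay stay stay move 0 0 (byLetter refl refl refl refl refl refl refl) refl (λ _ → refl) refl refl
exchange (landλ (quit {a})) =
  conserve stay stay stay move 0 0 (byLetter refl refl refl refl refl refl refl) refl (quit-charge a) refl refl
exchange (landλ (hold {i} {a})) =
  conserve stay stay stay move 0 1 (byLetter refl refl refl refl refl refl refl) refl
    (hold-charge i a) refl refl
exchange splitλ =
  conserve stay move stay stay 0 0 (byLetter refl refl refl refl refl refl refl) refl (λ _ → refl) refl refl
exchange splitμ =
  conserve move stay stay stay 0 0 (byLetter refl refl refl refl refl refl refl) refl (λ _ → refl) refl refl
exchange passμ =
  conserve stay move move stay 0 0 (byLetter refl refl refl refl refl refl refl) refl (λ _ → refl) refl refl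
exchange passλ =
  conserve move stay stay move 0 0 (byLetter refl refl refl refl refl refl refl) refl (λ _ → refl) refl refl

resize-forward : Exchange f bκ bλ bμ bν b a a′ → length a ≡ activity f + n → length a′ ≡ activity b + n
resize-forward {f} {b = b} {a = a} {a′ = a′} {n} X len = +-cancelˡ-≡ (activity f) _ _ (begin
  activity f + length a′         ≡⟨ resize X ⟨
  activity b + length a          ≡⟨ cong (activity b +_) len ⟩
  activity b + (activity f + n)  ≡⟨ +-assoc (activity b) _ n ⟨
  activity b + activity f + n    ≡⟨ cong (_+ n) (+-comm (activity b) _) ⟩
  activity f + activity b + n    ≡⟨ +-assoc (activity f) _ n ⟩
  activity f + (activity b + n)  ∎)

resize-backward : Exchange f bκ bλ bμ bν b a a′ → length a′ ≡ activity b + n → length a ≡ activity f + n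
resize-backward {f} {b = b} {a = a} {a′ = a′} {n} X len = +-cancelˡ-≡ (activity b) _ _ (begin
  activity b + length a          ≡⟨ resize X ⟩
  activity f + length a′          ≡⟨ cong (activity f +_) len ⟩
  activity f + (activity b + n)  ≡⟨ +-assoc (activity f) _ n ⟨
  activity f + activity b + n    ≡⟨ cong (_+ n) (+-comm (activity f) _) ⟩
  activity b + activity f + n    ≡⟨ +-assoc (activity b) _ n ⟩
  activity b + (activity f + n)  ∎)

∑ₗ-snoc : ∀ g W → ∑ₗ g (W ∷ʳ b) ≡ g b + ∑ₗ g W
∑ₗ-snoc {b} g W = begin
  sum (map g (W ∷ʳ b))      ≡⟨ cong sum (map-++ g W [ b ]) ⟩
  sum (map g W ++ [ g b ])  ≡⟨ sum-++ (map g W) [ g b ] ⟩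
  ∑ₗ g W + (g b + 0)        ≡⟨ cong (∑ₗ g W +_) (+-identityʳ (g b)) ⟩
  ∑ₗ g W + g b              ≡⟨ +-comm (∑ₗ g W) (g b) ⟩
  g b + ∑ₗ g W              ∎

windowEnergy-snoc : ∀ W → windowEnergy (W ∷ʳ b) ≡ ∑ₗ (λ g → pairing g b) W + windowEnergy W
windowEnergy-snoc [] = refl
windowEnergy-snoc {b} (f ∷ W) = begin
  ∑ₗ (pairing f) (W ∷ʳ b) + windowEnergy (W ∷ʳ b)
    ≡⟨ cong₂ _+_ (∑ₗ-snoc (pairing f) W) (windowEnergy-snoc W) ⟩
  pairing f b + ∑ₗ (pairing f) W + (∑ₗ (λ g → pairing g b) W + windowEnergy W)
    ≡⟨ identity (pairing f b) _ _ _ ⟩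
  pairing f b + ∑ₗ (λ g → pairing g b) W + (∑ₗ (pairing f) W + windowEnergy W) ∎
  where
  identity : ∀ p q r s → p + q + (r + s) ≡ p + r + (q + s)
  identity = solve-∀

∑ₗ-linear : ∀ c d e (p q : Letter → Bool) t W →
            ∑ₗ (λ g → c * ⟦ p g ⟧ + d * ⟦ q g ⟧ + t g + e * (2 * activity g)) W ≡
            c * ones (map p W) + d * ones (map q W) + ∑ₗ t W + e * (2 * ∑ₗ activity W)
∑ₗ-linear c d e p q t [] = identity c d e
  where
  identity : ∀ c d e → 0 ≡ c * 0 + d * 0 + 0 + e * (2 * 0)
  identity = solve-∀
∑ₗ-linear c d e p q t (g ∷ W) =
  trans (cong (_ +_) (∑ₗ-linear c d e p q t W)) (identity c d e ⟦ p g ⟧ ⟦ q g ⟧ (t g) (activity g) _ _ _ _)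
  where
  identity : ∀ c d e p q t l p′ q′ t′ l′ →
             c * p + d * q + t + e * (2 * l) + (c * p′ + d * q′ + t′ + e * (2 * l′)) ≡
             c * (p + p′) + d * (q + q′) + (t + t′) + e * (2 * (l + l′))
  identity = solve-∀

-- This is `balanced` summed over `W`, whose number of active letters is the height `n` of `charge`.
-- Gain and loss stand on opposite sides of the two equations, so both are added to each side and
-- cancelled at the end.
exchange-energy : (x : Exchange f bκ bλ bμ bν b a a′) → ∀ W → length a ≡ activity f + ∑ₗ activity W →
  cκλ x * ones (map bitκλ W) + cκμ x * ones (map bitκμ W) + (windowEnergy (f ∷ W) + stackEnergy a) ≡
  cλν x * ones (map bitλν W) + cμν x * ones (map bitμν W) + (windowEnergy (W ∷ʳ b) + stackEnergy a′)
exchange-energy {f} {b = b} {a} {a′} x W len = cancel (cκλ x * ones (map bitκλ W) + cκμ x * ones (map bitκμ W))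
  (cλν x * ones (map bitλν W) + cμν x * ones (map bitμν W)) (∑ₗ (pairing f) W) (∑ₗ (λ g → pairing g b) W)
      (windowEnergy W)
  (gain x) (loss x) (∑ₗ activity W) (windowEnergy-snoc W)
  (trans (sym (∑ₗ-linear (cκλ x) (cκμ x) (loss x) bitκλ bitκμ (pairing f) W))
    (trans (cong sum (map-cong (balanced x) W))
           (∑ₗ-linear (cλν x) (cμν x) (gain x) bitλν bitμν (λ g → pairing g b) W)))
  (charge x len)
  where
  cancel : ∀ i i′ t t′ e {e′ σ σ′} p q l → e′ ≡ t′ + e →
           i + t + q * (2 * l) ≡ i′ + t′ + p * (2 * l) → σ + p * (2 * l) ≡ σ′ + q * (2 * l) →
           i + (t + e + σ) ≡ i′ + (e′ + σ′)
  cancel i i′ t t′ e {σ = σ} {σ′} p q l refl eq₁ eq₂ =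
    +-cancelʳ-≡ (q * (2 * l) + p * (2 * l)) _ _ (begin
      i + (t + e + σ) + (q * (2 * l) + p * (2 * l))
        ≡⟨ identity (i) t e σ _ _ ⟩
      (i + t + q * (2 * l)) + e + (σ + p * (2 * l))
        ≡⟨ cong₂ (λ y z → y + e + z) eq₁ eq₂ ⟩
      (i′ + t′ + p * (2 * l)) + e + (σ′ + q * (2 * l))
        ≡⟨ identity′ (i′) t′ e σ′ (p * (2 * l)) (q * (2 * l)) ⟩
      i′ + (t′ + e + σ′) + (q * (2 * l) + p * (2 * l)) ∎)
    where
    identity : ∀ i t e σ y z → i + (t + e + σ) + (y + z) ≡ (i + t + y) + e + (σ + z)
    identity = solve-∀
    identity′ : ∀ i t e σ y z → (i + t + y) + e + (σ + z) ≡ i + (t + e + σ) + (z + y)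
    identity′ = solve-∀

record Balance (W : Window) (a : Stack) (κs λs μs νs : Word) (W′ : Window) (a′ : Stack) : Set where
  field
    {sκλ sκμ sλν sμν hκλ hκμ hλν hμν} : ℕ
    scanκλ : Scan (map bitκλ W) κs λs (map bitκλ W′) sκλ hκλ
    scanκμ : Scan (map bitκμ W) κs μs (map bitκμ W′) sκμ hκμ
    scanλν : Scan (map bitλν W) λs νs (map bitλν W′) sλν hλν
    scanμν : Scan (map bitμν W) μs νs (map bitμν W′) sμν hμν
    sizeκμ : sκμ + (∑ₗ debtκμ W + sum a) ≡ sλν + (∑ₗ debtκμ W′ + sum a′)
    sizeκλ : sκλ + (∑ₗ debtκλ W + sum a) ≡ sμν + (∑ₗ debtκλ W′ + sum a′)
    fits   : length a′ ≡ ∑ₗ activity W′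
    energy : hκλ + hκμ + (windowEnergy W + stackEnergy a) ≡ hλν + hμν + (windowEnergy W′ + stackEnergy a′)

snocScan : ∀ (bit : Letter → Bool) W → Advance (bit f) x y (bit b) c → Scan (map bit (W ∷ʳ b)) κs λs w′ s h →
           Scan (map bit (f ∷ W)) (x ∷ κs) (y ∷ λs) w′ (c + s) (c * ones (map bit W) + h)
snocScan {b = b} bit W α σ = α ∷ subst (λ β → Scan β _ _ _ _ _) (map-++ bit W [ b ]) σ

balance : Run W a κs λs μs νs W′ a′ → length a ≡ ∑ₗ activity W → Balance W a κs λs μs νs W′ a′
balance [] len = record
  { scanκλ = [] ; scanκμ = [] ; scanλν = [] ; scanμν = []
  ; sizeκμ = refl ; sizeκλ = refl ; fits = len ; energy = refl
  }
balance {f ∷ W} {a} (_∷_ {b = b} {a′ = a′} p ρ) len = record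
  { scanκλ = snocScan bitκλ W (advκλ X) (Balance.scanκλ B)
  ; scanκμ = snocScan bitκμ W (advκμ X) (Balance.scanκμ B)
  ; scanλν = snocScan {f = f} bitλν W (advλν X) (Balance.scanλν B)
  ; scanμν = snocScan {f = f} bitμν W (advμν X) (Balance.scanμν B)
  ; sizeκμ = size (cκμ X) (cλν X) (Balance.sκμ B) (Balance.sλν B) (debtκμ f) (debtκμ b) (sum a) (sum a′)
      (∑ₗ-snoc debtκμ W) (owedκμ X) (Balance.sizeκμ B)
  ; sizeκλ = size (cκλ X) (cμν X) (Balance.sκλ B) (Balance.sμν B) (debtκλ f) (debtκλ b) (sum a) (sum a′)
      (∑ₗ-snoc debtκλ W) (owedκλ X) (Balance.sizeκλ B)
  ; fits = Balance.fits B
  ; energy = total (cκλ X * ones (map bitκλ W)) (cκμ X * ones (map bitκμ W)) (cλν X * ones (map bitλν W))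
      (cμν X * ones (map bitμν W))
             (Balance.hκλ B) (Balance.hκμ B) (Balance.hλν B) (Balance.hμν B) (exchange-energy X W len)
                 (Balance.energy B)
  }
  where
  X = exchange p
  B = balance ρ (trans (resize-forward X len) (sym (∑ₗ-snoc activity W)))
  size : ∀ c c′ s s′ d d′ t t′ {e e′ k} → e′ ≡ d′ + e → c + (d + t) ≡ c′ + (d′ + t′) →
         s + (e′ + t′) ≡ s′ + k → c + s + (d + e + t) ≡ c′ + s′ + k
  size c c′ s s′ d d′ t t′ {e} {k = k} refl eq₁ eq₂ = begin
    c + s + (d + e + t)          ≡⟨ identity c s d e t ⟩
    (c + (d + t)) + s + e        ≡⟨ cong (λ y → y + s + e) eq₁ ⟩
    (c′ + (d′ + t′)) + s + e     ≡⟨ identity′ c′ d′ t′ s e ⟩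
    c′ + (s + (d′ + e + t′))     ≡⟨ cong (c′ +_) eq₂ ⟩
    c′ + (s′ + k)                ≡⟨ sym (+-assoc c′ s′ k) ⟩
    c′ + s′ + k                  ∎
    where
    identity : ∀ c s d e t → c + s + (d + e + t) ≡ (c + (d + t)) + s + e
    identity = solve-∀
    identity′ : ∀ c d t s e → (c + (d + t)) + s + e ≡ c + (s + (d + e + t))
    identity′ = solve-∀
  total : ∀ i j i′ j′ k l k′ l′ {e e′ e″} → i + j + e ≡ i′ + j′ + e′ → k + l + e′ ≡ k′ + l′ + e″ →
          i + k + (j + l) + e ≡ i′ + k′ + (j′ + l′) + e″
  total i j i′ j′ k l k′ l′ {e} {e′} {e″} eq₁ eq₂ = begin
    i + k + (j + l) + e         ≡⟨ identity i k j l e ⟩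
    (i + j + e) + (k + l)       ≡⟨ cong (_+ (k + l)) eq₁ ⟩
    (i′ + j′ + e′) + (k + l)    ≡⟨ identity′ (i′ + j′) e′ (k + l) ⟩
    i′ + j′ + (k + l + e′)      ≡⟨ cong (i′ + j′ +_) eq₂ ⟩
    i′ + j′ + (k′ + l′ + e″)    ≡⟨ identity″ i′ j′ k′ l′ e″ ⟩
    i′ + k′ + (j′ + l′) + e″    ∎
    where
    identity : ∀ i k j l e → i + k + (j + l) + e ≡ (i + j + e) + (k + l)
    identity = solve-∀
    identity′ : ∀ i e k → (i + e) + k ≡ i + (k + e)
    identity′ = solve-∀
    identity″ : ∀ i j k l e → i + j + (k + l + e) ≡ i + k + (j + l) + e
    identity″ = solve-∀

Run-functional : Run W a κs λs μs νs W′ a′ → Run W a κs λs μs νs′ W″ a″ →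
                 νs ≡ νs′ × W′ ≡ W″ × a′ ≡ a″
Run-functional [] [] = refl , refl , refl
Run-functional (p ∷ ρ) (p′ ∷ ρ′) with Step-functional p p′
... | refl , refl , refl with Run-functional ρ ρ′
...   | refl , refl , refl = refl , refl , refl

map-snoc-cong : ∀ (bit : Letter → Bool) W W′ → map bit W ≡ map bit W′ → bit b ≡ bit b′ →
                map bit (W ∷ʳ b) ≡ map bit (W′ ∷ʳ b′)
map-snoc-cong {b} {b′} bit W W′ eq eq′ = begin
  map bit (W ∷ʳ b)      ≡⟨ map-++ bit W [ b ] ⟩
  map bit W ∷ʳ bit b    ≡⟨ cong₂ _∷ʳ_ eq eq′ ⟩
  map bit W′ ∷ʳ bit b′  ≡⟨ map-++ bit W′ [ b′ ] ⟨
  map bit (W′ ∷ʳ b′)    ∎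

behind : x ≡ x′ → Advance x y z z′ c → Advance x′ y z z″ c′ → z′ ≡ z″
behind refl α α′ = proj₁ (Advance-functional α α′)

-- Equality of the windows is known at the right end, so the tails are compared before the first
-- step is undone. The hypotheses on the bits travel the other way: the scans λν and μν are
-- deterministic from left to right.
Run-injective : map bitλν W ≡ map bitλν W′ → map bitμν W ≡ map bitμν W′ →
                Run W a κs λs μs νs W″ a″ → Run W′ a′ κs′ λs μs νs W″ a″ →
                W ≡ W′ × a ≡ a′ × κs ≡ κs′
Run-injective _ _ [] [] = refl , refl , refl
Run-injective {f ∷ W} {f′ ∷ W′} eqλ eqμ (p ∷ ρ) (p′ ∷ ρ′)
  with ∷-injective eqλ | ∷-injective eqμ
... | eλ , eqλ′ | eμ , eqμ′
  with Run-injective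
         (map-snoc-cong bitλν W W′ eqλ′
           (behind eλ (advλν (exchange p)) (advλν (exchange p′))))
         (map-snoc-cong bitμν W W′ eqμ′
           (behind eμ (advμν (exchange p)) (advμν (exchange p′))))
         ρ ρ′
... | eqW , refl , refl with ∷ʳ-injective W W′ eqW
...   | refl , refl with Step-injective eλ eμ p p′
...     | refl , refl , refl = refl , refl , refl

-- Existence of runs, from κ forwards and from ν backwards

refill : ∀ bκ a → length a ≡ suc n → ∃₂ λ b a′ → Refill bκ b a a′
refill true  a           _ = laden true , a , bead
refill false (zero ∷ a)  _ = vacant true , a , quit
refill false (suc i ∷ a) _ = pending , i ∷ a , hold

-- A letter that is not vacant accounts for a stack item, so `len` guarantees the item that
-- `collect` or a refill inspects.
stepForward : ∀ f a → length a ≡ activity f + n →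
              Advance (bitκλ f) bκ bλ z′ c → Advance (bitκμ f) bκ bμ z″ c′ →
              ∃₂ λ bν b → ∃ λ a′ → Step f bκ bλ bμ bν b a a′
stepForward {bκ = false} (vacant β) a _ stay stay = _ , _ , _ , clear
stepForward {bκ = true}  (vacant β) a _ stay stay = _ , _ , _ , enter
stepForward {bκ = bκ} (laden β) a len stay stay = _ , _ , _ , land (proj₂ (proj₂ (refill bκ a len)))
stepForward (laden β) a _ stay move = _ , _ , _ , splitλ
stepForward (laden β) a _ move stay = _ , _ , _ , splitμ
stepForward (laden β) (i ∷ a) _ move move = _ , _ , _ , collect
stepForward {bκ = bκ} pending a len stay stay = _ , _ , _ , spend (proj₂ (proj₂ (refill bκ a len)))
stepForward {bκ = bκ} onlyμ a len stay stay = _ , _ , _ , landμ (proj₂ (proj₂ (refill bκ a len)))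
stepForward onlyμ a _ stay move = _ , _ , _ , passμ
stepForward {bκ = bκ} onlyλ a len stay stay = _ , _ , _ , landλ (proj₂ (proj₂ (refill bκ a len)))
stepForward onlyλ a _ move stay = _ , _ , _ , passλ

-- The four combinations of staying and moving in λν and μν correspond to the four rules that end
-- with a refill, and so reveal the letter that was in front.
unrefill : Advance x bλ bν true c → Advance y bμ bν true c′ → Refill bκ b a a′ →
           ∃ λ f → Step f bκ bλ bμ bν b a a′ × bitλν f ≡ x × bitμν f ≡ y
unrefill stay stay q = laden _ , land q , refl , refl
unrefill stay move q = onlyλ , landλ q , refl , refl
unrefill move stay q = onlyμ , landμ q , refl , refl
unrefill move move q = pending , spend q , refl , refl

stepBackward : ∀ b a′ → length a′ ≡ activity b + n →
               Advance x bλ bν (bitλν b) c → Advance y bμ bν (bitμν b) c′ →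
               ∃ λ f → ∃₂ λ bκ a → Step f bκ bλ bμ bν b a a′ × bitλν f ≡ x × bitμν f ≡ y
stepBackward (vacant false) _ _ stay stay = _ , _ , _ , clear , refl , refl
stepBackward (vacant true)  _ _ α β with unrefill α β quit
... | _ , p = _ , _ , _ , p
stepBackward (laden true)  _ _ α β with unrefill α β bead
... | _ , p = _ , _ , _ , p
stepBackward pending (i ∷ a) _ α β with unrefill α β hold
... | _ , p = _ , _ , _ , p
stepBackward (laden false) (zero ∷ a)  _ stay stay = _ , _ , _ , enter , refl , refl
stepBackward (laden false) (suc i ∷ a) _ stay stay = _ , _ , _ , collect , refl , refl
stepBackward onlyμ _ _ stay stay = _ , _ , _ , splitλ , refl , refl
stepBackward onlyμ _ _ move stay = _ , _ , _ , passμ , refl , refl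
stepBackward onlyλ _ _ stay stay = _ , _ , _ , splitμ , refl , refl
stepBackward onlyλ _ _ stay move = _ , _ , _ , passλ , refl , refl

runForward : ∀ W a → length a ≡ ∑ₗ activity W →
             Scan (map bitκλ W) κs λs w s h → Scan (map bitκμ W) κs μs w′ s′ h′ →
             ∃₂ λ νs W′ → ∃ λ a′ → Run W a κs λs μs νs W′ a′
runForward []      a len [] [] = _ , _ , _ , []
runForward (f ∷ W) a len [] [] = _ , _ , _ , []
runForward (f ∷ W) a len (α ∷ σ) (β ∷ τ) with stepForward f a len α β
... | bν , b , a′ , p
  with runForward (W ∷ʳ b) a′ (trans (resize-forward X len) (sym (∑ₗ-snoc activity W)))
         (rewindow bitκλ (advκλ X) α σ) (rewindow bitκμ (advκμ X) β τ)
  where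
  X = exchange p
  rewindow : ∀ (bit : Letter → Bool) → Advance x y z (bit b) c → Advance x y z z′ c′ →
             Scan (map bit W ∷ʳ z′) κs λs w s h → Scan (map bit (W ∷ʳ b)) κs λs w s h
  rewindow bit α α′ = subst (λ β → Scan β _ _ _ _ _)
    (sym (trans (map-++ bit W [ b ]) (cong (map bit W ∷ʳ_) (behind refl α α′))))
... | _ , _ , _ , ρ = _ , _ , _ , p ∷ ρ

∷ʳ≢[] : ∀ w → w ∷ʳ x ≢ []
∷ʳ≢[] []      ()
∷ʳ≢[] (_ ∷ _) ()

lastLetter : ∀ V → map bitλν V ≡ w ∷ʳ x → map bitμν V ≡ w′ ∷ʳ y →
             ∃₂ λ W b → V ≡ W ∷ʳ b × map bitλν W ≡ w × bitλν b ≡ x × map bitμν W ≡ w′ × bitμν b ≡ y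
lastLetter V eqλ eqμ with initLast V
lastLetter {w = w} _ eqλ eqμ | [] = contradiction (sym eqλ) (∷ʳ≢[] w)
lastLetter {w = w} {w′ = w′} _ eqλ eqμ | W ∷ʳ′ b
  with ∷ʳ-injective (map bitλν W) w (trans (sym (map-++ bitλν W [ b ])) eqλ)
     | ∷ʳ-injective (map bitμν W) w′ (trans (sym (map-++ bitμν W [ b ])) eqμ)
... | eλ , eλ′ | eμ , eμ′ = W , b , refl , eλ , eλ′ , eμ , eμ′

runBackward : ∀ W′ a′ → length a′ ≡ ∑ₗ activity W′ →
              Scan w λs νs (map bitλν W′) s h → Scan w′ μs νs (map bitμν W′) s′ h′ →
              ∃₂ λ W a → ∃ λ κs → Run W a κs λs μs νs W′ a′ ×
              map bitλν W ≡ w × map bitμν W ≡ w′ × length a ≡ ∑ₗ activity W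
runBackward W a len [] [] = W , a , [] , [] , refl , refl , len
runBackward W′ a′ len (α ∷ σ) (β ∷ τ) with runBackward W′ a′ len σ τ
... | V , a , κs , ρ , eqλ , eqμ , len′ with lastLetter V eqλ eqμ
... | W , b , refl , refl , refl , refl , refl with trans len′ (∑ₗ-snoc activity W)
...   | len″ with stepBackward b a len″ α β
...     | f , bκ , _ , p , refl , refl = f ∷ W , _ , _ , p ∷ ρ , refl , refl , resize-backward (exchange p) len″

rewindow : W ≡ W″ → Run W a κs λs μs νs W′ a′ → Run W″ a κs λs μs νs W′ a′
rewindow refl ρ = ρ

replicate-∷ʳ : ∀ {T : Set} k {t : T} ts → replicate k t ++ t ∷ ts ≡ t ∷ replicate k t ++ ts
replicate-∷ʳ zero    ts = refl
replicate-∷ʳ (suc k) ts = cong (_ ∷_) (replicate-∷ʳ k ts)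

replicate-snoc : ∀ {T : Set} k {t : T} → replicate k t ∷ʳ t ≡ replicate (suc k) t
replicate-snoc k = trans (replicate-∷ʳ k []) (cong (_ ∷_) (++-identityʳ _))

-- The two ends of a run

loaded cleared : ℕ → Window
loaded r  = replicate r (laden true)
cleared r = replicate r (vacant false)

data Idle : Letter → Set where
  vacant : Idle (vacant β)
  pending : Idle pending

-- Exactly the letters that a `Refill` leaves behind the window, so that each of them can be undone
-- as the result of a landing.
data Busy : Letter → Set where
  vacant : Busy (vacant true)
  pending : Busy pending
  laden : Busy (laden true)

idle : ∀ W r → map bitκλ W ≡ empty r → map bitκμ W ≡ empty r → All Idle W
idle []        _       _  _  = []
idle (vacant _ ∷ W) (suc r) e₁ e₂ = vacant ∷ idle W r (proj₂ (∷-injective e₁)) (proj₂ (∷-injective e₂))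
idle (pending ∷ W)   (suc r) e₁ e₂ = pending ∷ idle W r (proj₂ (∷-injective e₁)) (proj₂ (∷-injective e₂))
idle (laden _ ∷ W) (suc r) () _
idle (onlyλ ∷ W)   (suc r) () _
idle (onlyμ ∷ W)   (suc r) _ ()

busy : ∀ W r → map bitλν W ≡ full r → map bitμν W ≡ full r → All Busy W
busy []           _       _  _  = []
busy (vacant true ∷ W) (suc r) e₁ e₂ = vacant ∷ busy W r (proj₂ (∷-injective e₁)) (proj₂ (∷-injective e₂))
busy (laden true ∷ W) (suc r) e₁ e₂ = laden ∷ busy W r (proj₂ (∷-injective e₁)) (proj₂ (∷-injective e₂))
busy (pending ∷ W)      (suc r) e₁ e₂ = pending ∷ busy W r (proj₂ (∷-injective e₁)) (proj₂ (∷-injective e₂))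
busy (vacant false ∷ W) (suc r) () _
busy (laden false ∷ W) (suc r) () _
busy (onlyλ ∷ W)   (suc r) () _
busy (onlyμ ∷ W)   (suc r) _ ()

-- Chosen so that every change made by `settle` lowers the total by one: `pending` becomes
-- `vacant true`, which becomes `vacant false`, while `hold` keeps the letter and takes a unit from
-- the stack.
delay : Letter → ℕ
delay (vacant true) = 1
delay pending        = 2
delay _        = 0

-- Once κ, λ and μ are exhausted, a full turn of the window lowers the sum of the
-- delays and of the stack until all letters are vacant.
settle : ∀ fuel V j r a → length a ≡ ∑ₗ activity V → ∑ₗ delay V + sum a ≤ fuel → All Idle V → length V + j ≡ r →
         ∃₂ λ k νs → Run (V ++ cleared j) a (empty k) (empty k) (empty k) νs (cleared r) []
-- The front letter has changed, so a new turn begins in which all letters, also those of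
-- `cleared j`, count as unexamined. The list grows again, but a unit of fuel has been spent, and
-- the recursion is lexicographic in the fuel and the unexamined letters.
settleLater : ∀ fuel V j r a → length a ≡ activity b + ∑ₗ activity V →
    delay b + ∑ₗ delay V + sum a ≤ fuel → Idle b → All Idle V →
         suc (length V + j) ≡ r →
         ∃₂ λ k νs → Run ((V ++ cleared j) ∷ʳ b) a (empty k) (empty k) (empty k) νs (cleared r) []

∑ₗ-cleared : ∀ g → g (vacant false) ≡ 0 → ∀ V j → ∑ₗ g (V ++ cleared j) ≡ ∑ₗ g V
∑ₗ-cleared g g0 [] zero    = refl
∑ₗ-cleared g g0 [] (suc j) = cong₂ _+_ g0 (∑ₗ-cleared g g0 [] j)
∑ₗ-cleared g g0 (f ∷ V) j  = cong (g f +_) (∑ₗ-cleared g g0 V j)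

settle fuel [] j _ [] len le [] refl = 0 , [] , []
settle fuel (vacant false ∷ V) j r a len le (vacant ∷ idles) eq
  with settle fuel V (suc j) r a len le idles (trans (+-suc (length V) j) eq)
... | k , νs , ρ = suc k , false ∷ νs , clear ∷ rewindow (begin
  V ++ cleared (suc j)             ≡⟨ cong (V ++_) (replicate-snoc j) ⟨
  V ++ (cleared j ++ [ vacant false ])  ≡⟨ ++-assoc V _ _ ⟨
  (V ++ cleared j) ∷ʳ vacant false      ∎) ρ
settle (suc fuel) (vacant true ∷ V) j r a len le (vacant ∷ idles) eq
  with settleLater {vacant false} fuel V j r a len (s≤s⁻¹ le) vacant idles eq
... | k , νs , ρ = suc k , true ∷ νs , clear ∷ ρ
settle (suc fuel) (pending ∷ V) j r (0 ∷ a) len le (pending ∷ idles) eq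
  with settleLater {vacant true} fuel V j r a (suc-injective len) (s≤s⁻¹ le) vacant idles eq
... | k , νs , ρ = suc k , false ∷ νs , spend quit ∷ ρ
settle (suc fuel) (pending ∷ V) j r (suc i ∷ a) len le (pending ∷ idles) eq
  with settleLater {pending} fuel V j r (i ∷ a) len
      (s≤s⁻¹ (subst (_≤ suc fuel) (+-suc (2 + ∑ₗ delay V) (i + sum a)) le)) pending idles eq
... | k , νs , ρ = suc k , false ∷ νs , spend hold ∷ ρ

settleLater {b} fuel V j r a len le ib idles eq
  with settle fuel ((V ++ cleared j) ∷ʳ b) 0 r a
         (trans len (sym (total activity refl)))
         (subst (λ d → d + sum a ≤ fuel) (sym (total delay refl)) le)
         (All.∷ʳ⁺ (All.++⁺ idles (All.replicate⁺ j vacant)) ib)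
         (begin
           length ((V ++ cleared j) ∷ʳ b) + 0  ≡⟨ +-identityʳ _ ⟩
           length ((V ++ cleared j) ∷ʳ b)      ≡⟨ length-++ (V ++ cleared j) ⟩
           length (V ++ cleared j) + 1         ≡⟨ +-comm _ 1 ⟩
           suc (length (V ++ cleared j))       ≡⟨ cong suc (length-++ V) ⟩
           suc (length V + length (cleared j)) ≡⟨ cong (λ l → suc (length V + l)) (length-replicate j) ⟩
           suc (length V + j)                  ≡⟨ eq ⟩
           r                                   ∎)
  where
  total : ∀ g → g (vacant false) ≡ 0 → ∑ₗ g ((V ++ cleared j) ∷ʳ b) ≡ g b + ∑ₗ g V
  total g g0 = trans (∑ₗ-snoc g (V ++ cleared j)) (cong (g b +_) (∑ₗ-cleared g g0 V j))
... | k , νs , ρ = k , νs , rewindow (++-identityʳ _) ρ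

-- To the left of ν all places hold beads; undoing one step for each letter makes
-- them all laden.
load : ∀ j r → Reverse W → All Busy W → length a ≡ ∑ₗ activity W + j → j + length W ≡ r →
       Run (loaded j ++ W) a κs λs μs νs W′ a′ →
       ∃₂ λ k a₀ → ∃ λ κs → Run (loaded r) a₀ κs (full k ++ λs) (full k ++ μs) (full k ++ νs) W′ a′ ×
           length a₀ ≡ r
load j r [] [] len refl ρ = 0 , _ , _ ,
    rewindow (trans (++-identityʳ _) (cong loaded (sym (+-identityʳ j)))) ρ , trans len (sym (+-identityʳ j))
load {a = a} {κs = κs} {λs} {μs} {νs} {W′} {a′} j r (W ∶ rev ∶ʳ b) busies len eq ρ =
    undo (proj₂ (proj₂ (refillBack len′ (proj₂ (All.∷ʳ⁻ busies)))))
  where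
  len′ : length a ≡ activity b + (∑ₗ activity W + j)
  len′ = trans len (trans (cong (_+ j) (∑ₗ-snoc activity W)) (+-assoc (activity b) _ j))
  eq′ : suc j + length W ≡ r
  eq′ = trans (sym (trans (cong (j +_) (trans (length-++ W) (+-comm _ 1))) (+-suc j _))) eq
  undo : ∀ {a₁ bκ} → Refill bκ b a₁ a →
         ∃₂ λ k a₀ → ∃ λ κs → Run (loaded r) a₀ κs (full k ++ λs) (full k ++ μs) (full k ++ νs) W′ a′ ×
             length a₀ ≡ r
  undo q
    with load (suc j) r rev (proj₁ (All.∷ʳ⁻ busies))
              (trans (resize-backward (exchange (land {β = true} q)) len′) (sym (+-suc (∑ₗ activity W) j))) eq′
              (land {β = true} q ∷ rewindow (sym (++-assoc (loaded j) W [ b ])) ρ)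
  ... | k , a₀ , κs′ , ρ′ , len″ = suc k , a₀ , κs′ ,
        subst (λ e → Run _ _ _ e (full (suc k) ++ μs) (full (suc k) ++ νs) _ _) (replicate-∷ʳ k λs)
        (subst (λ e → Run _ _ _ (full k ++ true ∷ λs) e (full (suc k) ++ νs) _ _) (replicate-∷ʳ k μs)
        (subst (λ e → Run _ _ _ (full k ++ true ∷ λs) (full k ++ true ∷ μs) e _ _) (replicate-∷ʳ k νs)
            ρ′)) , len″
  refillBack : ∀ {a b} → length a ≡ activity b + n → Busy b → ∃₂ λ bκ a₁ → Refill bκ b a₁ a
  refillBack _ vacant = _ , _ , quit
  refillBack {a = i ∷ a} _ pending = _ , _ , hold
  refillBack _ laden = _ , _ , bead

padLeft : ∀ p r → Run (loaded (suc r)) a κs λs μs νs W′ a′ →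
          Run (loaded (suc r)) a (full p ++ κs) (full p ++ λs) (full p ++ μs) (full p ++ νs) W′ a′
padLeft zero    r ρ = ρ
padLeft (suc p) r ρ = land bead ∷ rewindow (sym (replicate-snoc r)) (padLeft p r ρ)

rest : ∀ q r → Run (cleared (suc r)) [] (empty q) (empty q) (empty q) (empty q) (cleared (suc r)) []
rest zero    r = []
rest (suc q) r = clear ∷ rewindow (sym (replicate-snoc r)) (rest q r)

pad : ℕ → ℕ → Word → Word
pad p q w = full p ++ (w ++ empty q)

padRun : ∀ p q r → Run (loaded (suc r)) a κs λs μs νs (cleared (suc r)) [] →
         Run (loaded (suc r)) a (pad p q κs) (pad p q λs) (pad p q μs) (pad p q νs) (cleared (suc r)) []
padRun p q r ρ = padLeft p r (ρ ⟨++⟩ rest q r)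

∑ₗ-loaded : ∀ g i r → g (laden true) ≡ i → ∑ₗ g (loaded r) ≡ r * i
∑ₗ-loaded g i zero    _ = refl
∑ₗ-loaded g i (suc r) e = cong₂ _+_ e (∑ₗ-loaded g i r e)

loaded-fits : ∀ (a : Stack) r → length a ≡ r → length a ≡ ∑ₗ activity (loaded r)
loaded-fits a r len = trans len (sym (trans (∑ₗ-loaded activity 1 r refl) (*-identityʳ r)))

windowEnergy-loaded : ∀ r → windowEnergy (loaded r) ≡ 0
windowEnergy-loaded zero    = refl
windowEnergy-loaded (suc r) = cong₂ _+_ (trans (∑ₗ-loaded (pairing (laden true)) 0 r refl) (*-zeroʳ r))
    (windowEnergy-loaded r)

windowEnergy-cleared : ∀ r → windowEnergy (cleared r) ≡ 0
windowEnergy-cleared zero    = refl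
windowEnergy-cleared (suc r) = cong₂ _+_ (∑ₗ-cleared (pairing (vacant false)) refl [] r)
    (windowEnergy-cleared r)

reframe : w ≡ w″ → w′ ≡ w₁ → Scan w κs λs w′ s h → Scan w″ κs λs w₁ s h
reframe refl refl σ = σ

record CellBalance (r : ℕ) (a : Stack) (κs λs μs νs : Word) : Set where
  field
    {sκλ sκμ sλν sμν hκλ hκμ hλν hμν} : ℕ
    scanκλ : Scan (full r) κs λs (empty r) sκλ hκλ
    scanκμ : Scan (full r) κs μs (empty r) sκμ hκμ
    scanλν : Scan (full r) λs νs (empty r) sλν hλν
    scanμν : Scan (full r) μs νs (empty r) sμν hμν
    sizeκμ : sκμ + sum a ≡ sλν
    sizeκλ : sκλ + sum a ≡ sμν
    energy : hκλ + hκμ + stackEnergy a ≡ hλν + hμν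

-- The windows at both ends carry neither energy nor debt, and the final stack is empty, so of the
-- boundary terms only those of the initial stack survive.
cellBalance : ∀ r → length a ≡ r → Run (loaded r) a κs λs μs νs (cleared r) [] → CellBalance r a κs λs μs νs
cellBalance {a} {κs} {λs} {μs} {νs} r len ρ = record
  { scanκλ = frame bitκλ refl refl scanκλ
  ; scanκμ = frame bitκμ refl refl scanκμ
  ; scanλν = frame bitλν refl refl scanλν
  ; scanμν = frame bitμν refl refl scanμν
  ; sizeκμ = drop₀ sκμ (sum a) (lightStart debtκμ refl) (lightEnd debtκμ refl) sizeκμ
  ; sizeκλ = drop₀ sκλ (sum a) (lightStart debtκλ refl) (lightEnd debtκλ refl) sizeκλ
  ; energy = drop₀ (hκλ + hκμ) (stackEnergy a) (windowEnergy-loaded r) (windowEnergy-cleared r) energy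
  }
  where
  open Balance (balance ρ (loaded-fits a r len))
  frame : ∀ (bit : Letter → Bool) → bit (laden true) ≡ true → bit (vacant false) ≡ false →
          Scan (map bit (loaded r)) w w′ (map bit (cleared r)) s h → Scan (full r) w w′ (empty r) s h
  frame bit e e′ = reframe (trans (map-replicate bit r _) (cong (replicate r) e))
      (trans (map-replicate bit r _) (cong (replicate r) e′))
  lightStart : ∀ g → g (laden true) ≡ 0 → ∑ₗ g (loaded r) ≡ 0
  lightStart g e = trans (∑ₗ-loaded g 0 r e) (*-zeroʳ r)
  lightEnd : ∀ g → g (vacant false) ≡ 0 → ∑ₗ g (cleared r) ≡ 0
  lightEnd g e = ∑ₗ-cleared g e [] r
  drop₀ : ∀ i j {k d e} → d ≡ 0 → e ≡ 0 → i + (d + j) ≡ k + (e + 0) → i + j ≡ k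
  drop₀ i j {k} refl refl eq = trans eq (+-identityʳ k)

-- When the words are used up, the κλ and κμ bits of the window are all gaps, which leaves only
-- `Idle` letters. `settle` then needs `q` further places to write the beads still owed to ν.
cellForward : ∀ r → length a ≡ r → Scan (full r) κs λs (empty r) s h → Scan (full r) κs μs (empty r) s′ h′ →
              ∃₂ λ q νs → Run (loaded r) a (κs ++ empty q) (λs ++ empty q) (μs ++ empty q) νs (cleared r) []
cellForward {a} {κs} {λs} {μs = μs} r len σ τ
  with runForward (loaded r) a (loaded-fits a r len)
         (reframe (sym (map-replicate bitκλ r _)) refl σ) (reframe (sym (map-replicate bitκμ r _)) refl τ)
... | νs , W , a′ , ρ = finish (settle _ W 0 r a′ fits ≤-refl (idle W r emptyκλ emptyκμ) lengthW)
  where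
  open Balance (balance ρ (loaded-fits a r len))
  emptyκλ = proj₁ (Scan-functional scanκλ (reframe (sym (map-replicate bitκλ r _)) refl σ))
  emptyκμ = proj₁ (Scan-functional scanκμ (reframe (sym (map-replicate bitκμ r _)) refl τ))
  lengthW : length W + 0 ≡ r
  lengthW = begin
    length W + 0            ≡⟨ +-identityʳ _ ⟩
    length W                ≡⟨ length-map bitκλ W ⟨
    length (map bitκλ W)    ≡⟨ cong length emptyκλ ⟩
    length (empty r)        ≡⟨ length-replicate r ⟩
    r                       ∎
  finish : ∃₂ (λ k ξs → Run (W ++ []) a′ (empty k) (empty k) (empty k) ξs (cleared r) []) → _
  finish (q , ξs , ρ′) = q , νs ++ ξs , ρ ⟨++⟩ rewindow (++-identityʳ W) ρ′

cellBackward : ∀ r → Scan (full r) λs νs (empty r) s h → Scan (full r) μs νs (empty r) s′ h′ →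
               ∃₂ λ k a → ∃ λ κs → length a ≡ r ×
               Run (loaded r) a κs (full k ++ λs) (full k ++ μs) (full k ++ νs) (cleared r) []
cellBackward r σ τ
  with runBackward (cleared r) [] (sym (∑ₗ-cleared activity refl [] r))
         (reframe refl (sym (map-replicate bitλν r _)) σ) (reframe refl (sym (map-replicate bitμν r _)) τ)
... | W , a , κs , ρ , eqλ , eqμ , len
  with load 0 r (reverseView W) (busy W r eqλ eqμ) (trans len (sym (+-identityʳ _))) lengthW ρ
  where
  lengthW : length W ≡ r
  lengthW = trans (sym (length-map bitλν W)) (trans (cong length eqλ) (length-replicate r))
... | k , a₀ , κs′ , ρ′ , len′ = k , a₀ , κs′ , len′ , ρ′

-- Partitions as boundary words

private variable
  j p q lo beads : ℕ
  u v : Word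
  γ κ κ₁ lam lam₁ μ μ₁ ν ν₁ : Partition

-- The length of row i: the boundary is read from the bottom left, so row i ends at
-- the bead that is followed by i beads, and has one square for each gap before it.
rl : Word → ℕ → ℕ
rl []          i = 0
rl (true ∷ w)  i = rl w i
rl (false ∷ w) i = if i <ᵇ ones w then suc (rl w i) else 0

rl-below : ∀ w → i < ones w → rl (false ∷ w) i ≡ suc (rl w i)
rl-below {i} w lt with i <ᵇ ones w | <⇒<ᵇ lt
... | true | _ = refl

rl-above : ∀ w → ones w ≤ i → rl w i ≡ 0
rl-above []          _  = refl
rl-above (true ∷ w)  le = rl-above w (≤-trans (n≤1+n _) le)
rl-above {i} (false ∷ w) le with i <ᵇ ones w | <ᵇ⇒< i (ones w)
... | false | _  = refl
... | true  | i< = contradiction (i< _) (≤⇒≯ le)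

rl-antitone : ∀ w i → rl w (suc i) ≤ rl w i
rl-antitone []          i = z≤n
rl-antitone (true ∷ w)  i = rl-antitone w i
rl-antitone (false ∷ w) i with suc i <? ones w
... | no  ≮ = subst (_≤ rl (false ∷ w) i) (sym (rl-above (false ∷ w) (≮⇒≥ ≮))) z≤n
... | yes i< = subst₂ _≤_ (sym (rl-below w i<)) (sym (rl-below w (≤-trans (n≤1+n _) i<)))
    (s≤s (rl-antitone w i))

rl-bounded : ∀ w i → rl w i + ones w ≤ length w
rl-bounded []          i = z≤n
rl-bounded (true ∷ w)  i = subst (_≤ suc (length w)) (sym (+-suc (rl w i) (ones w))) (s≤s (rl-bounded w i))
rl-bounded (false ∷ w) i with i <? ones w
... | no  ≮ rewrite rl-above (false ∷ w) (≮⇒≥ ≮) =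
    ≤-trans (m≤n+m (ones w) (rl w i)) (≤-trans (rl-bounded w i) (n≤1+n _))
... | yes i< rewrite rl-below w i< = s≤s (rl-bounded w i)

ones-++ : ∀ w w′ → ones (w ++ w′) ≡ ones w + ones w′
ones-++ []      w′ = refl
ones-++ (b ∷ w) w′ = trans (cong (⟦ b ⟧ +_) (ones-++ w w′)) (sym (+-assoc ⟦ b ⟧ _ _))

ones-empty : ∀ q → ones (empty q) ≡ 0
ones-empty zero    = refl
ones-empty (suc q) = ones-empty q

ones-full : ∀ p → ones (full p) ≡ p
ones-full zero    = refl
ones-full (suc p) = cong suc (ones-full p)

rl-full : ∀ p w i → rl (full p ++ w) i ≡ rl w i
rl-full zero    w i = refl
rl-full (suc p) w i = rl-full p w i

rl-++-empty : ∀ w q i → rl (w ++ empty q) i ≡ rl w i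
rl-++-empty []          q i = rl-above (empty q) (subst (_≤ i) (sym (ones-empty q)) z≤n)
rl-++-empty (true ∷ w)  q i = rl-++-empty w q i
rl-++-empty (false ∷ w) q i 
  rewrite ones-++ w (empty q) | ones-empty q | +-identityʳ (ones w) | rl-++-empty w q i = refl

ones-drop-≥ : ∀ w p → ones w ≤ p + ones (drop p w)
ones-drop-≥ w           zero    = ≤-refl
ones-drop-≥ []          (suc p) = z≤n
ones-drop-≥ (true ∷ w)  (suc p) = s≤s (ones-drop-≥ w p)
ones-drop-≥ (false ∷ w) (suc p) = ≤-trans (ones-drop-≥ w p) (n≤1+n _)

ones-drop-≤ : ∀ w p → ones (drop p w) ≤ ones w
ones-drop-≤ w           zero    = ≤-refl
ones-drop-≤ []          (suc p) = z≤n
ones-drop-≤ (b ∷ w)     (suc p) = ≤-trans (ones-drop-≤ w p) (m≤n+m (ones w) ⟦ b ⟧)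

-- The squares of the diagonal j - i = p - ones w are counted by the beads from
-- position p on.
square⇒ : ∀ w {p i j} → p + i ≡ j + ones w → j < rl w i → i < ones (drop p w)
square⇒ (true ∷ w) {zero} {i} {j} refl lt =
  contradiction (subst (j <_) (rl-above w (≤-trans (n≤1+n _) (m≤n+m (suc (ones w)) j))) lt) n≮0
square⇒ (true ∷ w) {suc p} {i} {j} eq lt = square⇒ w (suc-injective (trans eq (+-suc j (ones w)))) lt
square⇒ (false ∷ w) {zero} {i} {j} refl lt =
  contradiction (subst (j <_) (rl-above (false ∷ w) (m≤n+m (ones w) j)) lt) n≮0
square⇒ (false ∷ w) {suc p} {i} {j} eq lt with i <? ones w
... | no  ≮ = contradiction (subst (j <_) (rl-above (false ∷ w) (≮⇒≥ ≮)) lt) n≮0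
square⇒ (false ∷ w) {suc p} {i} {zero} eq lt | yes i< =
  +-cancelˡ-≤ p _ _ (subst (_≤ p + ones (drop p w)) (trans (sym eq) (sym (+-suc p i))) (ones-drop-≥ w p))
square⇒ (false ∷ w) {suc p} {i} {suc j} eq lt | yes i< =
  square⇒ w (suc-injective eq) (s<s⁻¹ (subst (suc j <_) (rl-below w i<) lt))

square⇐ : ∀ w {p i j} → p + i ≡ j + ones w → i < ones (drop p w) → j < rl w i
square⇐ [] {p} {i} eq lt = contradiction (subst (λ v → i < ones v) (drop-[] p) lt) n≮0
square⇐ (true ∷ w) {zero} {j = j} refl lt = contradiction lt (≤⇒≯ (m≤n+m (suc (ones w)) j))
square⇐ (true ∷ w) {suc p} {i} {j} eq lt = square⇐ w (suc-injective (trans eq (+-suc j (ones w)))) lt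
square⇐ (false ∷ w) {zero} {j = j} refl lt = contradiction lt (≤⇒≯ (m≤n+m (ones w) j))
square⇐ (false ∷ w) {suc p} {i} {j} eq lt =
    subst (j <_) (sym (rl-below w (<-≤-trans lt (ones-drop-≤ w p)))) (below j eq)
  where
  below : ∀ j → suc p + i ≡ j + ones w → j < suc (rl w i)
  below zero    _  = z<s
  below (suc j) eq = s<s (square⇐ w (suc-injective eq) lt)

-- When there is a bead at all, the first letter is a bead exactly if the lowest of the `ones w`
-- rows is empty.
word-unique : ∀ w w′ → length w ≡ length w′ → ones w ≡ ones w′ → (∀ i → rl w i ≡ rl w′ i) → w ≡ w′
word-unique [] [] _ _ _ = refl
word-unique (true ∷ w) (true ∷ w′) l o e =
  cong (true ∷_) (word-unique w w′ (suc-injective l) (suc-injective o) e)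
word-unique (false ∷ w) (false ∷ w′) l o e =
  cong (false ∷_) (word-unique w w′ (suc-injective l) o same)
  where
  same : ∀ i → rl w i ≡ rl w′ i
  same i with i <? ones w
  ... | no  ≮ = trans (rl-above w (≮⇒≥ ≮)) (sym (rl-above w′ (subst (_≤ i) o (≮⇒≥ ≮))))
  ... | yes i< = suc-injective (trans (sym (rl-below w i<)) (trans (e i) (rl-below w′ (subst (i <_) o i<))))
word-unique (true ∷ w) (false ∷ w′) l o e =
  contradiction (trans (sym (rl-above w ≤-refl))
      (trans (e (ones w)) (rl-below w′ (subst (ones w <_) o (n<1+n _))))) 0≢1+n
word-unique (false ∷ w) (true ∷ w′) l o e =
  contradiction (trans (sym (rl-above w′ ≤-refl))
      (trans (sym (e (ones w′))) (rl-below w (subst (ones w′ <_) (sym o) (n<1+n _))))) 0≢1+n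

-- The boundary inside a box of `A` rows and `B` columns is traced from the bottom left: if the
-- lowest row is empty, a bead is written and the row is dropped; otherwise a gap is written and the
-- first column is dropped.
wordOf : ∀ A B (f : ℕ → ℕ) → (∀ {i j} → i ≤ j → f j ≤ f i) → (∀ {i} → A ≤ i → f i ≡ 0) → (∀ i → f i ≤ B) →
         ∃ λ w → ones w ≡ A × length w ≡ A + B × (∀ i → f i ≡ rl w i)
wordOf zero B f _ zeros _ = empty B , ones-empty B , length-replicate B ,
  λ i → trans (zeros z≤n) (sym (rl-above (empty B) (subst (_≤ i) (sym (ones-empty B)) z≤n)))
wordOf (suc A) zero f _ _ bounded = full (suc A) , ones-full (suc A) ,
  trans (length-replicate (suc A)) (sym (+-identityʳ (suc A))) ,
  λ i → trans (n≤0⇒n≡0 (bounded i)) (sym (flat (suc A) i))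
  where
  flat : ∀ p i → rl (full p) i ≡ 0
  flat zero    i = refl
  flat (suc p) i = flat p i
wordOf (suc A) (suc B) f anti zeros bounded with f A in eq
... | zero with wordOf A (suc B) f anti (λ le → n≤0⇒n≡0 (subst (f _ ≤_) eq (anti le))) bounded
...   | w , o , l , e = true ∷ w , cong suc o , cong suc l , e
wordOf (suc A) (suc B) f anti zeros bounded | suc k
  with wordOf (suc A) B (pred ∘ f) (pred-mono-≤ ∘ anti) (cong pred ∘ zeros) (pred-mono-≤ ∘ bounded)
... | w , o , l , e = false ∷ w , o , trans (cong suc l) (cong suc (sym (+-suc A B))) , same
  where
  same : ∀ i → f i ≡ rl (false ∷ w) i
  same i with i <? suc A
  ... | no  ≮ = trans (zeros (≮⇒≥ ≮)) (sym (rl-above (false ∷ w) (subst (_≤ i) (sym o) (≮⇒≥ ≮))))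
  ... | yes i< = trans (sym (suc-pred (f i)
      {{>-nonZero (<-≤-trans (subst (0 <_) (sym eq) z<s) (anti (s≤s⁻¹ i<)))}}))
                  (trans (cong suc (e i)) (sym (rl-below w (subst (i <_) (sym o) i<))))

nth-applyUpTo-< : ∀ (f : ℕ → ℕ) {n i} → i < n → nth (applyUpTo f n) i ≡ f i
nth-applyUpTo-< f {suc n} {zero}  _  = refl
nth-applyUpTo-< f {suc n} {suc i} lt = nth-applyUpTo-< (f ∘ suc) (s<s⁻¹ lt)

nth-applyUpTo-≥ : ∀ (f : ℕ → ℕ) {n i} → n ≤ i → nth (applyUpTo f n) i ≡ 0
nth-applyUpTo-≥ f {zero}          _  = refl
nth-applyUpTo-≥ f {suc n} {suc i} le = nth-applyUpTo-≥ (f ∘ suc) (s≤s⁻¹ le)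

-- Beads before the first gap are empty rows and are discarded; each bead after it gives a nonempty
-- row, as `positive` demands.
fromWord : Word → Partition
fromWord []          = partition [] [] []
fromWord (true ∷ w)  = fromWord w
fromWord (false ∷ w) = partition (applyUpTo (suc ∘ rl w) (ones w))
  (All.applyUpTo⁺₂ _ (ones w) (λ _ → _)) (Linked.applyUpTo⁺₂ _ (ones w) (λ i → s≤s (rl-antitone w i)))

infix 4 _encodes_
record _encodes_ (w : Word) (μ : Partition) : Set where
  constructor encoding
  field rows : ∀ i → rowLength μ i ≡ rl w i

open _encodes_

fromWord-encodes : ∀ w → w encodes fromWord w
fromWord-encodes []         = encoding λ _ → refl
fromWord-encodes (true ∷ w) = encoding (rows (fromWord-encodes w))
fromWord-encodes (false ∷ w) = encoding rowOf
  where
  rowOf : ∀ i → nth (applyUpTo (suc ∘ rl w) (ones w)) i ≡ rl (false ∷ w) i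
  rowOf i with i <? ones w
  ... | no  ≮ = trans (nth-applyUpTo-≥ _ (≮⇒≥ ≮)) (sym (rl-above (false ∷ w) (≮⇒≥ ≮)))
  ... | yes i< = trans (nth-applyUpTo-< _ i<) (sym (rl-below w i<))

parts-positive : ∀ μ → All NonZero (parts μ)
parts-positive (partition ps pos _) = recompute (All.all? nonZero? ps) pos

parts-decreasing : ∀ μ → Linked _≥_ (parts μ)
parts-decreasing (partition ps _ dec) = recompute (Linked.linked? _≥?_ ps) dec

nth-unique : ∀ {ps qs} → All NonZero ps → All NonZero qs → (∀ i → nth ps i ≡ nth qs i) → ps ≡ qs
nth-unique []       []       _ = refl
nth-unique {qs = suc q ∷ _} [] (_ ∷ _) e = contradiction (e 0) 0≢1+n
nth-unique {suc p ∷ _} (_ ∷ _) [] e = contradiction (sym (e 0)) 0≢1+n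
nth-unique (_ ∷ ps) (_ ∷ qs) e = cong₂ _∷_ (e 0) (nth-unique ps qs (e ∘ suc))

partition-unique : (∀ i → rowLength κ i ≡ rowLength μ i) → κ ≡ μ
partition-unique {κ} {μ} e = same (nth-unique (parts-positive κ) (parts-positive μ) e)
  where
  same : ∀ {κ μ} → parts κ ≡ parts μ → κ ≡ μ
  same refl = refl

encodes-functional : w encodes κ → w encodes μ → κ ≡ μ
encodes-functional e e′ = partition-unique λ i → trans (rows e i) (sym (rows e′ i))

encodes-injective : length w ≡ length w′ → ones w ≡ ones w′ → w encodes μ → w′ encodes μ → w ≡ w′
encodes-injective {w} {w′} l o e e′ = word-unique w w′ l o λ i → trans (sym (rows e i)) (rows e′ i)

encodes-full : ∀ p → w encodes μ → full p ++ w encodes μ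
encodes-full {w} p e = encoding λ i → trans (rows e i) (sym (rl-full p w i))

encodes-empty : ∀ q → w encodes μ → w ++ empty q encodes μ
encodes-empty {w} q e = encoding λ i → trans (rows e i) (sym (rl-++-empty w q i))

nth-antitone : ∀ {ps} → Linked _≥_ ps → ∀ i → nth ps (suc i) ≤ nth ps i
nth-antitone []       i       = z≤n
nth-antitone [-]      i       = z≤n
nth-antitone (p≥ ∷ l) zero    = p≥
nth-antitone (p≥ ∷ l) (suc i) = nth-antitone l i

rowLength-antitone : ∀ μ {i j} → i ≤ j → rowLength μ j ≤ rowLength μ i
rowLength-antitone μ le = go (≤⇒≤′ le)
  where
  go : ∀ {i j} → i ≤′ j → rowLength μ j ≤ rowLength μ i
  go ≤′-refl      = ≤-refl
  go (≤′-step le) = ≤-trans (nth-antitone (parts-decreasing μ) _) (go le)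

nth-beyond : ∀ ps {i} → length ps ≤ i → nth ps i ≡ 0
nth-beyond []       _  = refl
nth-beyond (p ∷ ps) {suc i} le = nth-beyond ps (s≤s⁻¹ le)

nth-within : ∀ ps {i} → 0 < nth ps i → i < length ps
nth-within (p ∷ ps) {zero}  _  = z<s
nth-within (p ∷ ps) {suc i} lt = s<s (nth-within ps lt)

encode : ∀ A B κ → (∀ {i} → A ≤ i → rowLength κ i ≡ 0) → (∀ i → rowLength κ i ≤ B) →
         ∃ λ w → ones w ≡ A × length w ≡ A + B × w encodes κ
encode A B κ zeros bounded with wordOf A B (rowLength κ) (rowLength-antitone κ) zeros bounded
... | w , o , l , e = w , o , l , encoding e

encode-within : ∀ v → v encodes μ → (∀ i → rowLength κ i ≤ rowLength μ i) →
                ∃ λ w → ones w ≡ ones v × length w ≡ length v × w encodes κ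
encode-within {κ = κ} v e sub
  with encode (ones v) (length v ∸ ones v) κ
         (λ {i} le → n≤0⇒n≡0 (subst (rowLength κ i ≤_) (trans (rows e i) (rl-above v le)) (sub i)))
         (λ i → ≤-trans (sub i) (subst (_≤ length v ∸ ones v) (sym (rows e i))
           (subst (_≤ length v ∸ ones v) (m+n∸n≡m _ (ones v)) (∸-monoˡ-≤ (ones v) (rl-bounded v i)))))
... | w , o , l , e′ = w , o , trans l (m+[n∸m]≡n (ones-drop-≤′ v)) , e′
  where
  ones-drop-≤′ : ∀ v → ones v ≤ length v
  ones-drop-≤′ v = ≤-trans (m≤n+m (ones v) (rl v 0)) (rl-bounded v 0)

-- Ribbons as jumps of beads

-- In Fill n u v h a bead is put on the gap at position n, and h beads precede it;
-- in Move n p u v h the bead at position p moves to position p + suc n.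
data Fill : ℕ → Word → Word → ℕ → Set where
  here  : Fill 0 (false ∷ w) (true ∷ w) 0
  there : Fill n u v h → Fill (suc n) (x ∷ u) (x ∷ v) (⟦ x ⟧ + h)

data Move (n : ℕ) : ℕ → Word → Word → ℕ → Set where
  lift : Fill n u v h → Move n 0 (true ∷ u) (false ∷ v) h
  skip : Move n p u v h → Move n (suc p) (x ∷ u) (x ∷ v) h

fill-ones : Fill n u v h → q ≤ n → ones (drop q v) ≡ suc (ones (drop q u))
fill-ones {q = zero}  here              _  = refl
fill-ones {q = zero}  (there {x = x} φ) _  = trans (cong (⟦ x ⟧ +_) (fill-ones φ z≤n)) (+-suc ⟦ x ⟧ _)
fill-ones {q = suc q} (there φ)         le = fill-ones φ (s≤s⁻¹ le)

fill-beyond : Fill n u v h → n < q → ones (drop q v) ≡ ones (drop q u)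
fill-beyond {q = suc q} here      _  = refl
fill-beyond {q = suc q} (there φ) lt = fill-beyond φ (s<s⁻¹ lt)

fill-length : Fill n u v h → length u ≡ length v
fill-length here      = refl
fill-length (there φ) = cong suc (fill-length φ)

move-length : Move n p u v h → length u ≡ length v
move-length (lift φ) = cong suc (fill-length φ)
move-length (skip m) = cong suc (move-length m)

move-before : Move n p u v h → q ≤ p → ones (drop q v) ≡ ones (drop q u)
move-before {q = zero}  (lift φ)         _  = fill-ones φ z≤n
move-before {q = zero}  (skip {x = x} m) _  = cong (⟦ x ⟧ +_) (move-before m z≤n)
move-before {q = suc q} (skip m)         le = move-before m (s≤s⁻¹ le)

move-ones : Move n p u v h → ones u ≡ ones v
move-ones m = sym (move-before m z≤n)

-- By `square⇒` and `square⇐`, this and its two companions `move-before` and `move-beyond` say that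
-- the jump adds one square on each of the diagonals at positions `p + 1` to `p + suc n` and none
-- elsewhere.
move-inside : Move n p u v h → p < q → q ≤ p + suc n → ones (drop q v) ≡ suc (ones (drop q u))
move-inside {q = suc q} (lift φ) _  le = fill-ones φ (s≤s⁻¹ le)
move-inside {q = suc q} (skip m) lt le = move-inside m (s<s⁻¹ lt) (s≤s⁻¹ le)

move-beyond : Move n p u v h → p + suc n < q → ones (drop q v) ≡ ones (drop q u)
move-beyond {q = suc q} (lift φ) lt = fill-beyond φ (s<s⁻¹ lt)
move-beyond {q = suc q} (skip m) lt = move-beyond m (s<s⁻¹ lt)

-- Here `t` is the number of beads behind the filled gap. Their rows lose that gap. Every index from
-- `t` on now belongs to a bead further to the right, whose row is at least as long.
fill-rows : Fill n u v h → ∃ λ t → ones u ≡ t + h × (∀ i → i < t → rl u i ≡ suc (rl v i)) ×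
            (∀ i → t ≤ i → rl u i ≤ rl v i)
fill-rows (here {w}) = ones w , sym (+-identityʳ _) , (λ _ → rl-below w) ,
    λ i le → subst (_≤ rl w i) (sym (rl-above (false ∷ w) le)) z≤n
fill-rows (there {x = true} φ) with fill-rows φ
... | t , o , lo , hi = t , trans (cong suc o) (sym (+-suc t _)) , lo , hi
fill-rows {u = false ∷ u} {v = false ∷ v} (there {x = false} φ) with fill-rows φ
... | t , o , lo , hi = t , o , lo′ , hi′
  where
  o′ : ones v ≡ suc (ones u)
  o′ = fill-ones φ z≤n
  lo′ : ∀ i → i < t → rl (false ∷ u) i ≡ suc (rl (false ∷ v) i)
  lo′ i lt = trans (rl-below u <u)
      (cong suc (trans (lo i lt) (sym (rl-below v (<-trans <u (subst (ones u <_) (sym o′) (n<1+n _)))))))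
    where <u = <-≤-trans lt (subst (t ≤_) (sym o) (m≤m+n t _))
  hi′ : ∀ i → t ≤ i → rl (false ∷ u) i ≤ rl (false ∷ v) i
  hi′ i le with i <? ones u
  ... | no  ≮ = subst (_≤ rl (false ∷ v) i) (sym (rl-above (false ∷ u) (≮⇒≥ ≮))) z≤n
  ... | yes i< = subst₂ _≤_ (sym (rl-below u i<))
      (sym (rl-below v (<-trans i< (subst (ones u <_) (sym o′) (n<1+n _))))) (s≤s (hi i le))

rl-false-cong : ∀ u v → ones u ≡ ones v → rl u i ≡ rl v i → rl (false ∷ u) i ≡ rl (false ∷ v) i
rl-false-cong u v o e rewrite o | e = refl

-- The rows met by the ribbon are t, …, t + h, since each bead jumped over is
-- shifted by one row.
move-rows : Move n p u v h → ∃ λ t → t + h < ones v × (∀ {i} → i < t → rl u i ≡ rl v i) ×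
            (∀ {i} → t ≤ i → i ≤ t + h → rl u i < rl v i) × (∀ {i} → t + h < i → rl u i ≡ rl v i)
move-rows {u = _ ∷ u} {v = _ ∷ v} (lift φ) with fill-rows φ
... | t , o , lo , hi = t , ≤-reflexive o′ ,
    (λ lt → trans (lo _ lt) (sym (rl-below v (subst (_ <_) o′ (≤-trans lt (≤-trans (m≤m+n t _) (n≤1+n _))))))) ,
    (λ le le′ → subst (rl u _ <_) (sym (rl-below v (subst (_ <_) o′ (s≤s le′)))) (s≤s (hi _ le))) ,
    (λ lt → trans (rl-above u (subst (_≤ _) (sym o) (<⇒≤ lt)))
        (sym (rl-above (false ∷ v) (subst (_≤ _) o′ lt))))
  where
  o′ = sym (trans (fill-ones φ z≤n) (cong suc o))
move-rows (skip {x = true} m) with move-rows m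
... | t , o , lo , mid , hi = t , ≤-trans o (n≤1+n _) , lo , mid , hi
move-rows {u = _ ∷ u} {v = _ ∷ v} (skip {x = false} m) with move-rows m
... | t , o , lo , mid , hi = t , o , (rl-false-cong u v (move-ones m) ∘ lo) ,
    (λ le le′ → let i< = ≤-<-trans le′ o in
      subst₂ _<_ (sym (rl-below u (subst (_ <_) (sym (move-ones m)) i<))) (sym (rl-below v i<))
          (s≤s (mid le le′))) ,
    (rl-false-cong u v (move-ones m) ∘ hi)

filter-interval : ∀ {ℓ} {P : Pred ℕ ℓ} (P? : Decidable P) f N lo m → lo + m ≤ N →
                  (∀ i → lo ≤ i → i < lo + m → P (f i)) →
                  (∀ i → i < lo ⊎ lo + m ≤ i → ¬ P (f i)) →
                  length (filter P? (applyUpTo f N)) ≡ m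
filter-interval P? f zero zero zero _ _ _ = refl
filter-interval P? f (suc N) (suc lo) m le in∈ out∉ =
  trans (cong length (filter-reject P? (out∉ 0 (inj₁ z<s))))
    (filter-interval P? (f ∘ suc) N lo m (s≤s⁻¹ le) (λ i l l′ → in∈ (suc i) (s≤s l) (s<s l′))
      (λ i → out∉ (suc i) ∘ [ inj₁ ∘ s<s , inj₂ ∘ s≤s ]′))
filter-interval P? f (suc N) zero zero le in∈ out∉ =
  trans (cong length (filter-reject P? (out∉ 0 (inj₂ z≤n))))
    (filter-interval P? (f ∘ suc) N zero zero z≤n (λ i _ ()) (λ i _ → out∉ (suc i) (inj₂ z≤n)))
filter-interval P? f (suc N) zero (suc m) le in∈ out∉ =
  trans (cong length (filter-accept P? (in∈ 0 z≤n z<s)))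
    (cong suc (filter-interval P? (f ∘ suc) N zero m (s≤s⁻¹ le) (λ i _ l′ → in∈ (suc i) z≤n (s<s l′))
      (λ i → out∉ (suc i) ∘ λ { (inj₂ l) → inj₂ (s≤s l) })))

move-height : u encodes κ → v encodes μ → Move n p u v h → pred (length (rowsMet κ μ)) ≡ h
move-height {u} {κ} {v} {μ} {h = h} eu ev m with move-rows m
... | t , o , lo , mid , hi = cong pred (filter-interval (λ i → rowLength κ i <? rowLength μ i) (λ i → i)
    (length (parts μ)) t (suc h)
    (subst (_≤ length (parts μ)) (sym (+-suc t h))
        (nth-within (parts μ) (≤-<-trans z≤n (met (m≤m+n t h) ≤-refl))))
    (λ i le lt → met le (s≤s⁻¹ (subst (i <_) (+-suc t h) lt)))
    (λ i → [ (λ lt → <-irrefl (unmet (lo lt))) ,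
        (λ le → <-irrefl (unmet (hi (subst (_≤ i) (+-suc t h) le)))) ]′))
  where
  met : ∀ {i} → t ≤ i → i ≤ t + h → rowLength κ i < rowLength μ i
  met {i} le le′ = subst₂ _<_ (sym (rows eu i)) (sym (rows ev i)) (mid le le′)
  unmet : ∀ {i} → rl u i ≡ rl v i → rowLength κ i ≡ rowLength μ i
  unmet {i} e = trans (rows eu i) (trans e (sym (rows ev i)))

bit-cancel : ∀ x y k → ⟦ x ⟧ + k ≡ ⟦ y ⟧ + k → x ≡ y
bit-cancel false false k _  = refl
bit-cancel true  true  k _  = refl
bit-cancel true  false k eq = contradiction (sym eq) (<⇒≢ (n<1+n k))
bit-cancel false true  k eq = contradiction eq (<⇒≢ (n<1+n k))

-- A bit is the difference of two consecutive suffix counts. `toFill` and `toMove` rest on the same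
-- remark: the counts alone reveal which bits have changed.
counts-unique : ∀ u v → length u ≡ length v → (∀ q → ones (drop q v) ≡ ones (drop q u)) → u ≡ v
counts-unique [] [] _ _ = refl
counts-unique (x ∷ u) (y ∷ v) l e with counts-unique u v (suc-injective l) (e ∘ suc)
... | refl = cong (_∷ u) (bit-cancel x y (ones u) (sym (e 0)))

toFill : ∀ n u v → length u ≡ length v → (∀ q → q ≤ n → ones (drop q v) ≡ suc (ones (drop q u))) →
         (∀ q → n < q → ones (drop q v) ≡ ones (drop q u)) → ∃ (Fill n u v)
toFill n [] [] l inside beyond = contradiction (inside 0 z≤n) 0≢1+n
toFill zero (x ∷ u) (y ∷ v) l inside beyond
  with counts-unique u v (suc-injective l) (λ q → beyond (suc q) z<s)
toFill zero (false ∷ u) (true ∷ v)   l inside beyond | refl = 0 , here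
toFill zero (false ∷ u) (false ∷ v)  l inside beyond | refl =
    contradiction (inside 0 z≤n) (<⇒≢ (n<1+n (ones u)))
toFill zero (true ∷ u) (false ∷ v)   l inside beyond | refl =
  contradiction (inside 0 z≤n) (<⇒≢ (≤-trans (n<1+n (ones u)) (n≤1+n _)))
toFill zero (true ∷ u) (true ∷ v)    l inside beyond | refl = contradiction (inside 0 z≤n) (<⇒≢ (n<1+n _))
toFill (suc n) (x ∷ u) (y ∷ v) l inside beyond
  with toFill n u v (suc-injective l) (λ q le → inside (suc q) (s≤s le)) (λ q lt → beyond (suc q) (s<s lt))
     | bit-cancel x y (suc (ones u))
         (sym (trans (cong (⟦ y ⟧ +_) (sym (inside 1 (s≤s z≤n)))) (trans (inside 0 z≤n) (sym (+-suc ⟦ x ⟧ _)))))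
... | h , φ | refl = _ , there φ

toMove : ∀ p n u v → length u ≡ length v → (∀ q → q ≤ p → ones (drop q v) ≡ ones (drop q u)) →
         (∀ q → p < q → q ≤ p + suc n → ones (drop q v) ≡ suc (ones (drop q u))) →
         (∀ q → p + suc n < q → ones (drop q v) ≡ ones (drop q u)) → ∃ (Move n p u v)
toMove zero n [] [] l before inside beyond = contradiction (inside 1 z<s (s≤s z≤n)) 0≢1+n
toMove (suc p) n [] [] l before inside beyond =
  contradiction (inside (suc (suc p)) (n<1+n _)
      (s≤s (subst (suc p ≤_) (sym (+-suc p n)) (s≤s (m≤m+n p n))))) 0≢1+n
toMove zero n (x ∷ u) (y ∷ v) l before inside beyond
  with toFill n u v (suc-injective l) (λ q le → inside (suc q) z<s (s≤s le)) (λ q lt → beyond (suc q) (s<s lt))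
toMove zero n (true ∷ u) (false ∷ v)  l before inside beyond | h , φ = h , lift φ
toMove zero n (false ∷ u) (false ∷ v) l before inside beyond | h , φ =
  contradiction (trans (sym (before 0 z≤n)) (fill-ones φ z≤n)) (<⇒≢ (n<1+n _))
toMove zero n (true ∷ u) (true ∷ v)   l before inside beyond | h , φ =
  contradiction (trans (suc-injective (sym (before 0 z≤n))) (fill-ones φ z≤n)) (<⇒≢ (n<1+n _))
toMove zero n (false ∷ u) (true ∷ v)  l before inside beyond | h , φ =
  contradiction (trans (sym (before 0 z≤n)) (cong suc (fill-ones φ z≤n))) (<⇒≢ (≤-trans (n<1+n _) (n≤1+n _)))
toMove (suc p) n (x ∷ u) (y ∷ v) l before inside beyond
  with toMove p n u v (suc-injective l) (λ q le → before (suc q) (s≤s le))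
         (λ q lt le → inside (suc q) (s<s lt) (s≤s le))
         (λ q lt → beyond (suc q) (s<s lt))
     | bit-cancel x y (ones u) (sym (trans (cong (⟦ y ⟧ +_) (sym (before 1 (s≤s z≤n)))) (before 0 z≤n)))
... | h , m | refl = h , skip m

-- Diagonals, and the equivalence of ribbons with jumps

open _≺[_]_ using (included; start; confined; onePerDiagonal; head∈; head-topRight)

-- The main diagonal is at position `beads`. A bead put in front of the word raises both arguments
-- by one and leaves the diagonal unchanged.
diagAt : ℕ → ℕ → ℤ
diagAt p beads = ℤ.+ p ℤ.- ℤ.+ beads

onDiagonal : ∀ i j p beads → p + i ≡ j + beads → diagonal (i , j) ≡ diagAt p beads
onDiagonal i j p beads eq = begin
  ℤ.+ j ℤ.- ℤ.+ i                                ≡⟨ swap (ℤ.+ j) (ℤ.+ beads) (ℤ.+ i) ⟩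
  (ℤ.+ j ℤ.+ ℤ.+ beads) ℤ.- ℤ.+ i ℤ.- ℤ.+ beads          ≡⟨ cong (λ k → k ℤ.- ℤ.+ i ℤ.- ℤ.+ beads) eqℤ ⟨
  (ℤ.+ p ℤ.+ ℤ.+ i) ℤ.- ℤ.+ i ℤ.- ℤ.+ beads          ≡⟨ cong (λ k → k ℤ.- ℤ.+ beads) (swap′ (ℤ.+ p) (ℤ.+ i)) ⟩
  ℤ.+ p ℤ.- ℤ.+ beads                                ∎
  where
  eqℤ : ℤ.+ p ℤ.+ ℤ.+ i ≡ ℤ.+ j ℤ.+ ℤ.+ beads
  eqℤ = trans (sym (ℤ.pos-+ p i)) (trans (cong ℤ.+_ eq) (ℤ.pos-+ j beads))
  swap : ∀ j a i → j ℤ.- i ≡ (j ℤ.+ a) ℤ.- i ℤ.- a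
  swap = ℤ.solve-∀
  swap′ : ∀ p i → (p ℤ.+ i) ℤ.- i ≡ p
  swap′ = ℤ.solve-∀

offDiagonal : ∀ i j p beads → diagonal (i , j) ≡ diagAt p beads → p + i ≡ j + beads
offDiagonal i j p beads eq = ℤ.+-injective (begin
  ℤ.+ (p + i)                                    ≡⟨ ℤ.pos-+ p i ⟩
  ℤ.+ p ℤ.+ ℤ.+ i                                ≡⟨ swap (ℤ.+ p) (ℤ.+ beads) (ℤ.+ i) ⟩
  (ℤ.+ p ℤ.- ℤ.+ beads) ℤ.+ ℤ.+ i ℤ.+ ℤ.+ beads          ≡⟨ cong (λ k → k ℤ.+ ℤ.+ i ℤ.+ ℤ.+ beads) eq ⟨
  (ℤ.+ j ℤ.- ℤ.+ i) ℤ.+ ℤ.+ i ℤ.+ ℤ.+ beads          ≡⟨ cong (λ k → k ℤ.+ ℤ.+ beads) (swap′ (ℤ.+ j) (ℤ.+ i)) ⟩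
  ℤ.+ j ℤ.+ ℤ.+ beads                                ≡⟨ ℤ.pos-+ j beads ⟨
  ℤ.+ (j + beads)                                    ∎)
  where
  swap : ∀ p a i → p ℤ.+ i ≡ (p ℤ.- a) ℤ.+ i ℤ.+ a
  swap = ℤ.solve-∀
  swap′ : ∀ j i → (j ℤ.- i) ℤ.+ i ≡ j
  swap′ = ℤ.solve-∀

diagAt-≤ : ∀ beads → p ≤ q → diagAt p beads ℤ.≤ diagAt q beads
diagAt-≤ beads le = ℤ.+-monoˡ-≤ (ℤ.- ℤ.+ beads) (ℤ.+≤+ le)

diagAt-< : ∀ beads → p < q → diagAt p beads ℤ.< diagAt q beads
diagAt-< beads lt = ℤ.+-monoˡ-< (ℤ.- ℤ.+ beads) (ℤ.+<+ lt)

diagAt-≤⁻¹ : ∀ beads → diagAt p beads ℤ.≤ diagAt q beads → p ≤ q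
diagAt-≤⁻¹ beads le = ≮⇒≥ λ lt → ℤ.<⇒≱ (diagAt-< beads lt) le

diagAt-<⁻¹ : ∀ beads → diagAt p beads ℤ.< diagAt q beads → p < q
diagAt-<⁻¹ beads lt = ≰⇒> λ le → ℤ.≤⇒≯ (diagAt-≤ beads le) lt

diagAt-+ : ∀ p beads m → diagAt p beads ℤ.+ ℤ.+ m ≡ diagAt (p + m) beads
diagAt-+ p beads m = trans (swap (ℤ.+ p) (ℤ.+ beads) (ℤ.+ m)) (cong (λ k → k ℤ.- ℤ.+ beads) (sym (ℤ.pos-+ p m)))
  where
  swap : ∀ p a m → (p ℤ.- a) ℤ.+ m ≡ (p ℤ.+ m) ℤ.- a
  swap = ℤ.solve-∀

diagAt-from : ∀ p beads k → diagAt p beads ℤ.≤ k → ∃ λ m → k ≡ diagAt (p + m) beads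
diagAt-from p beads k le = ℤ.∣ k ℤ.- diagAt p beads ∣ , trans (swap k (diagAt p beads))
  (trans (cong (λ i → diagAt p beads ℤ.+ i) (sym (ℤ.0≤i⇒+∣i∣≡i (ℤ.i≤j⇒0≤j-i le)))) (diagAt-+ p beads _))
  where
  swap : ∀ k d → k ≡ d ℤ.+ (k ℤ.- d)
  swap = ℤ.solve-∀

∈⇒ : w encodes μ → p + i ≡ j + ones w → (i , j) ∈ μ → i < ones (drop p w)
∈⇒ {w} {i = i} e eq s∈ = square⇒ w eq (subst (_ <_) (rows e i) s∈)

∈⇐ : w encodes μ → p + i ≡ j + ones w → i < ones (drop p w) → (i , j) ∈ μ
∈⇐ {w} {i = i} e eq lt = subst (_ <_) (sym (rows e i)) (square⇐ w eq lt)

row-bound : w encodes μ → (i , j) ∈ μ → i < ones w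
row-bound {w} {i = i} e s∈ = ≰⇒> λ le → n≮0 (subst (_ <_) (trans (rows e i) (rl-above w le)) s∈)

-- The position is never zero: the row of a square has a bead of its own, whence `i < ones w`. In a
-- ribbon the place before the first position is where the jumping bead starts.
position : w encodes μ → (i , j) ∈ μ → ∃ λ p → suc p + i ≡ j + ones w
position {w} {i = i} {j} e s∈ = j + (ones w ∸ suc i) , trans (sym (+-suc (j + (ones w ∸ suc i)) i)) (begin
  j + (ones w ∸ suc i) + suc i    ≡⟨ +-assoc j _ (suc i) ⟩
  j + (ones w ∸ suc i + suc i)    ≡⟨ cong (λ k → j + k) (m∸n+n≡m (row-bound e s∈)) ⟩
  j + ones w                      ∎)

module _ {n p u v h κ μ} (m : Move n p u v h) (eu : u encodes κ) (ev : v encodes μ) where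
  private
    B = ones u

    onePer : ∀ q → p < q → q ≤ p + suc n → ∃ λ j → q + ones (drop q u) ≡ j + B × (ones (drop q u) , j) ∈ μ / κ
    onePer q lt le = c₀ , eq , ∈⇐ ev (trans eq (cong (λ k → c₀ + k) (move-ones m)))
        (subst (ones (drop q u) <_) (sym (move-inside m lt le)) ≤-refl) ,
                     λ s∈κ → <-irrefl refl (∈⇒ eu eq s∈κ)
      where
      c₀ = q + ones (drop q u) ∸ B
      eq : q + ones (drop q u) ≡ c₀ + B
      eq = sym (m∸n+n≡m (ones-drop-≥ u q))

    -- On its diagonal κ has the rows below `ones (drop q u)` and μ exactly one row more, which must
    -- be the row of the square. A position outside the range of the jump has equal counts and
    -- leaves no room for it.
    located : ∀ {i j} → (i , j) ∈ μ / κ → ∃ λ q → p < q × q ≤ p + suc n × i ≡ ones (drop q u) × q + i ≡ j + B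
    located {i} {j} (s∈μ , s∉κ) with position ev s∈μ
    ... | q₁ , eq₁ = q₀ , lt , le , ≤-antisym (s≤s⁻¹ (subst (i <_) (move-inside m lt le) i<)) i≥ , eq
      where
      q₀ = suc q₁
      eq : q₀ + i ≡ j + B
      eq = trans eq₁ (cong (λ k → j + k) (sym (move-ones m)))
      i< : i < ones (drop q₀ v)
      i< = ∈⇒ ev eq₁ s∈μ
      i≥ : ones (drop q₀ u) ≤ i
      i≥ = ≮⇒≥ λ i<′ → s∉κ (∈⇐ eu eq i<′)
      lt : p < q₀
      lt = ≰⇒> λ q≤p → ≤⇒≯ i≥ (subst (i <_) (move-before m q≤p) i<)
      le : q₀ ≤ p + suc n
      le = ≮⇒≥ λ q> → ≤⇒≯ i≥ (subst (i <_) (move-beyond m q>) i<)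

    top : ℕ
    top = p + suc n

    p<top : p < top
    p<top = subst (p <_) (sym (+-suc p n)) (s≤s (m≤m+n p n))

    headSquare = onePer top p<top ≤-refl

    -- Between the positions `q` and `top` the row decreases by the number of beads passed and the
    -- column increases by the number of gaps passed.
    topRight : ∀ {s} → s ∈ μ / κ → ones (drop top u) ≤ row s × col s ≤ proj₁ headSquare
    topRight {i , j} s∈ with located s∈
    ... | q , lt , le , refl , eq = subst (λ w → ones w ≤ ones (drop q u)) back
        (ones-drop-≤ (drop q u) (top ∸ q)) ,
        +-cancelʳ-≤ B j _ (subst₂ _≤_ eq (proj₁ (proj₂ headSquare))
          (subst (λ k → q + ones (drop q u) ≤ k)
              (trans (sym (+-assoc q _ _)) (cong (λ k → k + ones (drop top u)) (m+[n∸m]≡n le)))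
            (+-monoʳ-≤ q (subst (λ w → ones (drop q u) ≤ top ∸ q + ones w) back
                (ones-drop-≥ (drop q u) (top ∸ q))))))
      where
      back : drop (top ∸ q) (drop q u) ≡ drop top u
      back = trans (drop-drop q (top ∸ q) u) (cong (λ k → drop k u) (m+[n∸m]≡n le))

    included′ : κ ⊆ μ
    included′ {i , j} s∈κ with move-rows m
    ... | t , _ , lo , mid , hi = subst (j <_) (sym (rows ev i)) (<-≤-trans (subst (j <_) (rows eu i) s∈κ) le)
      where
      le : rl u i ≤ rl v i
      le with i <? t | t + _ <? i
      ... | yes i<t | _       = ≤-reflexive (lo i<t)
      ... | no  _   | yes i>  = ≤-reflexive (hi i>)
      ... | no  i≮t | no  i≯  = <⇒≤ (mid (≮⇒≥ i≮t) (≮⇒≥ i≯))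

    end : diagAt (suc p) B ℤ.+ ℤ.+ suc n ≡ diagAt (suc top) B
    end = diagAt-+ (suc p) B (suc n)

  abstract
    move⇒ribbon : κ ≺[ suc n ] μ
    move⇒ribbon = record
      { included = λ {s} → included′ {s}
      ; start = diagAt (suc p) B
      ; confined = λ {(i , j)} s∈ → let q , lt , le , _ , eq = located s∈ in
          subst (diagAt (suc p) B ℤ.≤_) (sym (onDiagonal i j q B eq)) (diagAt-≤ B lt) ,
          subst₂ ℤ._<_ (sym (onDiagonal i j q B eq)) (sym end) (diagAt-< B (s≤s le))
      ; onePerDiagonal = one
      ; head = ones (drop top u) , proj₁ headSquare
      ; head∈ = proj₂ (proj₂ headSquare)
      ; head-topRight = topRight
      }
      where
      one : ∀ {k} → diagAt (suc p) B ℤ.≤ k → k ℤ.< diagAt (suc p) B ℤ.+ ℤ.+ suc n →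
            ∃! _≡_ (λ s → s ∈ μ / κ × diagonal s ≡ k)
      one {k} le lt with diagAt-from (suc p) B k le
      ... | m₁ , refl with onePer (suc p + m₁) (s≤s (m≤m+n p m₁)) (s≤s⁻¹ (diagAt-<⁻¹ B (subst (_ ℤ.<_) end lt)))
      ...   | j , eq , s∈ = (ones (drop (suc p + m₁) u) , j) , (s∈ , onDiagonal _ j (suc p + m₁) B eq) ,
          λ {s} → unique {s}
        where
        unique : ∀ {s} → s ∈ μ / κ × diagonal s ≡ diagAt (suc p + m₁) B → (ones (drop (suc p + m₁) u) , j) ≡ s
        unique {i′ , j′} (s∈′ , d) with located s∈′
        ... | q , _ , _ , refl , eq′ with +-cancelʳ-≡ (ones (drop q u)) q (suc p + m₁)
            (trans eq′ (sym (offDiagonal _ j′ (suc p + m₁) B d)))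
        ...   | refl = cong (_ ,_) (+-cancelʳ-≡ B j j′ (trans (sym eq) eq′))

    move⇒ribbon-head : diagonal (head move⇒ribbon) ≡ diagAt (p + suc n) B
    move⇒ribbon-head = onDiagonal _ (proj₁ headSquare) top B (proj₁ (proj₂ headSquare))

-- The first diagonal carries a square of μ, so its position is a successor.
ribbon-start : ∀ {v} (ρ : κ ≺[ suc n ] μ) → v encodes μ → ∃ λ p → start ρ ≡ diagAt (suc p) (ones v)
ribbon-start {n = n} ρ ev with onePerDiagonal ρ ℤ.≤-refl
    (subst (ℤ._< start ρ ℤ.+ ℤ.+ suc n) (ℤ.+-identityʳ (start ρ)) (ℤ.+-monoʳ-< (start ρ) (ℤ.+<+ z<s)))
... | (i , j) , ((s∈μ , _) , d) , _ with position ev s∈μ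
...   | p , eq = p , trans (sym d) (onDiagonal i j (suc p) _ eq)

diagonal-mono : ∀ {s s′ : Square} → row s′ ≤ row s → col s ≤ col s′ → diagonal s ℤ.≤ diagonal s′
diagonal-mono r c = ℤ.+-mono-≤ (ℤ.+≤+ c) (ℤ.neg-mono-≤ (ℤ.+≤+ r))

module _ {n u v κ μ} (ρ : κ ≺[ suc n ] μ) (eu : u encodes κ) (ev : v encodes μ)
         (len : length u ≡ length v) (size : ones u ≡ ones v)
         (p₀ : ℕ) (begins : start ρ ≡ diagAt (suc p₀) (ones u)) where
  private
    B = ones u

    end : start ρ ℤ.+ ℤ.+ suc n ≡ diagAt (suc (p₀ + suc n)) B
    end = trans (cong (λ k → k ℤ.+ ℤ.+ suc n) begins) (diagAt-+ (suc p₀) B (suc n))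

    col-of : ∀ q {i} → B ≤ q + i → ∃ λ j → q + i ≡ j + B
    col-of q {i} le = q + i ∸ B , sym (m∸n+n≡m le)

    square-at : ∀ q → ones (drop q u) ≤ i → i < ones (drop q v) → ∃ λ j → q + i ≡ j + B × (i , j) ∈ μ / κ
    square-at {i} q le lt with col-of q (≤-trans (ones-drop-≥ u q) (+-monoʳ-≤ q le))
    ... | j , eq = j , eq , ∈⇐ ev (trans eq (cong (λ k → j + k) size)) lt , λ s∈κ → ≤⇒≯ le (∈⇒ eu eq s∈κ)

    above : ∀ q → ones (drop q u) ≤ ones (drop q v)
    above q = ≮⇒≥ λ lt → let j , eq = col-of q (subst (_≤ q + ones (drop q v)) (sym size) (ones-drop-≥ v q)) in
      <-irrefl refl (∈⇒ ev (trans eq (cong (λ k → j + k) size)) (included ρ (∈⇐ eu eq lt)))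

    outside : ∀ q → ¬ (suc p₀ ≤ q × q < suc (p₀ + suc n)) → ones (drop q v) ≡ ones (drop q u)
    outside q out = sym (≤-antisym (above q) (≮⇒≥ λ lt → absurd (square-at q ≤-refl lt)))
      where
      absurd : ¬ ∃ λ j → q + ones (drop q u) ≡ j + B × (ones (drop q u) , j) ∈ μ / κ
      absurd (j , eq , s∈) with confined ρ s∈ | onDiagonal _ j q B eq
      ... | lo , hi | d = out (diagAt-≤⁻¹ B (subst₂ ℤ._≤_ begins d lo) , diagAt-<⁻¹ B (subst₂ ℤ._<_ d end hi))

    inside : ∀ q → p₀ < q → q ≤ p₀ + suc n → ones (drop q v) ≡ suc (ones (drop q u))
    inside q lt le with onePerDiagonal ρ (subst (ℤ._≤ diagAt q B) (sym begins) (diagAt-≤ B lt))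
                          (subst (diagAt q B ℤ.<_) (sym end) (diagAt-< B (s≤s le)))
    ... | (i , j) , ((s∈μ , s∉κ) , d) , unique = ≤-antisym (≮⇒≥ two) more
      where
      eq : q + i ≡ j + B
      eq = offDiagonal i j q B d
      more : ones (drop q u) < ones (drop q v)
      more = ≤-<-trans (≮⇒≥ λ lt → s∉κ (∈⇐ eu eq lt)) (∈⇒ ev (trans eq (cong (λ k → j + k) size)) s∈μ)
      two : ¬ suc (ones (drop q u)) < ones (drop q v)
      -- A surplus of two would put two squares of the ribbon on the same diagonal.
      two lt′ with square-at q ≤-refl more | square-at q (n≤1+n _) lt′
      ... | j₁ , eq₁ , s∈₁ | j₂ , eq₂ , s∈₂ =
        1+n≢n (cong proj₁ (trans (sym (unique (s∈₂ , onDiagonal _ j₂ q B eq₂)))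
            (unique (s∈₁ , onDiagonal _ j₁ q B eq₁))))

    top : ℕ
    top = p₀ + suc n

    p₀<top : p₀ < top
    p₀<top = subst (p₀ <_) (sym (+-suc p₀ n)) (s≤s (m≤m+n p₀ n))

    not-above : ∀ i j → (i , j) ∈ μ → diagonal (i , j) ℤ.< diagAt (suc top) B →
        diagonal (i , j) ℤ.≤ diagAt top B
    not-above i j s∈ lt = subst (ℤ._≤ diagAt top B) (sym d)
        (diagAt-≤ B (s≤s⁻¹ (diagAt-<⁻¹ B (subst (ℤ._< diagAt (suc top) B) d lt))))
      where
      q₀ : ℕ
      q₀ = suc (proj₁ (position ev s∈))
      d : diagonal (i , j) ≡ diagAt q₀ B
      d = onDiagonal i j q₀ B (trans (proj₂ (position ev s∈)) (cong (λ k → j + k) (sym size)))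

    beyond-row : ones (drop top u) < ones (drop top v)
    beyond-row = ≤-reflexive (sym (inside top p₀<top ≤-refl))

    reached : ∃ λ j → top + ones (drop top u) ≡ j + B × (ones (drop top u) , j) ∈ μ / κ
    reached = square-at {ones (drop top u)} top ≤-refl beyond-row

    not-below : ∀ s → s ∈ μ / κ → diagonal s ≡ diagAt top B → diagAt top B ℤ.≤ diagonal (head ρ)
    not-below s s∈ eq = subst (ℤ._≤ diagonal (head ρ)) eq
      (diagonal-mono {s} {head ρ} (proj₁ (head-topRight ρ s∈)) (proj₂ (head-topRight ρ s∈)))

    -- By `confined` the head cannot lie beyond the last diagonal. That diagonal carries a square of
    -- the ribbon, and the head lies weakly above and to the right of it.
    head-diagonal : diagonal (head ρ) ≡ diagAt top B
    head-diagonal = ℤ.≤-antisym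
      (not-above (row (head ρ)) (col (head ρ)) (proj₁ (head∈ ρ))
          (subst (diagonal (head ρ) ℤ.<_) end (proj₂ (confined ρ (head∈ ρ)))))
      (not-below (ones (drop top u) , proj₁ reached) (proj₂ (proj₂ reached))
        (onDiagonal (ones (drop top u)) (proj₁ reached) top B (proj₁ (proj₂ reached))))

    jump : ∃ (Move n p₀ u v)
    jump = toMove p₀ n u v len (λ q le → outside q λ (lt , _) → ≤⇒≯ le lt) inside
             (λ q lt → outside q λ (_ , lt′) → ≤⇒≯ (s≤s⁻¹ lt′) lt)

  ribbon⇒moveFrom : ∃₂ λ p h → Move n p u v h × height ρ ≡ h × diagonal (head ρ) ≡ diagAt (p + suc n) (ones u)
  ribbon⇒moveFrom = p₀ , proj₁ jump , proj₂ jump , move-height eu ev (proj₂ jump) , head-diagonal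

abstract
  ribbon⇒move : ∀ {u v} (ρ : κ ≺[ suc n ] μ) → u encodes κ → v encodes μ → length u ≡ length v →
      ones u ≡ ones v →
                ∃₂ λ p h → Move n p u v h × height ρ ≡ h × diagonal (head ρ) ≡ diagAt (p + suc n) (ones u)
  ribbon⇒move ρ eu ev len size with ribbon-start ρ ev
  ... | p , begins = ribbon⇒moveFrom ρ eu ev len size p (trans begins (cong (diagAt (suc p)) (sym size)))

-- Horizontal strips as chains of jumps and as scans

-- Moves of beads from positions lo ≤ p₁ < p₂ < ….
data Chain (n : ℕ) : ℕ → Word → Word → ℕ → ℕ → Set where
  []      : Chain n lo u u 0 0
  _at_∷_  : Move n p u v h → lo ≤ p → Chain n (suc p) v w s h′ → Chain n lo u w (suc s) (h + h′)

⊆⇒rows : ∀ κ μ → κ ⊆ μ → ∀ i → rowLength κ i ≤ rowLength μ i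
⊆⇒rows κ μ sub i = ≮⇒≥ λ lt → <-irrefl refl (sub {i , rowLength μ i} lt)

≤⇒rows : ∀ {r} → κ ≤[ r ] μ → ∀ i → rowLength κ i ≤ rowLength μ i
≤⇒rows ε       i = ≤-refl
≤⇒rows (_◅_ {κ} {ν} ρ c) i = ≤-trans (⊆⇒rows κ ν (λ {s} → included ρ {s}) i) (≤⇒rows c i)

-- The extra entry `diagAt (lo + n)` stands for the head of a preceding ribbon. A bead jumping from
-- `lo` or later produces a head beyond it, and for `lo = suc p` it is exactly the head of the jump
-- from `p`.
chain⇒ribbons : Chain n lo u v s h → u encodes κ → v encodes μ →
                ∃ λ (c : κ ≤[ suc n ] μ) → Linked ℤ._<_ (diagAt (lo + n) (ones u) ∷ headDiagonals c)
chain⇒ribbons [] eu ev with encodes-functional eu ev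
... | refl = ε , [-]
chain⇒ribbons {n} {lo} {u} (_at_∷_ {p = p} {v = v} m le c) eu ew
  with chain⇒ribbons c (fromWord-encodes v) ew
... | c′ , linked = move⇒ribbon m eu (fromWord-encodes v) ◅ c′ ,
    subst (diagAt (lo + n) (ones u) ℤ.<_) (sym headed)
        (diagAt-< (ones u) (subst (lo + n <_) (sym (+-suc p n)) (s≤s (+-monoˡ-≤ n le)))) ∷
    subst (λ d → Linked ℤ._<_ (d ∷ headDiagonals c′))
        (trans (cong₂ diagAt (sym (+-suc p n)) (sym (move-ones m))) (sym headed)) linked
  where
  headed = move⇒ribbon-head m eu (fromWord-encodes v)

-- The starting place of the jump becomes known only through `ribbon⇒move`, so the bound is imposed
-- on every place compatible with the head.
Floor : ∀ {r} → ℕ → ℕ → κ ≤[ r ] μ → Set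
Floor {r = r} lo beads ε       = ⊤
Floor {r = r} lo beads (ρ ◅ c) = ∀ p → diagonal (head ρ) ≡ diagAt (p + r) beads → lo ≤ p

rising : ∀ {r d} (c : κ ≤[ r ] μ) → Linked ℤ._<_ (d ∷ headDiagonals c) → d ≡ diagAt (p + r) beads →
    Floor (suc p) beads c
rising         ε       _        _    = _
rising {beads = beads} {r = r} (ρ ◅ c) (lt ∷ _) refl = λ q eq →
    +-cancelʳ-≤ r _ q (diagAt-<⁻¹ beads (subst (_ ℤ.<_) eq lt))

ribbons⇒chain : (c : κ ≤[ suc n ] μ) → Linked ℤ._<_ (headDiagonals c) → Floor lo (ones u) c →
                u encodes κ → v encodes μ → length u ≡ length v → ones u ≡ ones v →
                Chain n lo u v (length (headDiagonals c)) (sum (heights c))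
ribbons⇒chain ε _ _ eu ev len size with encodes-injective len size eu ev
... | refl = []
ribbons⇒chain {n = n} {lo = lo} {u = u} {v = v} (ρ ◅ c) linked floor eu ev len size
  with encode-within v ev (≤⇒rows c)
... | w , sizew , lenw , ew
  with ribbon⇒move ρ eu ew (trans len (sym lenw)) (trans size (sym sizew))
...   | p , _ , m , refl , headed = m at floor p headed ∷
          ribbons⇒chain c (Linked.tail linked)
              (rising c linked (trans headed (cong (diagAt (p + suc n)) (trans size (sym sizew))))) ew ev
              lenw sizew

shift : Chain n lo u v s h → Chain n (suc lo) (z ∷ u) (z ∷ v) s h
shift []            = []
shift (m at le ∷ c) = skip m at s≤s le ∷ shift c

relax : lo ≤ q → Chain n q u v s h → Chain n lo u v s h
relax le []             = []
relax le (m at le′ ∷ c) = m at ≤-trans le le′ ∷ c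

unshift : Chain n (suc lo) (x ∷ u) w s h → ∃ λ v → w ≡ x ∷ v × Chain n lo u v s h
unshift []                     = _ , refl , []
unshift (skip m at s≤s le ∷ c) with unshift c
... | v , refl , c′ = v , refl , m at le ∷ c′

-- After its own jump, if any, the first place is final: all later jumps start further right and
-- land even further right.
data FirstBead (n : ℕ) (x : Bool) (u : Word) : Word → ℕ → ℕ → Set where
  stays : Chain n 0 u v s h → FirstBead n x u (x ∷ v) s h
  moves : x ≡ true → Fill n u w h → Chain n 0 w v s h′ → FirstBead n x u (false ∷ v) (suc s) (h + h′)

firstBead : Chain n 0 (x ∷ u) w s h → FirstBead n x u w s h
firstBead []              = stays []
firstBead (lift φ at _ ∷ c) with unshift c
... | v , refl , c′ = moves refl φ c′
firstBead (skip m at _ ∷ c) with unshift c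
... | v , refl , c′ = stays (m at z≤n ∷ c′)

fill-snoc : ∀ w → Fill (length w) (w ++ false ∷ u) (w ++ true ∷ u) (ones w)
fill-snoc []      = here
fill-snoc (z ∷ w) = there (fill-snoc w)

fill-unsnoc : ∀ w → Fill (length w) (w ++ z ∷ u) v h → z ≡ false × v ≡ w ++ true ∷ u × h ≡ ones w
fill-unsnoc []      here = refl , refl , refl
fill-unsnoc (z ∷ w) (there φ) with fill-unsnoc w φ
... | refl , refl , refl = refl , refl , refl

move-fits : Move n p u v h → p + suc n < length u
move-fits (lift φ) = s≤s (fill-fits φ)
  where
  fill-fits : Fill n u v h → n < length u
  fill-fits here      = z<s
  fill-fits (there φ) = s≤s (fill-fits φ)
move-fits (skip m) = s≤s (move-fits m)

chain⇒scan : ∀ W κs → length W ≡ suc n → Chain n 0 (W ++ κs) w s h →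
             ∃₂ λ λs W′ → w ≡ λs ++ W′ × length λs ≡ length κs × Scan W κs λs W′ s h
chain⇒scan W [] len [] = [] , W , ++-identityʳ W , refl , []
-- With nothing left to read the word is the window alone, of length `suc n`, and no bead in it has
-- a place `suc n` further right.
chain⇒scan {n} W [] len (_at_∷_ {p = p} m _ _) = contradiction (move-fits m)
  (≤⇒≯ (subst (_≤ p + suc n) (sym (trans (cong length (++-identityʳ W)) len)) (m≤n+m (suc n) p)))
chain⇒scan (x ∷ W) (k ∷ κs) len c with firstBead c
... | stays c′
  with chain⇒scan (W ∷ʳ k) κs (trans (length-++ W) (trans (+-comm _ 1) len))
      (subst (λ u → Chain _ 0 u _ _ _) (sym (++-assoc W [ k ] κs)) c′)
...   | λs , W′ , refl , len′ , σ = x ∷ λs , W′ , refl , cong suc len′ , stay ∷ σ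
chain⇒scan (x ∷ W) (k ∷ κs) refl c | moves refl φ c′ with fill-unsnoc W φ
... | refl , refl , refl
  with chain⇒scan (W ∷ʳ true) κs (trans (length-++ W) (+-comm _ 1))
      (subst (λ u → Chain _ 0 u _ _ _) (sym (++-assoc W [ true ] κs)) c′)
...   | λs , W′ , refl , len′ , σ = false ∷ λs , W′ , refl , cong suc len′ ,
        subst (Scan _ _ _ _ _) (cong (_+ _) (*-identityˡ (ones W))) (move ∷ σ)

scan⇒chain : ∀ {W W′} → length W ≡ suc n → Scan W κs λs W′ s h → ∃₂ (Chain n 0 (W ++ κs) (λs ++ W′))
scan⇒chain {W = W} len [] = _ , _ , subst (λ u → Chain _ 0 u W 0 0) (sym (++-identityʳ W)) []
scan⇒chain {W = x ∷ W} refl (_∷_ {y = k} {κs = κs} stay σ)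
  with scan⇒chain (trans (length-++ W) (+-comm _ 1)) σ
... | _ , _ , c = _ , _ , relax z≤n (shift (subst (λ u → Chain _ 0 u _ _ _) (++-assoc W [ k ] κs) c))
scan⇒chain {W = x ∷ W} refl (_∷_ {κs = κs} move σ)
  with scan⇒chain (trans (length-++ W) (+-comm _ 1)) σ
... | _ , _ , c = _ , _ , lift (fill-snoc W) at z≤n ∷
    shift (subst (λ u → Chain _ 0 u _ _ _) (++-assoc W [ true ] κs) c)

++-split : ∀ (u v : Word) {w w′} → length u ≡ length v → u ++ w ≡ v ++ w′ → u ≡ v × w ≡ w′
++-split []      []      _   eq   = refl , eq
++-split (x ∷ u) (y ∷ v) len eq with ∷-injective eq
... | refl , eq′ with ++-split u v (suc-injective len) eq′
...   | refl , eq″ = refl , eq″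

-- The initial window adds beads in front of κ and the final one adds gaps behind λ. Neither changes
-- a partition.
scan⇒strip : Scan (full (suc n)) κs λs (empty (suc n)) s h → κs encodes κ → λs encodes lam → κ ⇀[ suc n ] lam
scan⇒strip {n} σ eκ eλ with scan⇒chain (length-replicate (suc n)) σ
... | _ , _ , c with chain⇒ribbons c (encodes-full (suc n) eκ) (encodes-empty (suc n) eλ)
...   | c′ , linked = strip c′ (Linked.tail linked)

strip⇒scan : (σ : κ ⇀[ suc n ] lam) → κs encodes κ → λs encodes lam → length κs ≡ length λs →
    ones λs ≡ suc n + ones κs →
             Scan (full (suc n)) κs λs (empty (suc n)) (stripSize σ) (sum (heights (standardisation σ)))
strip⇒scan {n = n} {κs = κs} {λs} (strip c linked) eκ eλ len size
  with chain⇒scan (full (suc n)) κs (length-replicate (suc n))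
         (ribbons⇒chain c linked (anywhere c) (encodes-full (suc n) eκ) (encodes-empty (suc n) eλ) len′ size′)
  where
  anywhere : ∀ {beads κ μ} (c : κ ≤[ suc n ] μ) → Floor 0 beads c
  anywhere ε       = _
  anywhere (ρ ◅ c) = λ _ _ → z≤n
  len′ : length (full (suc n) ++ κs) ≡ length (λs ++ empty (suc n))
  len′ = begin
    length (full (suc n) ++ κs)           ≡⟨ length-++ (full (suc n)) ⟩
    length (full (suc n)) + length κs
        ≡⟨ cong₂ _+_ (trans (length-replicate (suc n)) (sym (length-replicate (suc n)))) len ⟩
    length (empty (suc n)) + length λs    ≡⟨ +-comm _ (length λs) ⟩
    length λs + length (empty (suc n))    ≡⟨ length-++ λs ⟨
    length (λs ++ empty (suc n))          ∎
  size′ : ones (full (suc n) ++ κs) ≡ ones (λs ++ empty (suc n))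
  size′ = begin
    ones (full (suc n) ++ κs)             ≡⟨ ones-++ (full (suc n)) κs ⟩
    ones (full (suc n)) + ones κs         ≡⟨ cong (_+ ones κs) (ones-full (suc n)) ⟩
    suc n + ones κs                       ≡⟨ size ⟨
    ones λs                               ≡⟨ +-identityʳ _ ⟨
    ones λs + 0                           ≡⟨ cong (ones λs +_) (ones-empty (suc n)) ⟨
    ones λs + ones (empty (suc n))        ≡⟨ ones-++ λs _ ⟨
    ones (λs ++ empty (suc n))            ∎
... | λs′ , W′ , eq , len″ , σ with ++-split λs λs′ (trans (sym len) (sym len″)) eq
...   | refl , refl = σ

-- Entries of the matrix as stacks

∑-+ : ∀ {k} (f g : Fin k → ℕ) → ∑ (λ i → f i + g i) ≡ ∑ f + ∑ g
∑-+ {zero}  f g = refl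
∑-+ {suc k} f g = trans (cong (λ s → f zero + g zero + s) (∑-+ (f ∘ suc) (g ∘ suc)))
    (exchange₄ (f zero) (g zero) _ _)
  where
  exchange₄ : ∀ a b c d → a + b + (c + d) ≡ a + c + (b + d)
  exchange₄ = solve-∀

-- The top of the stack is the last entry.
stack : ∀ {r} → Vec ℕ r → Stack
stack a = reverse (Vec.toList a)

stack-∷ : ∀ {r} i (a : Vec ℕ r) → stack (i ∷ a) ≡ stack a ++ [ i ]
stack-∷ i a = unfold-reverse i (Vec.toList a)

stack-length : ∀ {r} (a : Vec ℕ r) → length (stack a) ≡ r
stack-length a = trans (length-reverse (Vec.toList a)) (Vec.length-toList a)

stack-injective : ∀ {r} {a b : Vec ℕ r} → stack a ≡ stack b → a ≡ b
stack-injective {a = a} {b} e = trans (sym (Vec.cast-is-id refl a))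
    (Vec.toList-injective refl a b (reverse-injective e))

unstack : ∀ {r} s → length s ≡ r → ∃ λ (a : Vec ℕ r) → stack a ≡ s
unstack s refl = subst (Vec ℕ) (length-reverse s) (Vec.fromList (reverse s)) , go (length-reverse s)
  where
  go : ∀ {k} (e : length (reverse s) ≡ k) → stack (subst (Vec ℕ) e (Vec.fromList (reverse s))) ≡ s
  go refl = trans (cong reverse (Vec.toList∘fromList (reverse s))) (reverse-involutive s)

stack-sum : ∀ {r} (a : Vec ℕ r) → sum (stack a) ≡ ∣ a ∣
stack-sum []      = refl
stack-sum (i ∷ a) = begin
  sum (stack (i ∷ a))      ≡⟨ cong sum (stack-∷ i a) ⟩
  sum (stack a ++ [ i ])   ≡⟨ sum-++ (stack a) [ i ] ⟩
  sum (stack a) + (i + 0)  ≡⟨ cong₂ _+_ (stack-sum a) (+-identityʳ i) ⟩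
  ∣ a ∣ + i                ≡⟨ +-comm ∣ a ∣ i ⟩
  i + ∣ a ∣                ∎

stackEnergy-∷ʳ : ∀ s i → stackEnergy (s ++ [ i ]) ≡ stackEnergy s + 2 * sum s
stackEnergy-∷ʳ []      i = trans (+-identityʳ (i * 0)) (*-zeroʳ i)
stackEnergy-∷ʳ (j ∷ s) i = begin
  j * (2 * length (s ++ [ i ])) + stackEnergy (s ++ [ i ])
    ≡⟨ cong₂ (λ l e → j * (2 * l) + e) (trans (length-++ s) (+-comm (length s) 1)) (stackEnergy-∷ʳ s i) ⟩
  j * (2 * suc (length s)) + (stackEnergy s + 2 * sum s)
    ≡⟨ rearrange j (length s) (stackEnergy s) (sum s) ⟩
  j * (2 * length s) + stackEnergy s + 2 * (j + sum s) ∎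
  where
  rearrange : ∀ j l e t → j * (2 * suc l) + (e + 2 * t) ≡ j * (2 * l) + e + 2 * (j + t)
  rearrange = solve-∀

-- The entry with index i has i entries below it on the stack, so its height is its coefficient in
-- `𝐧`. The factor 2 will cancel the halves in the spin.
stack-energy : ∀ {r} (a : Vec ℕ r) → stackEnergy (stack a) ≡ 2 * 𝐧 a
stack-energy []      = refl
stack-energy (i ∷ a) = begin
  stackEnergy (stack (i ∷ a))                ≡⟨ cong stackEnergy (stack-∷ i a) ⟩
  stackEnergy (stack a ++ [ i ])             ≡⟨ stackEnergy-∷ʳ (stack a) i ⟩
  stackEnergy (stack a) + 2 * sum (stack a)  ≡⟨ cong₂ (λ e t → e + 2 * t) (stack-energy a) (stack-sum a) ⟩
  2 * 𝐧 a + 2 * ∣ a ∣                        ≡⟨ *-distribˡ-+ 2 (𝐧 a) ∣ a ∣ ⟨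
  2 * (𝐧 a + ∣ a ∣)                          ≡⟨ cong (2 *_) (+-comm (𝐧 a) ∣ a ∣) ⟩
  2 * (∣ a ∣ + 𝐧 a)                          ≡⟨ cong (2 *_) (∑-+ (lookup a) (λ i → toℕ i * lookup a i)) ⟨
  2 * 𝐧 (i ∷ a)                              ∎

-- The local rule for partitions

scan-length : Scan w κs λs w′ s h → length κs ≡ length λs
scan-length []      = refl
scan-length (_ ∷ σ) = cong suc (scan-length σ)

scan-ones : Scan w κs λs w′ s h → ones w + ones κs ≡ ones λs + ones w′
scan-ones {w} [] = +-identityʳ (ones w)
scan-ones {x ∷ w} (_∷_ {y = y} {z} {x′} {κs = κs} {λs} {w′} α σ) = begin
  ⟦ x ⟧ + ones w + (⟦ y ⟧ + ones κs)      ≡⟨ rearrange ⟦ x ⟧ ⟦ y ⟧ (ones w) (ones κs) ⟩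
  (⟦ x ⟧ + ⟦ y ⟧) + (ones w + ones κs)    ≡⟨ cong (_+ (ones w + ones κs)) (kept α) ⟩
  (⟦ z ⟧ + ⟦ x′ ⟧) + (ones w + ones κs)   ≡⟨ rearrange′ ⟦ z ⟧ ⟦ x′ ⟧ (ones w) (ones κs) ⟩
  ⟦ z ⟧ + (ones w + (⟦ x′ ⟧ + 0) + ones κs) ≡⟨ cong (λ o → ⟦ z ⟧ + (o + ones κs)) (ones-++ w [ x′ ]) ⟨
  ⟦ z ⟧ + (ones (w ∷ʳ x′) + ones κs)      ≡⟨ cong (⟦ z ⟧ +_) (scan-ones σ) ⟩
  ⟦ z ⟧ + (ones λs + ones w′)             ≡⟨ +-assoc ⟦ z ⟧ _ _ ⟨
  ⟦ z ⟧ + ones λs + ones w′               ∎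
  where
  kept : ∀ {x y z x′ c} → Advance x y z x′ c → ⟦ x ⟧ + ⟦ y ⟧ ≡ ⟦ z ⟧ + ⟦ x′ ⟧
  kept stay = refl
  kept move = refl
  rearrange : ∀ a b c d → a + c + (b + d) ≡ (a + b) + (c + d)
  rearrange = solve-∀
  rearrange′ : ∀ a b c d → (a + b) + (c + d) ≡ a + (c + (b + 0) + d)
  rearrange′ = solve-∀

-- A relation rather than a function: existence and uniqueness in each direction are separate
-- lemmas, and each may choose or pad the words as it requires.
record Cell (n : ℕ) (κ lam μ : Partition) (a : Vec ℕ (suc n)) (ν : Partition) : Set where
  field
    {wordκ wordλ wordμ wordν} : Word
    codeκ : wordκ encodes κ
    codeλ : wordλ encodes lam
    codeμ : wordμ encodes μ
    codeν : wordν encodes ν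
    run   : Run (loaded (suc n)) (stack a) wordκ wordλ wordμ wordν (cleared (suc n)) []

  open CellBalance (cellBalance (suc n) (stack-length a) run) public

  stripκλ : κ ⇀[ suc n ] lam
  stripκλ = scan⇒strip scanκλ codeκ codeλ
  stripκμ : κ ⇀[ suc n ] μ
  stripκμ = scan⇒strip scanκμ codeκ codeμ
  stripλν : lam ⇀[ suc n ] ν
  stripλν = scan⇒strip scanλν codeλ codeν
  stripμν : μ ⇀[ suc n ] ν
  stripμν = scan⇒strip scanμν codeμ codeν

scan-grows : ∀ r → Scan (full r) κs λs (empty r) s h → ones λs ≡ r + ones κs
scan-grows {κs} {λs} r σ = begin
  ones λs                   ≡⟨ +-identityʳ _ ⟨
  ones λs + 0               ≡⟨ cong (ones λs +_) (ones-empty r) ⟨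
  ones λs + ones (empty r)  ≡⟨ scan-ones σ ⟨
  ones (full r) + ones κs   ≡⟨ cong (_+ ones κs) (ones-full r) ⟩
  r + ones κs               ∎

height-sum : ∀ {r κ μ} → κ ⇀[ r ] μ → ℕ
height-sum σ = sum (heights (standardisation σ))

-- The given strip yields a scan of the same two words, and the words determine the number of jumps
-- and the beads passed.
strip-balance : ∀ {n} → Scan (full (suc n)) κs λs (empty (suc n)) s h → κs encodes κ → λs encodes lam →
                (σ : κ ⇀[ suc n ] lam) → s ≡ stripSize σ × h ≡ height-sum σ
strip-balance {n = n} σ eκ eλ τ =
    proj₂ (Scan-functional σ (strip⇒scan τ eκ eλ (scan-length σ) (scan-grows (suc n) σ)))

cell-size : ∀ {n a} → Cell n κ lam μ a ν → (σ : κ ⇀[ suc n ] μ) (τ : lam ⇀[ suc n ] ν) →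
            stripSize τ ≡ stripSize σ + ∣ a ∣
cell-size {a = a} C σ τ = begin
  stripSize τ               ≡⟨ proj₁ (strip-balance scanλν codeλ codeν τ) ⟨
  sλν                       ≡⟨ sizeκμ ⟨
  sκμ + sum (stack a)       ≡⟨ cong₂ _+_ (proj₁ (strip-balance scanκμ codeκ codeμ σ)) (stack-sum a) ⟩
  stripSize σ + ∣ a ∣       ∎
  where open Cell C

cell-energy : ∀ {n a} → Cell n κ lam μ a ν →
              (ρ : κ ⇀[ suc n ] lam) (σ : κ ⇀[ suc n ] μ) (τ : lam ⇀[ suc n ] ν) (υ : μ ⇀[ suc n ] ν) →
              height-sum τ + height-sum υ ≡ height-sum ρ + height-sum σ + 2 * 𝐧 a
cell-energy {a = a} C ρ σ τ υ = begin
  height-sum τ + height-sum υ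
    ≡⟨ cong₂ _+_ (proj₂ (strip-balance scanλν codeλ codeν τ)) (proj₂ (strip-balance scanμν codeμ codeν υ)) ⟨
  hλν + hμν
    ≡⟨ energy ⟨
  hκλ + hκμ + stackEnergy (stack a)
    ≡⟨ cong₂ _+_ (cong₂ _+_ (proj₂ (strip-balance scanκλ codeκ codeλ ρ))
        (proj₂ (strip-balance scanκμ codeκ codeμ σ))) (stack-energy a) ⟩
  height-sum ρ + height-sum σ + 2 * 𝐧 a ∎
  where open Cell C

cell-mirror : ∀ {n a} → Cell n κ lam μ a ν → Cell n κ μ lam a ν
cell-mirror {n = n} {a} C = record
  { codeκ = codeκ ; codeλ = codeμ ; codeμ = codeλ ; codeν = codeν
  ; run = subst₂ (λ W W′ → Run W (stack a) wordκ wordμ wordλ wordν W′ []) (mirror-replicate refl (suc n))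
      (mirror-replicate refl (suc n)) (Run-mirror run)
  }
  where
  open Cell C
  mirror-replicate : ∀ {f} → mirror f ≡ f → ∀ r → map mirror (replicate r f) ≡ replicate r f
  mirror-replicate e zero    = refl
  mirror-replicate e (suc r) = cong₂ _∷_ e (mirror-replicate e r)

cell-pad : ∀ {n a} (p q : ℕ) → Cell n κ lam μ a ν → Cell n κ lam μ a ν
cell-pad {n = n} p q C = record
  { codeκ = padded codeκ ; codeλ = padded codeλ ; codeμ = padded codeμ ; codeν = padded codeν
  ; run = padRun p q n run }
  where
  open Cell C
  padded : ∀ {w μ} → w encodes μ → pad p q w encodes μ
  padded e = encodes-full p (encodes-empty q e)

pad-length : ∀ p q w → length (pad p q w) ≡ p + (length w + q)
pad-length p q w = trans (length-++ (full p))
    (cong₂ _+_ (length-replicate p) (trans (length-++ w) (cong (length w +_) (length-replicate q))))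

pad-ones : ∀ p q w → ones (pad p q w) ≡ p + ones w
pad-ones p q w = begin
  ones (full p ++ (w ++ empty q))          ≡⟨ ones-++ (full p) _ ⟩
  ones (full p) + ones (w ++ empty q)      ≡⟨ cong₂ _+_ (ones-full p) (ones-++ w (empty q)) ⟩
  p + (ones w + ones (empty q))            ≡⟨ cong (λ o → p + (ones w + o)) (ones-empty q) ⟩
  p + (ones w + 0)                         ≡⟨ cong (p +_) (+-identityʳ _) ⟩
  p + ones w                               ∎

-- The words of a cell are determined up to padding by its partitions, so two
-- cells can be compared after padding to equal lengths and numbers of beads.
record Aligned {n a b} (C : Cell n κ lam μ a ν) (C₁ : Cell n κ₁ lam₁ μ₁ b ν₁) : Set where
  field
    aligned-length : length (Cell.wordκ C) ≡ length (Cell.wordκ C₁)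
    aligned-ones   : ones (Cell.wordκ C) ≡ ones (Cell.wordκ C₁)

  private
    module C = Cell C
    module C₁ = Cell C₁
    along : ∀ {u u′ v v′} → Scan (full (suc n)) u v (empty (suc n)) s h →
        Scan (full (suc n)) u′ v′ (empty (suc n)) s′ h′ →
            length u ≡ length u′ × ones u ≡ ones u′ → length v ≡ length v′ × ones v ≡ ones v′
    along σ τ (l , o) = trans (sym (scan-length σ)) (trans l (scan-length τ)) ,
                        trans (scan-grows (suc n) σ) (trans (cong (suc n +_) o) (sym (scan-grows (suc n) τ)))

    sameλ = along C.scanκλ C₁.scanκλ (aligned-length , aligned-ones)
    sameμ = along C.scanκμ C₁.scanκμ (aligned-length , aligned-ones)
    sameν = along C.scanλν C₁.scanλν sameλ

  alignκ : κ ≡ κ₁ → C.wordκ ≡ C₁.wordκ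
  alignκ refl = encodes-injective aligned-length aligned-ones C.codeκ C₁.codeκ
  alignλ : lam ≡ lam₁ → C.wordλ ≡ C₁.wordλ
  alignλ refl = encodes-injective (proj₁ sameλ) (proj₂ sameλ) C.codeλ C₁.codeλ
  alignμ : μ ≡ μ₁ → C.wordμ ≡ C₁.wordμ
  alignμ refl = encodes-injective (proj₁ sameμ) (proj₂ sameμ) C.codeμ C₁.codeμ
  alignν : ν ≡ ν₁ → C.wordν ≡ C₁.wordν
  alignν refl = encodes-injective (proj₁ sameν) (proj₂ sameν) C.codeν C₁.codeν

align : ∀ {n a b} → (C : Cell n κ lam μ a ν) (C₁ : Cell n κ₁ lam₁ μ₁ b ν₁) →
        ∃₂ λ (C′ : Cell n κ lam μ a ν) (D′ : Cell n κ₁ lam₁ μ₁ b ν₁) → Aligned C′ D′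
-- Each word receives on the left as many beads as the other has, which makes both totals `oC + oD`.
-- The gaps on the right then bring both lengths to `oC + oD + lC + lD`.
align C C₁ = cell-pad oD (oC + lD) C , cell-pad oC (oD + lC) C₁ , record
  { aligned-length = trans (pad-length oD (oC + lD) (Cell.wordκ C))
      (trans (rearrange oC oD lC lD) (sym (pad-length oC (oD + lC) (Cell.wordκ C₁))))
  ; aligned-ones   = trans (pad-ones oD _ (Cell.wordκ C))
      (trans (+-comm oD oC) (sym (pad-ones oC _ (Cell.wordκ C₁))))
  }
  where
  oC = ones (Cell.wordκ C)
  oD = ones (Cell.wordκ C₁)
  lC = length (Cell.wordκ C)
  lD = length (Cell.wordκ C₁)
  rearrange : ∀ oC oD lC lD → oD + (lC + (oC + lD)) ≡ oC + (lD + (oD + lC))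
  rearrange = solve-∀

rerun : ∀ {W a κs λs μs νs κs′ λs′ μs′ W′ a′} → κs ≡ κs′ → λs ≡ λs′ → μs ≡ μs′ →
        Run W a κs λs μs νs W′ a′ → Run W a κs′ λs′ μs′ νs W′ a′
rerun refl refl refl ρ = ρ

abstract
  cell-functional : ∀ {n a} → Cell n κ lam μ a ν → Cell n κ lam μ a ν₁ → ν ≡ ν₁
  cell-functional {κ = κ} {lam} {μ} {ν} {ν₁} {n} {a} C₀ D₀ = same (align C₀ D₀)
    where
    same : (∃₂ λ (C : Cell n κ lam μ a ν) (C₁ : Cell n κ lam μ a ν₁) → Aligned C C₁) → ν ≡ ν₁
    same (C , C₁ , al) = encodes-functional (subst (_encodes ν) νs≡ C.codeν) C₁.codeν
      where
      module C = Cell C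
      module C₁ = Cell C₁
      open Aligned al
      νs≡ : C.wordν ≡ C₁.wordν
      νs≡ = proj₁ (Run-functional (rerun (alignκ refl) (alignλ refl) (alignμ refl) C.run) C₁.run)

  cell-injective : ∀ {n a b} → Cell n κ lam μ a ν → Cell n κ₁ lam μ b ν → κ ≡ κ₁ × a ≡ b
  cell-injective {κ = κ} {lam} {μ} {ν} {κ₁} {n} {a} {b} C₀ D₀ = same (align C₀ D₀)
    where
    same : (∃₂ λ (C : Cell n κ lam μ a ν) (C₁ : Cell n κ₁ lam μ b ν) → Aligned C C₁) → κ ≡ κ₁ × a ≡ b
    same (C , C₁ , al) = encodes-functional (subst (_encodes κ) (proj₂ (proj₂ runs)) C.codeκ) C₁.codeκ ,
        stack-injective (proj₁ (proj₂ runs))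
      where
      module C = Cell C
      module C₁ = Cell C₁
      open Aligned al
      runs : loaded (suc n) ≡ loaded (suc n) × stack a ≡ stack b × C.wordκ ≡ C₁.wordκ
      runs = Run-injective refl refl (rerun refl (alignλ refl) (alignμ refl) C.run)
               (subst (λ νs → Run _ _ _ _ _ νs _ _) (sym (alignν refl)) C₁.run)

  frame-length : ∀ r u v → length u ≡ length v → length (u ++ empty r) ≡ length (full r ++ v)
  frame-length r u v e = begin
    length (u ++ empty r)           ≡⟨ length-++ u ⟩
    length u + length (empty r)     ≡⟨ cong₂ _+_ e (trans (length-replicate r) (sym (length-replicate r))) ⟩
    length v + length (full r)      ≡⟨ +-comm (length v) _ ⟩
    length (full r) + length v      ≡⟨ length-++ (full r) ⟨
    length (full r ++ v)            ∎

  frame-ones : ∀ r u v → ones u ≡ ones v → ones (full r ++ v) ≡ r + ones (u ++ empty r)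
  frame-ones r u v e = begin
    ones (full r ++ v)           ≡⟨ ones-++ (full r) v ⟩
    ones (full r) + ones v       ≡⟨ cong₂ _+_ (ones-full r) (sym e) ⟩
    r + ones u                   ≡⟨ cong (r +_) (+-identityʳ _) ⟨
    r + (ones u + 0)             ≡⟨ cong (λ o → r + (ones u + o)) (ones-empty r) ⟨
    r + (ones u + ones (empty r)) ≡⟨ cong (r +_) (ones-++ u (empty r)) ⟨
    r + ones (u ++ empty r)      ∎

  -- Words from the same box have equally many beads, whereas a scan needs `suc n` more in the
  -- larger partition than in the smaller. They are put in front of `v`, and gaps behind `u` restore
  -- the equality of lengths.
  framed-scan : ∀ {n A N} (σ : κ ⇀[ suc n ] lam) → ones u ≡ A × length u ≡ N × u encodes κ →
      ones v ≡ A × length v ≡ N × v encodes lam →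
                Scan (full (suc n)) (u ++ empty (suc n)) (full (suc n) ++ v) (empty (suc n)) (stripSize σ)
                    (height-sum σ)
  framed-scan {u = u} {v} {n} σ (o , l , e) (o′ , l′ , e′) =
    strip⇒scan σ (encodes-empty (suc n) e) (encodes-full (suc n) e′)
      (frame-length (suc n) u v (trans l (sym l′))) (frame-ones (suc n) u v (trans o (sym o′)))

  cell-forward : ∀ {n} → κ ⇀[ suc n ] lam → κ ⇀[ suc n ] μ → (a : Vec ℕ (suc n)) → ∃ (Cell n κ lam μ a)
  cell-forward {κ} {lam} {μ} {n} σ τ a = result
    (encode A B κ (λ le → inside-zero {κ} {lam} (≤⇒rows (standardisation σ))
        (beyond lam (≤-trans (m≤m+n _ _) le)))
                  (λ i → ≤-trans (≤⇒rows (standardisation σ) i)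
                      (≤-trans (rowLength-antitone lam z≤n) (m≤m+n _ _))))
    (encode A B lam (λ le → beyond lam (≤-trans (m≤m+n _ _) le)) (λ i →
        ≤-trans (rowLength-antitone lam z≤n) (m≤m+n _ _)))
    (encode A B μ (λ le → beyond μ (≤-trans (m≤n+m _ (length (parts lam))) le)) (λ i →
        ≤-trans (rowLength-antitone μ z≤n) (m≤n+m _ (rowLength lam 0))))
    where
    r A B : ℕ
    r = suc n
    -- A common box for λ and μ, and hence also for κ.
    A = length (parts lam) + length (parts μ)
    B = rowLength lam 0 + rowLength μ 0
    beyond : ∀ μ {i} → length (parts μ) ≤ i → rowLength μ i ≡ 0
    beyond μ le = nth-beyond (parts μ) le
    inside-zero : ∀ {κ μ i} → (∀ i → rowLength κ i ≤ rowLength μ i) → rowLength μ i ≡ 0 → rowLength κ i ≡ 0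
    inside-zero {i = i} sub e = n≤0⇒n≡0 (subst (_ ≤_) e (sub i))
    Code : Partition → Set
    Code μ = ∃ λ w → ones w ≡ A × length w ≡ A + B × w encodes μ
    finish : ∀ {u v w} → u encodes κ → v encodes lam → w encodes μ →
             (∃₂ λ q ns → Run (loaded r) (stack a) ((u ++ empty r) ++ empty q) ((full r ++ v) ++ empty q)
                 ((full r ++ w) ++ empty q) ns (cleared r) []) →
             ∃ (Cell n κ lam μ a)
    finish eu ev ew (q , νs , ρ) = fromWord νs , record
      { codeκ = encodes-empty q (encodes-empty r eu) ; codeλ = encodes-empty q (encodes-full r ev)
      ; codeμ = encodes-empty q (encodes-full r ew) ; codeν = fromWord-encodes νs ; run = ρ }
    result : Code κ → Code lam → Code μ → ∃ (Cell n κ lam μ a)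
    result (u , cu) (v , cv) (w , cw) = finish (proj₂ (proj₂ cu)) (proj₂ (proj₂ cv)) (proj₂ (proj₂ cw))
      (cellForward r (stack-length a) (framed-scan σ cu cv) (framed-scan τ cu cw))

  cell-backward : ∀ {n} → lam ⇀[ suc n ] ν → μ ⇀[ suc n ] ν → ∃₂ λ κ a → Cell n κ lam μ a ν
  cell-backward {lam} {ν} {μ} {n} σ τ = result
    (encode A B ν (nth-beyond (parts ν)) (λ i → rowLength-antitone ν z≤n))
    (within (≤⇒rows (standardisation σ))) (within (≤⇒rows (standardisation τ)))
    where
    r A B : ℕ
    r = suc n
    A = length (parts ν)
    B = rowLength ν 0
    Code : Partition → Set
    Code μ = ∃ λ w → ones w ≡ A × length w ≡ A + B × w encodes μ
    within : ∀ {κ} → (∀ i → rowLength κ i ≤ rowLength ν i) → Code κ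
    within {κ} sub = encode A B κ (λ {i} le →
        n≤0⇒n≡0 (subst (rowLength κ i ≤_) (nth-beyond (parts ν) le) (sub i)))
                                  (λ i → ≤-trans (sub i) (rowLength-antitone ν z≤n))
    finish : ∀ {u v w} → u encodes lam → v encodes μ → w encodes ν →
             (∃₂ λ k s → ∃ λ κs → length s ≡ r × Run (loaded r) s κs (full k ++ (u ++ empty r))
                 (full k ++ (v ++ empty r)) (full k ++ (full r ++ w)) (cleared r) []) →
             ∃₂ λ κ a → Cell n κ lam μ a ν
    finish eu ev ew (k , s , κs , len , ρ) = fromWord κs , proj₁ (unstack s len) , record
      { codeκ = fromWord-encodes κs ; codeλ = encodes-full k (encodes-empty r eu)
      ; codeμ = encodes-full k (encodes-empty r ev) ; codeν = encodes-full k (encodes-full r ew)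
      ; run = subst (λ s → Run _ s _ _ _ _ _ _) (sym (proj₂ (unstack s len))) ρ }
    result : Code ν → Code lam → Code μ → ∃₂ λ κ a → Cell n κ lam μ a ν
    result (w , cw) (u , cu) (v , cv) = finish (proj₂ (proj₂ cu)) (proj₂ (proj₂ cv)) (proj₂ (proj₂ cw))
      (cellBackward r (framed-scan σ cu cw) (framed-scan τ cv cw))

  -- Both strips scan the same pair of framed words.
  strip-unique : ∀ {n} (σ τ : κ ⇀[ suc n ] μ) → stripSize σ ≡ stripSize τ × height-sum σ ≡ height-sum τ
  strip-unique {κ} {μ} {n} σ τ = result (encode A B μ (nth-beyond (parts μ)) (λ i → rowLength-antitone μ z≤n))
    (encode A B κ (λ {i} le → n≤0⇒n≡0 (subst (rowLength κ i ≤_) (nth-beyond (parts μ) le)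
        (≤⇒rows (standardisation σ) i)))
                  (λ i → ≤-trans (≤⇒rows (standardisation σ) i) (rowLength-antitone μ z≤n)))
    where
    A B : ℕ
    A = length (parts μ)
    B = rowLength μ 0
    Code : Partition → Set
    Code μ = ∃ λ w → ones w ≡ A × length w ≡ A + B × w encodes μ
    result : Code μ → Code κ → stripSize σ ≡ stripSize τ × height-sum σ ≡ height-sum τ
    result (v , cv) (u , cu) = proj₂ (Scan-functional (framed-scan σ cu cv) (framed-scan τ cu cv))

-- Growth diagrams

lastOf : ∀ {T : Set} → Vec T (suc k) → T
lastOf (t ∷ [])         = t
lastOf (_ ∷ ts@(_ ∷ _)) = lastOf ts

-- A tableau indexed by its whole sequence of shapes. Equality of tableau pairs is equality of these
-- sequences, and they form the sides of a growth diagram.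
data Strips (r : ℕ) : Vec Partition (suc k) → Set where
  []  : Strips r (κ ∷ [])
  _∷_ : ∀ {ks : Vec Partition k} → κ ⇀[ r ] lam → Strips r (lam ∷ ks) → Strips r (κ ∷ lam ∷ ks)

sizes : ∀ {r} {ks : Vec Partition (suc k)} → Strips r ks → Vec ℕ k
sizes []      = []
sizes (σ ∷ S) = stripSize σ ∷ sizes S

total-height : ∀ {r} {ks : Vec Partition (suc k)} → Strips r ks → ℕ
total-height []      = 0
total-height (σ ∷ S) = height-sum σ + total-height S

trivial-strips : ∀ {r} γ k → Strips r (Vec.replicate (suc k) γ)
trivial-strips γ zero    = []
trivial-strips γ (suc k) = strip ε [] ∷ trivial-strips γ k

sizes-trivial : ∀ {r} γ k j → lookup (sizes (trivial-strips {r} γ k)) j ≡ 0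
sizes-trivial γ (suc k) zero    = refl
sizes-trivial γ (suc k) (suc j) = sizes-trivial γ k j

height-trivial : ∀ {r} γ k → total-height (trivial-strips {r} γ k) ≡ 0
height-trivial γ zero    = refl
height-trivial γ (suc k) = height-trivial γ k

lastOf-replicate : ∀ (γ : Partition) k → lastOf (Vec.replicate (suc k) γ) ≡ γ
lastOf-replicate γ zero    = refl
lastOf-replicate γ (suc k) = lastOf-replicate γ k

sizes-unique : ∀ {n} {ks : Vec Partition (suc k)} (S T : Strips (suc n) ks) → sizes S ≡ sizes T
sizes-unique []      []      = refl
sizes-unique (σ ∷ S) (τ ∷ T) = cong₂ _∷_ (proj₁ (strip-unique σ τ)) (sizes-unique S T)

height-unique : ∀ {n} {ks : Vec Partition (suc k)} (S T : Strips (suc n) ks) → total-height S ≡ total-height T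
height-unique []      []      = refl
height-unique (σ ∷ S) (τ ∷ T) = cong₂ _+_ (proj₂ (strip-unique σ τ)) (height-unique S T)

module Growth (n : ℕ) where
  private
    r = suc n
    variable
      bs ts : Vec Partition (suc k)
      ls rs : Vec Partition (suc m)
      as    : Vec (Vec ℕ (suc n)) k

  -- A row of the growth diagram, with its bottom, its matrix entries and its top;
  -- a grid has bottom, left, top and right sides.
  data Row : ∀ {k} → Vec Partition (suc k) → Vec (Vec ℕ (suc n)) k → Vec Partition (suc k) → Set where
    edge : κ ⇀[ suc n ] lam → Row (κ ∷ []) [] (lam ∷ [])
    _∷_ : ∀ {ks ls : Vec Partition k} {a as} → Cell n κ lam μ a ν → Row (μ ∷ ks) as (ν ∷ ls) →
          Row (κ ∷ μ ∷ ks) (a ∷ as) (lam ∷ ν ∷ ls)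

  data Grid : ∀ {m k} → Vec Partition (suc k) → Matrix (suc n) m k → Vec Partition (suc m) →
              Vec Partition (suc k) → Vec Partition (suc m) → Set where
    edge : Strips (suc n) bs → Grid bs [] (Vec.head bs ∷ []) bs (lastOf bs ∷ [])
    _∷_ : ∀ {A : Matrix (suc n) m k} {as u} → Row bs as ts → Grid ts A ls u rs →
          Grid bs (as ∷ A) (Vec.head bs ∷ ls) u (lastOf bs ∷ rs)

  row-bottom : Row bs as ts → Strips r bs
  row-bottom (edge _)           = []
  row-bottom (C ∷ R) = Cell.stripκμ C ∷ row-bottom R

  row-top : Row bs as ts → Strips r ts
  row-top (edge _)   = []
  row-top (C ∷ R) = Cell.stripλν C ∷ row-top R

  row-left : Row bs as ts → Vec.head bs ⇀[ suc n ] Vec.head ts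
  row-left (edge σ)   = σ
  row-left (C ∷ _) = Cell.stripκλ C

  row-right : Row bs as ts → lastOf bs ⇀[ suc n ] lastOf ts
  row-right (edge σ)               = σ
  row-right (C ∷ R) = row-right R

  grid-bottom : ∀ {A : Matrix (suc n) m k} {bs ls ts rs} → Grid bs A ls ts rs → Strips r bs
  grid-bottom (edge S) = S
  grid-bottom (R ∷ _)  = row-bottom R

  grid-top : ∀ {A : Matrix (suc n) m k} {bs ls ts rs} → Grid bs A ls ts rs → Strips r ts
  grid-top (edge S)   = S
  grid-top (_ ∷ G) = grid-top G

  head-left : ∀ {A : Matrix (suc n) m k} {bs ls ts rs} → Grid bs A ls ts rs → Vec.head ls ≡ Vec.head bs
  head-left (edge _)   = refl
  head-left (_ ∷ _) = refl

  head-right : ∀ {A : Matrix (suc n) m k} {bs ls ts rs} → Grid bs A ls ts rs → Vec.head rs ≡ lastOf bs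
  head-right (edge _)   = refl
  head-right (_ ∷ _) = refl

  last-left : ∀ {A : Matrix (suc n) m k} {bs ls ts rs} → Grid bs A ls ts rs → lastOf ls ≡ Vec.head ts
  last-left (edge _)                   = refl
  last-left (_∷_ {ls = _ ∷ _} _ G) = last-left G

  last-right : ∀ {A : Matrix (suc n) m k} {bs ls ts rs} → Grid bs A ls ts rs → lastOf rs ≡ lastOf ts
  last-right (edge _)                    = refl
  last-right (_∷_ {rs = _ ∷ _} _ G) = last-right G

  grid-left : ∀ {A : Matrix (suc n) m k} {bs ls ts rs} → Grid bs A ls ts rs → Strips r ls
  grid-left (edge _) = []
  grid-left (_∷_ {ls = _ ∷ _} R G) = subst (_ ⇀[ r ]_) (sym (head-left G)) (row-left R) ∷ grid-left G

  grid-right : ∀ {A : Matrix (suc n) m k} {bs ls ts rs} → Grid bs A ls ts rs → Strips r rs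
  grid-right (edge _) = []
  grid-right (_∷_ {rs = _ ∷ _} R G) = subst (_ ⇀[ r ]_) (sym (head-right G)) (row-right R) ∷ grid-right G

  row-forward : ∀ {ks : Vec Partition k} → Strips r (κ ∷ ks) → κ ⇀[ suc n ] lam → ∀ as → ∃ λ ls →
      Row (κ ∷ ks) as (lam ∷ ls)
  row-forward []      τ []       = [] , (edge τ)
  row-forward (σ ∷ S) τ (a ∷ as) with cell-forward τ σ a
  ... | ν , C with row-forward S (Cell.stripμν C) as
  ...   | ls , R = ν ∷ ls , C ∷ R

  grid-forward : ∀ {ks : Vec Partition k} {ls : Vec Partition m} → Strips r (κ ∷ ks) → Strips r (κ ∷ ls) →
                 ∀ A → ∃₂ (Grid (κ ∷ ks) A (κ ∷ ls))
  grid-forward S []      []       = _ , _ , (edge S)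
  grid-forward S (τ ∷ T) (as ∷ A) with row-forward S τ as
  ... | _ , R with grid-forward (row-top R) T A
  ...   | _ , _ , G = _ , _ , R ∷ G

  row-backward : ∀ {ts : Vec Partition (suc k)} → Strips r ts → κ ⇀[ suc n ] lastOf ts → ∃₂ λ bs as →
      Row bs as ts × lastOf bs ≡ κ
  row-backward []      τ = _ , _ , (edge τ) , refl
  row-backward (σ ∷ S) τ with row-backward S τ
  ... | μ ∷ ks , as , R , e with cell-backward σ (row-left R)
  ...   | κ , a , C = κ ∷ μ ∷ ks , a ∷ as , C ∷ R , e

  grid-backward : ∀ {ts : Vec Partition (suc k)} {rs : Vec Partition (suc m)} → Strips r ts →
      Strips r rs → lastOf ts ≡ lastOf rs →
                  ∃₂ λ bs A → ∃ λ ls → Grid bs A ls ts rs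
  grid-backward S [] refl = _ , _ , _ , (edge S)
  grid-backward {ts = ts} S (_∷_ {κ = κ} {lam} τ T) e with grid-backward S T e
  ... | b₁ , A , ls , G with row-backward (grid-bottom G) (subst (κ ⇀[ r ]_) (head-right G) τ)
  ...   | bs , as , R , refl = bs , as ∷ A , Vec.head bs ∷ ls , R ∷ G

  row-functional : ∀ {k bs as} {ts ts′ : Vec Partition (suc k)} → Row bs as ts → Row bs as ts′ →
      Vec.head ts ≡ Vec.head ts′ → ts ≡ ts′
  row-functional (edge _)   (edge _)     refl = refl
  row-functional (C ∷ R) (C′ ∷ R′) refl with cell-functional C C′
  ... | refl with row-functional R R′ refl
  ...   | refl = refl

  grid-functional : ∀ {A : Matrix (suc n) m k} {bs ls ts ts′ rs rs′} → Grid bs A ls ts rs →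
      Grid bs A ls ts′ rs′ → ts ≡ ts′ × rs ≡ rs′
  grid-functional (edge _)   (edge _)     = refl , refl
  grid-functional (R ∷ G) (R′ ∷ G′) with row-functional R R′ (trans (sym (head-left G)) (head-left G′))
  ... | refl with grid-functional G G′
  ...   | refl , refl = refl , refl

  row-injective : ∀ {k as as′} {bs bs′ ts : Vec Partition (suc k)} → Row bs as ts → Row bs′ as′ ts →
      lastOf bs ≡ lastOf bs′ → bs ≡ bs′ × as ≡ as′
  row-injective (edge _)   (edge _)     refl = refl , refl
  row-injective (C ∷ R) (C′ ∷ R′) e with row-injective R R′ e
  ... | refl , refl with cell-injective C C′
  ...   | refl , refl = refl , refl

  grid-injective : ∀ {A A′ : Matrix (suc n) m k} {bs bs′ ls ls′ ts rs rs′} → Grid bs A ls ts rs →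
      Grid bs′ A′ ls′ ts rs′ → rs ≡ rs′ → bs ≡ bs′ × A ≡ A′
  grid-injective (edge _)   (edge _)     _ = refl , refl
  grid-injective (R ∷ G) (R′ ∷ G′) e with Vec.∷-injective e
  ... | e₁ , e₂ with grid-injective G G′ e₂
  ...   | refl , refl with row-injective R R′ e₁
  ...     | refl , refl = refl , refl

  -- `Vec.replicate _ _∷_ ⊛ as ⊛ AT` is what `transpose` unfolds to on a matrix with first row `as`.
  -- The bottom row of the diagram, with each cell mirrored, becomes the first column.
  grid-column : ∀ {ls : Vec Partition (suc m)} {AT ts rs u} {bs : Vec Partition (suc k)} {as} →
                Row bs as ts → Grid ls AT ts rs u →
                Grid (Vec.head bs ∷ ls) (Vec.replicate _ _∷_ ⊛ as ⊛ AT) bs (lastOf bs ∷ rs) u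
  grid-column {ls = _ ∷ _} (edge τ)   (edge S) = (edge (τ ∷ S))
  grid-column (C ∷ R) (_∷_ {bs = _ ∷ _} {ts = _ ∷ _} R′ G) with head-left G
  ... | refl = (cell-mirror C ∷ R′) ∷ grid-column R G

  transpose-[] : ∀ {bs : Vec Partition (suc k)} → Strips r bs →
      Grid (Vec.head bs ∷ []) (Vec.replicate k []) bs (lastOf bs ∷ []) bs
  transpose-[] []      = (edge [])
  transpose-[] (σ ∷ S) = (edge σ) ∷ transpose-[] S

  grid-transpose : ∀ {A : Matrix (suc n) m k} {bs ls ts rs} → Grid bs A ls ts rs →
      Grid ls (transpose A) bs rs ts
  grid-transpose (edge S)   = transpose-[] S
  grid-transpose (R ∷ G) = grid-column R (grid-transpose G)

  -- `S` and `T` are arbitrary strips along the given shapes, since a tableau brings witnesses of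
  -- its own rather than those stored in the cells.
  row-sizes : ∀ {bs ts : Vec Partition (suc k)} {as} → Row bs as ts →
      (S : Strips r bs) (T : Strips r ts) → ∀ j →
              lookup (sizes T) j ≡ lookup (sizes S) j + ∣ lookup as j ∣
  row-sizes (C ∷ R) (σ ∷ S) (τ ∷ T) zero    = cell-size C σ τ
  row-sizes (C ∷ R) (σ ∷ S) (τ ∷ T) (suc j) = row-sizes R S T j

  grid-sizes : ∀ {A : Matrix (suc n) m k} {bs ls ts rs} → Grid bs A ls ts rs →
      (S : Strips r bs) (T : Strips r ts) → ∀ j →
               lookup (sizes T) j ≡ lookup (sizes S) j + ∑ (λ i → ∣ entry A i j ∣)
  grid-sizes (edge _) S T j = trans (cong (λ s → lookup s j) (sizes-unique T S)) (sym (+-identityʳ _))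
  grid-sizes {A = as ∷ A} (R ∷ G) S T j = begin
    lookup (sizes T) j                                              ≡⟨ grid-sizes G (row-top R) T j ⟩
    lookup (sizes (row-top R)) j + ∑ (λ i → ∣ entry A i j ∣)
        ≡⟨ cong (_+ ∑ (λ i → ∣ entry A i j ∣)) (row-sizes R S (row-top R) j) ⟩
    lookup (sizes S) j + ∣ lookup as j ∣ + ∑ (λ i → ∣ entry A i j ∣)   ≡⟨ +-assoc (lookup (sizes S) j) _ _ ⟩
    lookup (sizes S) j + (∣ lookup as j ∣ + ∑ (λ i → ∣ entry A i j ∣)) ∎

  row-size : ∀ {bs ts : Vec Partition (suc k)} {as} → Row bs as ts →
      (ρ : Vec.head bs ⇀[ suc n ] Vec.head ts) (υ : lastOf bs ⇀[ suc n ] lastOf ts) →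
             stripSize υ ≡ stripSize ρ + ∑ (λ j → ∣ lookup as j ∣)
  row-size (edge _)   ρ υ = trans (proj₁ (strip-unique υ ρ)) (sym (+-identityʳ _))
  row-size {as = a ∷ as} (C ∷ R) ρ υ = begin
    stripSize υ                                                  ≡⟨ row-size R (Cell.stripμν C) υ ⟩
    stripSize (Cell.stripμν C) + ∑ (λ j → ∣ lookup as j ∣)
        ≡⟨ cong (_+ ∑ (λ j → ∣ lookup as j ∣)) (cell-size (cell-mirror C) ρ (Cell.stripμν C)) ⟩
    stripSize ρ + ∣ a ∣ + ∑ (λ j → ∣ lookup as j ∣)              ≡⟨ +-assoc (stripSize ρ) _ _ ⟩
    stripSize ρ + (∣ a ∣ + ∑ (λ j → ∣ lookup as j ∣))            ∎

  -- The right side of a cell is the left side of the next one, so the heights of the strips inside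
  -- the row cancel.
  row-height : ∀ {bs ts : Vec Partition (suc k)} {as} → Row bs as ts → (S : Strips r bs) (T : Strips r ts)
               (ρ : Vec.head bs ⇀[ suc n ] Vec.head ts) (υ : lastOf bs ⇀[ suc n ] lastOf ts) →
               total-height T + height-sum υ ≡ total-height S + height-sum ρ + 2 * ∑ (λ j → 𝐧 (lookup as j))
  row-height (edge _) [] [] ρ υ = trans (proj₂ (strip-unique υ ρ)) (sym (+-identityʳ _))
  row-height {as = a ∷ as} (C ∷ R) (σ ∷ S) (τ ∷ T) ρ υ = combine (height-sum τ) (total-height T)
      (height-sum υ) (total-height S) (height-sum μν)
      (height-sum ρ) (height-sum σ) (𝐧 a) (∑ (λ j → 𝐧 (lookup as j))) (row-height R S T μν υ)
          (cell-energy C ρ σ τ μν)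
    where
    μν = Cell.stripμν C
    combine : ∀ τ T υ S μν ρ σ x y → T + υ ≡ S + μν + 2 * y → τ + μν ≡ ρ + σ + 2 * x →
        τ + T + υ ≡ σ + S + ρ + 2 * (x + y)
    combine τ T υ S μν ρ σ x y e₁ e₂ = begin
      τ + T + υ                   ≡⟨ +-assoc τ T υ ⟩
      τ + (T + υ)                 ≡⟨ cong (τ +_) e₁ ⟩
      τ + (S + μν + 2 * y)        ≡⟨ rearrange τ S μν y ⟩
      τ + μν + (S + 2 * y)        ≡⟨ cong (_+ (S + 2 * y)) e₂ ⟩
      ρ + σ + 2 * x + (S + 2 * y) ≡⟨ rearrange′ ρ σ x S y ⟩
      σ + S + ρ + 2 * (x + y)     ∎
      where
      rearrange : ∀ a bs c d → a + (bs + c + 2 * d) ≡ a + c + (bs + 2 * d)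
      rearrange = solve-∀
      rearrange′ : ∀ ρ σ x S y → ρ + σ + 2 * x + (S + 2 * y) ≡ σ + S + ρ + 2 * (x + y)
      rearrange′ = solve-∀

  grid-height : ∀ {A : Matrix (suc n) m k} {bs ls ts rs} → Grid bs A ls ts rs →
                (S : Strips r bs) (V : Strips r ls) (T : Strips r ts) (U : Strips r rs) →
                total-height T + total-height U ≡ total-height S + total-height V + 2 * ∑ (λ i →
                    ∑ (λ j → 𝐧 (entry A i j)))
  grid-height (edge _) S [] T [] = trans (cong (_+ 0) (height-unique T S)) (sym (+-identityʳ _))
  grid-height {A = as ∷ A} (_∷_ {ls = _ ∷ _} {rs = _ ∷ _} R G) S (ρ ∷ V) T (υ ∷ U) =
      go (head-left G) (head-right G) ρ υ
    where
    go : ∀ {x y} → x ≡ _ → y ≡ _ → (ρ : _ ⇀[ suc n ] x) (υ : _ ⇀[ suc n ] y) →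
        total-height T + (height-sum υ + total-height U) ≡
         total-height S + (height-sum ρ + total-height V) + 2 * ∑ (λ i → ∑ (λ j → 𝐧 (entry (as ∷ A) i j)))
    go refl refl ρ υ = combine (total-height T) (height-sum υ) (total-height U) (total-height S)
        (height-sum ρ) (total-height V)
      (total-height (row-top R)) (∑ (λ j → 𝐧 (lookup as j))) (∑ (λ i → ∑ (λ j → 𝐧 (entry A i j))))
          (row-height R S (row-top R) ρ υ) (grid-height G (row-top R) V T U)
      where
      combine : ∀ T υ U S ρ V K x y → K + υ ≡ S + ρ + 2 * x → T + U ≡ K + V + 2 * y →
          T + (υ + U) ≡ S + (ρ + V) + 2 * (x + y)
      combine T υ U S ρ V K x y e₁ e₂ = begin
        T + (υ + U)                   ≡⟨ rearrange T υ U ⟩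
        T + U + υ                     ≡⟨ cong (_+ υ) e₂ ⟩
        K + V + 2 * y + υ             ≡⟨ rearrange′ K V y υ ⟩
        K + υ + (V + 2 * y)           ≡⟨ cong (_+ (V + 2 * y)) e₁ ⟩
        S + ρ + 2 * x + (V + 2 * y)   ≡⟨ rearrange″ S ρ x V y ⟩
        S + (ρ + V) + 2 * (x + y)     ∎
        where
        rearrange : ∀ T υ U → T + (υ + U) ≡ T + U + υ
        rearrange = solve-∀
        rearrange′ : ∀ K V y υ → K + V + 2 * y + υ ≡ K + υ + (V + 2 * y)
        rearrange′ = solve-∀
        rearrange″ : ∀ S ρ x V y → S + ρ + 2 * x + (V + 2 * y) ≡ S + (ρ + V) + 2 * (x + y)
        rearrange″ = solve-∀

  grid-column-sizes : ∀ {A : Matrix (suc n) m k} {bs ls ts rs} → Grid bs A ls ts rs →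
      (V : Strips r ls) (U : Strips r rs) → ∀ i →
                      lookup (sizes U) i ≡ lookup (sizes V) i + ∑ (λ j → ∣ entry A i j ∣)
  grid-column-sizes (_∷_ {ls = _ ∷ _} {rs = _ ∷ _} R G) (ρ ∷ V) (υ ∷ U) (suc i) = grid-column-sizes G V U i
  grid-column-sizes {A = as ∷ _} (_∷_ {ls = _ ∷ _} {rs = _ ∷ _} R G) (ρ ∷ V) (υ ∷ U) zero =
      go (head-left G) (head-right G) ρ υ
    where
    go : ∀ {x y} → x ≡ _ → y ≡ _ → (ρ : _ ⇀[ suc n ] x) (υ : _ ⇀[ suc n ] y) →
        stripSize υ ≡ stripSize ρ + ∑ (λ j → ∣ lookup as j ∣)
    go refl refl ρ υ = row-size R ρ υ

private variable
  r : ℕ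

-- Spin as half a height, and tableaux as sides of a diagram

half-+ : ∀ i j → (ℤ.+ i ℚ./ 2) ℚ.+ (ℤ.+ j ℚ./ 2) ≡ ℤ.+ (i + j) ℚ./ 2
half-+ i j = ℚ.toℚᵘ-injective (ℚᵘ.≃-trans (ℚ.toℚᵘ-homo-+ (ℤ.+ i ℚ./ 2) (ℤ.+ j ℚ./ 2))
  (ℚᵘ.≃-trans (ℚᵘ.+-cong (ℚ.toℚᵘ-fromℚᵘ (mkℚᵘ (ℤ.+ i) 1)) (ℚ.toℚᵘ-fromℚᵘ (mkℚᵘ (ℤ.+ j) 1)))
  (ℚᵘ.≃-trans (*≡* same) (ℚᵘ.≃-sym (ℚ.toℚᵘ-fromℚᵘ (mkℚᵘ (ℤ.+ (i + j)) 1))))))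
  where
  identity : ∀ x y → (x ℤ.* ℤ.+ 2 ℤ.+ y ℤ.* ℤ.+ 2) ℤ.* ℤ.+ 2 ≡ (x ℤ.+ y) ℤ.* ℤ.+ 4
  identity = ℤ.solve-∀
  same : (ℤ.+ i ℤ.* ℤ.+ 2 ℤ.+ ℤ.+ j ℤ.* ℤ.+ 2) ℤ.* ℤ.+ 2 ≡ ℤ.+ (i + j) ℤ.* ℤ.+ 4
  same = trans (identity (ℤ.+ i) (ℤ.+ j)) (cong (ℤ._* ℤ.+ 4) (sym (ℤ.pos-+ i j)))

half-double : ∀ i → ℤ.+ (2 * i) ℚ./ 2 ≡ ℤ.+ i ℚ./ 1
half-double i = ℚ.fromℚᵘ-cong {mkℚᵘ (ℤ.+ (2 * i)) 1} {mkℚᵘ (ℤ.+ i) 0}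
  (*≡* (trans (ℤ.*-identityʳ _) (trans (ℤ.pos-* 2 i) (ℤ.*-comm (ℤ.+ 2) (ℤ.+ i)))))

fromStrips : ∀ {b : Vec Partition (suc k)} → Strips r b → Tableau r k (Vec.head b) (lastOf b)
fromStrips []      = []
fromStrips (σ ∷ S) = σ ∷ fromStrips S

shapes-fromStrips : ∀ {b : Vec Partition (suc k)} (S : Strips r b) → shapes (fromStrips S) ≡ b
shapes-fromStrips []      = refl
shapes-fromStrips (σ ∷ S) = cong (_ ∷_) (shapes-fromStrips S)

toStrips : (T : Tableau r k κ μ) → Strips r (shapes T)
toStrips []                = []
toStrips (σ ∷ [])          = σ ∷ []
toStrips (σ ∷ T@(_ ∷ _))   = σ ∷ toStrips T

head-shapes : (T : Tableau r k κ μ) → Vec.head (shapes T) ≡ κ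
head-shapes []      = refl
head-shapes (_ ∷ _) = refl

last-shapes : (T : Tableau r k κ μ) → lastOf (shapes T) ≡ μ
last-shapes []              = refl
last-shapes (_ ∷ [])        = refl
last-shapes (_ ∷ T@(_ ∷ _)) = last-shapes T

sizes-toStrips : (T : Tableau r k κ μ) → sizes (toStrips T) ≡ wt T
sizes-toStrips []              = refl
sizes-toStrips (_ ∷ [])        = refl
sizes-toStrips (_ ∷ T@(_ ∷ _)) = cong (_ ∷_) (sizes-toStrips T)

spin-toStrips : (T : Tableau r k κ μ) → spin T ≡ ℤ.+ total-height (toStrips T) ℚ./ 2
spin-toStrips []              = refl
spin-toStrips (σ ∷ [])        = half-+ (height-sum σ) 0
spin-toStrips (σ ∷ T@(_ ∷ _)) = trans (cong (stripSpin σ ℚ.+_) (spin-toStrips T)) (half-+ (height-sum σ) _)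

tableau-above : Tableau r k κ μ → κ ≤[ r ] μ
tableau-above []      = ε
tableau-above (σ ∷ T) = standardisation σ ◅◅ tableau-above T

retype : κ ≡ κ₁ → μ ≡ μ₁ → Tableau r k κ μ → Tableau r k κ₁ μ₁
retype refl refl T = T

shapes-retype : (e : κ ≡ κ₁) (e′ : μ ≡ μ₁) (T : Tableau r k κ μ) → shapes (retype e e′ T) ≡ shapes T
shapes-retype refl refl T = refl

-- From the far end backwards, each shape lies below the core in the ribbon order and hence equals
-- it. A diagram grown backwards from a pair of tableaux has bottom and left sides ending in γ, so
-- this makes both of them constant.
core-constant : ∀ {b : Vec Partition (suc k)} → IsCore r γ → Strips r b → lastOf b ≡ γ → b ≡ Vec.replicate _ γ
core-constant core []      refl = refl
core-constant core (σ ∷ S) e with core-constant core S e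
... | refl = cong (_∷ _) (core _ (standardisation σ))

-- The correspondence between matrices and pairs of tableaux

module Correspondence (n : ℕ) (γ : Partition) (core : IsCore (suc n) γ) where
  open Growth n

  private
    base : ∀ k → Vec Partition (suc k)
    base k = Vec.replicate (suc k) γ

  -- P is the top side of the diagram and Q its right side. Only the shapes of the tableaux enter,
  -- so the relation respects equality of pairs.
  Knuth : ∀ {m k} → Matrix (suc n) m k → TableauPair (suc n) γ m k → Set
  Knuth {m} {k} A x = Grid (base k) A (base m) (shapes (P x)) (shapes (Q x))

  private
    fromGrid : ∀ {m k} {A : Matrix (suc n) m k} {t rs} → Grid (base k) A (base m) t rs → ∃ (Knuth A)
    fromGrid {m} {k} {A} {t} {rs} G = pair (tableau-above T) T U ,
      subst₂ (Grid (base k) A (base m))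
        (sym (trans (shapes-retype _ _ (fromStrips (grid-top G))) (shapes-fromStrips (grid-top G))))
        (sym (trans (shapes-retype _ _ (fromStrips (grid-right G))) (shapes-fromStrips (grid-right G)))) G
      where
      T : Tableau (suc n) k γ (lastOf t)
      T = retype (trans (sym (last-left G)) (lastOf-replicate γ m)) refl (fromStrips (grid-top G))
      U : Tableau (suc n) m γ (lastOf t)
      U = retype (trans (head-right G) (lastOf-replicate γ k)) (last-right G) (fromStrips (grid-right G))

  abstract
    knuth : ∀ {m k} (A : Matrix (suc n) m k) → ∃ (Knuth A)
    knuth {m} {k} A = fromGrid (proj₂ (proj₂ (grid-forward (trivial-strips γ k) (trivial-strips γ m) A)))

    knuth⁻¹ : ∀ {m k} (x : TableauPair (suc n) γ m k) → ∃ λ A → Knuth A x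
    knuth⁻¹ {m} {k} (pair _ T U) = finish (grid-backward (toStrips T) (toStrips U)
        (trans (last-shapes T) (sym (last-shapes U))))
      where
      finish : (∃₂ λ b A → ∃ λ l → Grid b A l (shapes T) (shapes U)) → ∃ λ A →
          Grid (base k) A (base m) (shapes T) (shapes U)
      finish (b , A , l , G) = A , subst₂ (λ b l → Grid b A l (shapes T) (shapes U))
        (core-constant core (grid-bottom G) (trans (sym (head-right G)) (head-shapes U)))
        (core-constant core (grid-left G) (trans (last-left G) (head-shapes T))) G

  knuth-≈ : ∀ {m k} {A : Matrix (suc n) m k} x y → Setoid._≈_ (TableauPairs (suc n) γ m k) x y →
      Knuth A x → Knuth A y
  knuth-≈ x y (e , e′) = subst₂ (Grid _ _ _) e e′

  bijection : ∀ m k → Bijection (setoid (Matrix (suc n) m k)) (TableauPairs (suc n) γ m k)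
  bijection m k = record
    { to        = λ A → proj₁ (knuth A)
    ; cong      = λ { refl → refl , refl }
    ; bijective = (λ {A} {B} e → proj₂
        (grid-injective (knuth-≈ (proj₁ (knuth A)) (proj₁ (knuth B)) e (proj₂ (knuth A)))
                                  (proj₂ (knuth B)) refl)) ,
                  λ x → proj₁ (knuth⁻¹ x) , λ { refl → grid-functional (proj₂ (knuth (proj₁ (knuth⁻¹ x))))
                      (proj₂ (knuth⁻¹ x)) }
    }

  knuth-wt-P : ∀ {m k} {A : Matrix (suc n) m k} x → Knuth A x →
      wt (P x) ≡ tabulate (λ j → ∑ (λ i → ∣ entry A i j ∣))
  knuth-wt-P {k = k} {A} x G = trans (sym (Vec.tabulate∘lookup (wt (P x)))) (Vec.tabulate-cong λ j →
    trans (cong (λ w → lookup w j) (sym (sizes-toStrips (P x))))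
      (trans (grid-sizes G (trivial-strips γ k) (toStrips (P x)) j) (cong (_+ _) (sizes-trivial γ k j))))

  knuth-wt-Q : ∀ {m k} {A : Matrix (suc n) m k} x → Knuth A x →
      wt (Q x) ≡ tabulate (λ i → ∑ (λ j → ∣ entry A i j ∣))
  knuth-wt-Q {m} {A = A} x G = trans (sym (Vec.tabulate∘lookup (wt (Q x)))) (Vec.tabulate-cong λ i →
    trans (cong (λ w → lookup w i) (sym (sizes-toStrips (Q x))))
      (trans (grid-column-sizes G (trivial-strips γ m) (toStrips (Q x)) i) (cong (_+ _) (sizes-trivial γ m i))))

  knuth-spin : ∀ {m k} {A : Matrix (suc n) m k} x → Knuth A x →
               spin (P x) ℚ.+ spin (Q x) ≡ ℤ.+ ∑ (λ i → ∑ (λ j → 𝐧 (entry A i j))) ℚ./ 1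
  knuth-spin {m} {k} {A} x G = begin
    spin (P x) ℚ.+ spin (Q x)
        ≡⟨ cong₂ ℚ._+_ (spin-toStrips (P x)) (spin-toStrips (Q x)) ⟩
    (ℤ.+ hP ℚ./ 2) ℚ.+ (ℤ.+ hQ ℚ./ 2)                ≡⟨ half-+ hP hQ ⟩
    ℤ.+ (hP + hQ) ℚ./ 2                              ≡⟨ cong (λ h → ℤ.+ h ℚ./ 2) heights≡ ⟩
    ℤ.+ (2 * N) ℚ./ 2                                ≡⟨ half-double N ⟩
    ℤ.+ N ℚ./ 1                                      ∎
    where
    hP = total-height (toStrips (P x))
    hQ = total-height (toStrips (Q x))
    N  = ∑ (λ i → ∑ (λ j → 𝐧 (entry A i j)))
    heights≡ : hP + hQ ≡ 2 * N
    heights≡ = trans (grid-height G (trivial-strips γ k) (trivial-strips γ m) (toStrips (P x)) (toStrips (Q x)))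
      (cong₂ (λ h h′ → h + h′ + 2 * N) (height-trivial γ k) (height-trivial γ m))

  knuth-transpose : ∀ {m k} {A : Matrix (suc n) m k} x → Knuth A x → Knuth (transpose A) (swapPair x)
  knuth-transpose x G = grid-transpose G

open import Data.Integer.Base using (+_)

corollary5p2p8 :
  (r : ℕ) .{{_ : NonZero r}} (γ : Partition) → IsCore r γ →
  ∃ λ (Φ : ∀ m n → Bijection (setoid (Matrix r m n)) (TableauPairs r γ m n)) →
    let Corresponds : ∀ m n → Matrix r m n → TableauPair r γ m n → Set
        Corresponds m n A PQ = Setoid._≈_ (TableauPairs r γ m n) (Bijection.to (Φ m n) A) PQ
    in
    (∀ m n (A : Matrix r m n) (PQ : TableauPair r γ m n) → Corresponds m n A PQ →
        wt (P PQ) ≡ tabulate (λ j → ∑ (λ i → ∣ entry A i j ∣))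
      × wt (Q PQ) ≡ tabulate (λ i → ∑ (λ j → ∣ entry A i j ∣))
      × spin (P PQ) ℚ.+ spin (Q PQ) ≡ + ∑ (λ i → ∑ (λ j → 𝐧 (entry A i j))) ℚ./ 1)
    × (∀ m n (A : Matrix r m n) (PQ : TableauPair r γ m n) → Corresponds m n A PQ →
        Corresponds n m (transpose A) (swapPair PQ))
corollary5p2p8 zero    γ core = contradiction refl (≢-nonZero⁻¹ 0)
corollary5p2p8 (suc r) γ core = bijection ,
  (λ m n A PQ e → let G = knuth-≈ (proj₁ (knuth A)) PQ e (proj₂ (knuth A)) in knuth-wt-P PQ G ,
      knuth-wt-Q PQ G , knuth-spin PQ G) ,
  -- The transposed diagram has top and right sides exchanged. It has the same bottom, left side and
  -- entries as the diagram that defines the image of `transpose A`, so the two coincide.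
  (λ m n A PQ e → grid-functional (proj₂ (knuth (transpose A)))
      (knuth-transpose PQ (knuth-≈ (proj₁ (knuth A)) PQ e (proj₂ (knuth A)))))
  where
  open Correspondence r γ core
  open Growth r
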